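{- Let $\Sigma\in\mathcal{G}_n$ and let $Q_0$ be the unique regular rational orthogonal matrix with $Q_0^{\rm T}S(\Sigma)Q_0=S(\Sigma^{\rm T})$, with level $\ell_0$. Suppose that $\ell_0=p_1p_2\cdots p_t$, where the $p_i$ are distinct odd primes, for some $t\ge 0$. Then the number of generalized cospectral mates of $\Sigma$ (counted up to isomorphism) is at most $2^t-1$.
   Context: An oriented graph $\Sigma$ on vertices $v_1,\dots,v_n$ is a simple graph with each edge given a direction. Its skew-adjacency matrix $S(\Sigma)=(s_{ij})$ has $s_{ij}=1$ if $(v_i,v_j)$ is an arc, $s_{ij}=-1$ if $(v_j,v_i)$ is an arc, and $0$ otherwise. The converse $\Sigma^{\rm T}$ is obtained by reversing every arc, so $S(\Sigma^{\rm T})=S(\Sigma)^{\rm T}=-S(\Sigma)$. Two oriented graphs $\Sigma,\Delta$ are isomorphic if $P^{\rm T}S(\Sigma)P=S(\Delta)$ for some permutation matrix $P$. They are generalized cospectral if $S(\Sigma)$ and $S(\Delta)$ have the same spectrum and $J-I-S(\Sigma)$ and $J-I-S(\Delta)$ have the same spectrum ($J$ the all-one matrix, $I$ the identity). A generalized cospectral mate of $\Sigma$ is an oriented graph generalized cospectral with $\Sigma$ but not isomorphic to $\Sigma$. The skew-walk matrix is $W(\Sigma)=[e,Se,\dots,S^{n-1}e]$ with $S=S(\Sigma)$ and $e$ the all-one vector. $\mathcal{G}_n$ is the set of $n$-vertex oriented graphs $\Sigma$ such that $2^{ -\lfloor n/2\rfloor}\det W(\Sigma)$ is an odd square-free integer.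 A rational orthogonal matrix $Q$ is regular if $Qe=e$; its level is the smallest positive integer $k$ with $kQ$ integral. For $\Sigma$ with $\det W(\Sigma)\neq 0$, there is a unique regular rational orthogonal matrix $Q_0$ with $Q_0^{\rm T}S(\Sigma)Q_0=S(\Sigma^{\rm T})$. -}

module Defs where

open import Data.Nat as ℕ using (ℕ; zero; suc; _≤_; _<_; _^_; _∸_)
open import Data.Nat.DivMod using (_/_)
open import Data.Nat.Primality using (Prime)
open import Data.Integer as ℤ using (ℤ; +_)
open import Data.Rational as ℚ using (ℚ)
open import Data.Fin using (Fin; zero; suc; punchIn; toℕ; _≟_)
open import Data.Fin.Permutation using (Permutation; _⟨$⟩ʳ_)
open import Data.List as List using (List; []; _∷_; length)
open import Data.Nat.ListAction using (product)
open import Data.List.Relation.Unary.All using (All)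
open import Data.List.Relation.Unary.AllPairs using (AllPairs)
open import Data.List.Relation.Unary.Unique.Propositional using (Unique)
open import Data.Product using (Σ; ∃; _×_; _,_)
open import Data.Sum using (_⊎_)
open import Relation.Binary.PropositionalEquality using (_≡_)
open import Relation.Nullary using (¬_; does)
open import Data.Bool using (if_then_else_)
import Data.Nat.Divisibility as ℕD
import Data.Integer.Divisibility as ℤD

record RingOps (A : Set) : Set where
  field
    0r 1r : A
    _+r_ _*r_ : A → A → A
    -r_ : A → A

module _ {A : Set} (R : RingOps A) where
  open RingOps R

  sumR : (n : ℕ) → (Fin n → A) → A
  sumR zero    f = 0r
  sumR (suc n) f = f zero +r sumR n (λ i → f (suc i))

  signR : ℕ → A → A
  signR zero    a = a
  signR (suc k) a = -r (signR k a)

  detR : (n : ℕ) → (Fin n → Fin n → A) → A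
  detR zero    M = 1r
  detR (suc n) M =
    sumR (suc n) (λ j → signR (toℕ j) (M zero j *r detR n (λ i k → M (suc i) (punchIn j k))))

-- Integers and integer polynomials (little-endian coefficient lists)

ℤops : RingOps ℤ
ℤops = record { 0r = + 0 ; 1r = + 1 ; _+r_ = ℤ._+_ ; _*r_ = ℤ._*_ ; -r_ = λ a → ℤ.- a }

Poly : Set
Poly = List ℤ

polyAdd : Poly → Poly → Poly
polyAdd []       q        = q
polyAdd (a ∷ p)  []       = a ∷ p
polyAdd (a ∷ p)  (b ∷ q)  = (a ℤ.+ b) ∷ polyAdd p q

polyScale : ℤ → Poly → Poly
polyScale c = List.map (c ℤ.*_)

polyMul : Poly → Poly → Poly
polyMul []      q = []
polyMul (a ∷ p) q = polyAdd (polyScale a q) (+ 0 ∷ polyMul p q)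

polyNeg : Poly → Poly
polyNeg = List.map (λ a → ℤ.- a)

normPoly : Poly → Poly
normPoly []      = []
normPoly (a ∷ p) with normPoly p
... | []    = if does (a ℤ.≟ + 0) then [] else a ∷ []
... | b ∷ q = a ∷ b ∷ q

polyOps : RingOps Poly
polyOps = record { 0r = [] ; 1r = + 1 ∷ [] ; _+r_ = polyAdd ; _*r_ = polyMul ; -r_ = polyNeg }

Mat : ℕ → Set
Mat n = Fin n → Fin n → ℤ

detℤ : (n : ℕ) → Mat n → ℤ
detℤ n = detR ℤops n

charPoly : (n : ℕ) → Mat n → Poly
charPoly n A = normPoly (detR polyOps n M)
  where
  M : Fin n → Fin n → Poly
  M i j = if does (i ≟ j) then (ℤ.- A i j) ∷ + 1 ∷ [] else (ℤ.- A i j) ∷ []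

-- same spectrum (eigenvalues with multiplicity) = same characteristic polynomial
SameSpectrum : (n : ℕ) → Mat n → Mat n → Set
SameSpectrum n A B = charPoly n A ≡ charPoly n B

-- Oriented graphs via their skew-adjacency matrices

record OGraph (n : ℕ) : Set where
  field
    S       : Mat n
    entries : ∀ i j → (S i j ≡ + 1) ⊎ (S i j ≡ + 0) ⊎ (S i j ≡ ℤ.- (+ 1))
    skew    : ∀ i j → S i j ≡ ℤ.- S j i
open OGraph public

JIS : (n : ℕ) → OGraph n → Mat n
JIS n Γ i j = (if does (i ≟ j) then + 0 else + 1) ℤ.- S Γ i j

Isomorphic : (n : ℕ) → OGraph n → OGraph n → Set
Isomorphic n Γ Δ = ∃ λ (π : Permutation n n) → ∀ i j → S Δ i j ≡ S Γ (π ⟨$⟩ʳ i) (π ⟨$⟩ʳ j)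

GenCospectral : (n : ℕ) → OGraph n → OGraph n → Set
GenCospectral n Γ Δ = SameSpectrum n (S Γ) (S Δ) × SameSpectrum n (JIS n Γ) (JIS n Δ)

GenCospectralMate : (n : ℕ) → OGraph n → OGraph n → Set
GenCospectralMate n Γ Δ = GenCospectral n Γ Δ × ¬ Isomorphic n Γ Δ

matVec : (n : ℕ) → Mat n → (Fin n → ℤ) → (Fin n → ℤ)
matVec n A v i = sumR ℤops n (λ j → A i j ℤ.* v j)

powVec : (n : ℕ) → Mat n → ℕ → (Fin n → ℤ)
powVec n A zero    = λ _ → + 1
powVec n A (suc k) = matVec n A (powVec n A k)

walkMatrix : (n : ℕ) → OGraph n → Mat n
walkMatrix n Γ i k = powVec n (S Γ) (toℕ k) i

OddSquareFree : ℤ → Set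
OddSquareFree m = ¬ (+ 2 ℤD.∣ m) × (∀ (d : ℕ) → (d ℕ.* d) ℕD.∣ ℤ.∣ m ∣ → d ≡ 1)

InG : (n : ℕ) → OGraph n → Set
InG n Γ = ∃ λ (m : ℤ) → (detℤ n (walkMatrix n Γ) ≡ (+ (2 ^ (n / 2))) ℤ.* m) × OddSquareFree m

QMat : ℕ → Set
QMat n = Fin n → Fin n → ℚ

ℚops : RingOps ℚ
ℚops = record { 0r = ℚ.0ℚ ; 1r = ℚ.1ℚ ; _+r_ = ℚ._+_ ; _*r_ = ℚ._*_ ; -r_ = λ a → ℚ.- a }

toℚ : ℤ → ℚ
toℚ z = z ℚ./ 1

mulQ : (n : ℕ) → QMat n → QMat n → QMat n
mulQ n A B i j = sumR ℚops n (λ k → A i k ℚ.* B k j)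

transposeQ : (n : ℕ) → QMat n → QMat n
transposeQ n A i j = A j i

idQ : (n : ℕ) → QMat n
idQ n i j = if does (i ≟ j) then ℚ.1ℚ else ℚ.0ℚ

OrthogonalQ : (n : ℕ) → QMat n → Set
OrthogonalQ n Q = ∀ i j → mulQ n (transposeQ n Q) Q i j ≡ idQ n i j

RegularQ : (n : ℕ) → QMat n → Set
RegularQ n Q = ∀ i → sumR ℚops n (λ j → Q i j) ≡ ℚ.1ℚ

ConjToConverse : (n : ℕ) → OGraph n → QMat n → Set
ConjToConverse n Γ Q =
  ∀ i j → mulQ n (mulQ n (transposeQ n Q) (λ a b → toℚ (S Γ a b))) Q i j ≡ toℚ (S Γ j i)

IntegralQ : ℚ → Set
IntegralQ q = ℚ.denominator q ≡ + 1

ScalesToIntegral : (n : ℕ) → QMat n → ℕ → Set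
ScalesToIntegral n Q k = ∀ i j → IntegralQ (toℚ (+ k) ℚ.* Q i j)

IsLevel : (n : ℕ) → QMat n → ℕ → Set
IsLevel n Q ℓ = (0 < ℓ) × ScalesToIntegral n Q ℓ
              × (∀ k → 0 < k → ScalesToIntegral n Q k → ℓ ≤ k)

ProductOfDistinctOddPrimes : ℕ → ℕ → Set
ProductOfDistinctOddPrimes ℓ t =
  Σ (List ℕ) λ ps → All Prime ps × All (λ p → ¬ (2 ℕD.∣ p)) ps × Unique ps
                  × product ps ≡ ℓ × length ps ≡ t

{-# OPTIONS --safe #-}
-- If Δ is generalized cospectral with Γ, then det (I + uS) and det (I + uS − uJ) agree for both graphs, hence so do
-- the moments 𝟏ᵀSᵏ𝟏, and Q = W(Γ) W(Δ)⁻¹ is a regular rational orthogonal matrix conjugating S(Γ) to S(Δ). The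
-- hypothesis on det W(Γ) makes the level ℓ of Q odd and square-free, and for a prime p ∣ ℓ the columns of ℓQ are,
-- modulo p, multiples of one vector x spanning the kernel of Wᵀ, which is an eigenvector of S. If p ∤ ℓ₀, then Q₀
-- preserves the line of x while anticommuting with S, so S x ≡ 0; but then x lifts to a kernel vector of Wᵀ modulo
-- p², contradicting p² ∤ det W. So the primes dividing ℓ form a subset of {p₁, …, pₜ}. If the levels of Q₁ and Q₂
-- have the same prime divisors, then Q₁ᵀQ₂ is integral, hence a permutation matrix, and the two graphs are
-- isomorphic. One of the 2ᵗ subsets is taken by Γ itself.
module Submission where

open import Defs
import Algebra.Properties.CommutativeSemigroup as CommutativeSemigroupProperties
open import Data.Bool using (if_then_else_)
open import Data.Empty using (⊥; ⊥-elim)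
open import Data.Fin using (Fin; zero; suc; punchIn; toℕ; fromℕ; fromℕ<; inject₁; splitAt; _↑ˡ_; _↑ʳ_; join; funToFin;
  finToFun; _≟_)
open import Data.Fin.Permutation using (Permutation; permutation; _⟨$⟩ʳ_)
import Data.Fin.Properties as FinP
open import Data.Integer as ℤ using (ℤ; +_; -[1+_]; _+_; _*_; -_; _-_)
open import Data.Integer.Divisibility.Signed as ℤS using (_∣_; divides)
import Data.Integer.DivMod as ℤDM
import Data.Integer.Properties as ℤP
open import Data.Integer.Tactic.RingSolver using (solve-∀)
open import Data.List using (List; []; _∷_; length; lookup)
open import Data.List.Membership.Propositional using (_∈_)
open import Data.List.Membership.Propositional.Properties using (∈-lookup)
open import Data.List.Relation.Unary.All as All using (All; []; _∷_)
open import Data.List.Relation.Unary.AllPairs using (AllPairs; []; _∷_)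
open import Data.List.Relation.Unary.Any using (index)
open import Data.List.Relation.Unary.Any.Properties using (lookup-index)
open import Data.Nat as ℕ using (ℕ; zero; suc; _≤_; _^_; _∸_)
import Data.Nat.Coprimality as ℕC
import Data.Nat.Divisibility as ℕD
import Data.Nat.DivMod as ℕDM
import Data.Nat.GCD as ℕG
open import Data.Nat.Induction using (<-rec)
open import Data.Nat.ListAction using (product)
open import Data.Nat.Primality
  using (Prime; prime?; euclidsLemma; prime⇒irreducible; prime⇒nonTrivial; prime⇒nonZero; ¬prime[1]; prime[2])
open import Data.Nat.Primality.Factorisation using (factorise; PrimeFactorisation; factorisationHasAllPrimeFactors)
import Data.Nat.Properties as ℕP
open import Data.Product using (∃; _×_; _,_; proj₁; proj₂)
open import Data.Rational as ℚ using (ℚ)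
import Data.Rational.Properties as ℚP
open import Data.Rational.Solver using (module +-*-Solver)
import Data.Rational.Unnormalised as ℚᵘ
import Data.Rational.Unnormalised.Properties as ℚᵘP
open import Data.Sum using (_⊎_; inj₁; inj₂; [_,_]′)
open import Data.Vec.Functional using (insertAt)
open import Data.Vec.Functional.Properties using (insertAt-lookup; insertAt-punchIn)
open import Function using (_∘_; id)
open import Relation.Binary.Bundles using (Setoid)
open import Relation.Binary.PropositionalEquality
  using (_≡_; _≢_; refl; sym; trans; cong; cong₂; subst; subst₂; module ≡-Reasoning)
import Relation.Binary.Reasoning.Setoid as SetoidReasoning
open import Relation.Nullary using (¬_; Dec; yes; no; does)
open import Relation.Nullary.Decidable using (_×-dec_)

open CommutativeSemigroupProperties ℤP.+-commutativeSemigroup using () renaming (interchange to +-interchange)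
open CommutativeSemigroupProperties ℕP.+-commutativeSemigroup using () renaming (interchange to ℕ-interchange)

-- Sums and dot products

-- Rational matrices are carried as fractions N / d with N integral, so every argument becomes a
-- congruence. The obstacle is the prime 2: since 2^⌊n/2⌋ divides det W, arguments from p² ∤ det W
-- fail there. The entries of WᵀW are ±𝟏ᵀSᵏ𝟏, which are even for k > 0, and for k = 0 when n is
-- even. Removing a factor 2 from each row (except the first for odd n) leaves an odd determinant.
-- If ℓ is even, a column y of ℓQ satisfies |Sʲy|² ≡ 0 modulo 4 and is, modulo 2, a combination Σ
-- aₗSˡ𝟏 with 2l < n. Doubling the exponents turns these norms into entries of WᵀW times a vector
-- made of the aₗ, which forces all aₗ to be even. For odd p, lifting x modulo p² is a linear
-- system. Its obstructions vanish because x · x ≡ 0 puts x itself into the column space of W, a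
-- cyclic module on which the kernel of S is at most a line. Moments are read off without power
-- series: integers w are substituted, congruences are taken modulo powers of w, and a moment
-- difference divisible by every such w is 0.

Vector : ℕ → Set
Vector n = Fin n → ℤ

-- Opaque, so that unification does not try to unfold sums.
opaque
  ∑ : ∀ {n} → Vector n → ℤ
  ∑ {n} f = sumR ℤops n f

  ∑-sumR : ∀ {n} (f : Vector n) → ∑ f ≡ sumR ℤops n f
  ∑-sumR f = refl

  ∑-[] : (f : Vector 0) → ∑ f ≡ + 0
  ∑-[] f = refl

  ∑-∷ : ∀ {n} (f : Vector (suc n)) → ∑ f ≡ f zero + ∑ (f ∘ suc)
  ∑-∷ f = refl

  ∑-cong : ∀ {n} {f g : Vector n} → (∀ i → f i ≡ g i) → ∑ f ≡ ∑ g
  ∑-cong {zero}  h = refl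
  ∑-cong {suc n} h = cong₂ _+_ (h zero) (∑-cong (h ∘ suc))

  ∑-zero : ∀ {n} {f : Vector n} → (∀ i → f i ≡ + 0) → ∑ f ≡ + 0
  ∑-zero {zero}  h = refl
  ∑-zero {suc n} h = cong₂ _+_ (h zero) (∑-zero (h ∘ suc))

infix 7 _·_
_·_ : ∀ {n} → Vector n → Vector n → ℤ
u · v = ∑ (λ i → u i * v i)

opaque
  unfolding ∑

  ∑-distrib-+ : ∀ {n} (f g : Vector n) → ∑ (λ i → f i + g i) ≡ ∑ f + ∑ g
  ∑-distrib-+ {zero}  f g = refl
  ∑-distrib-+ {suc n} f g =
    trans (cong (_+_ (f zero + g zero)) (∑-distrib-+ (f ∘ suc) (g ∘ suc)))
          (+-interchange (f zero) (g zero) (∑ (f ∘ suc)) (∑ (g ∘ suc)))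

  *-distribˡ-∑ : ∀ {n} c (f : Vector n) → c * ∑ f ≡ ∑ (λ i → c * f i)
  *-distribˡ-∑ {zero}  c f = ℤP.*-zeroʳ c
  *-distribˡ-∑ {suc n} c f =
    trans (ℤP.*-distribˡ-+ c (f zero) _) (cong (_+_ (c * f zero)) (*-distribˡ-∑ c (f ∘ suc)))

*-distribʳ-∑ : ∀ {n} c (f : Vector n) → ∑ f * c ≡ ∑ (λ i → f i * c)
*-distribʳ-∑ c f =
  trans (ℤP.*-comm (∑ f) c) (trans (*-distribˡ-∑ c f) (∑-cong λ i → ℤP.*-comm c (f i)))

opaque
  unfolding ∑

  ∑-swap : ∀ {m n} (f : Fin m → Fin n → ℤ) → ∑ (λ i → ∑ (f i)) ≡ ∑ (λ j → ∑ (λ i → f i j))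
  ∑-swap {zero}  f = sym (∑-zero {f = λ j → ∑ (λ i → f i j)} (λ _ → refl))
  ∑-swap {suc m} f =
    trans (cong (_+_ (∑ (f zero))) (∑-swap (f ∘ suc)))
          (sym (∑-distrib-+ (f zero) (λ j → ∑ (λ i → f (suc i) j))))

  ∑-punchIn : ∀ {n} (k : Fin (suc n)) (f : Vector (suc n)) → ∑ f ≡ f k + ∑ (f ∘ punchIn k)
  ∑-punchIn         zero    f = refl
  ∑-punchIn {suc n} (suc k) f =
    trans (cong (_+_ (f zero)) (∑-punchIn k (f ∘ suc)))
          (left-comm (f zero) (f (suc k)) _)
    where
    left-comm : ∀ a b c → a + (b + c) ≡ b + (a + c)
    left-comm = solve-∀

∑-single : ∀ {n} (k : Fin n) (f : Vector n) → (∀ i → i ≢ k → f i ≡ + 0) → ∑ f ≡ f k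
∑-single {suc n} k f h =
  trans (∑-punchIn k f)
        (trans (cong (_+_ (f k)) (∑-zero (λ i → h (punchIn k i) (FinP.punchInᵢ≢i k i))))
               (ℤP.+-identityʳ (f k)))

-- Matrices

infix 4 _≋_
_≋_ : ∀ {m n} → (A B : Fin m → Fin n → ℤ) → Set
A ≋ B = ∀ i j → A i j ≡ B i j

δ : ∀ {n} → Fin n → Fin n → ℤ
δ i j = if does (i ≟ j) then + 1 else + 0

δ-refl : ∀ {n} (i : Fin n) → δ i i ≡ + 1
δ-refl i with i ≟ i
... | yes _ = refl
... | no ¬p = ⊥-elim (¬p refl)

δ-≢ : ∀ {n} {i j : Fin n} → i ≢ j → δ i j ≡ + 0
δ-≢ {i = i} {j} i≢j with i ≟ j
... | yes p = ⊥-elim (i≢j p)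
... | no _  = refl

δ-sym : ∀ {n} (i j : Fin n) → δ i j ≡ δ j i
δ-sym i j with i ≟ j
... | yes refl = sym (δ-refl i)
... | no  i≢j  = sym (δ-≢ (i≢j ∘ sym))

∑-δˡ : ∀ {n} (k : Fin n) (f : Vector n) → ∑ (λ i → δ k i * f i) ≡ f k
∑-δˡ k f = trans (∑-single k _ λ i i≢k → cong (_* f i) (δ-≢ (i≢k ∘ sym)))
                 (trans (cong (_* f k) (δ-refl k)) (ℤP.*-identityˡ (f k)))

∑-δʳ : ∀ {n} (k : Fin n) (f : Vector n) → ∑ (λ i → f i * δ i k) ≡ f k
∑-δʳ k f = trans (∑-cong λ i → trans (ℤP.*-comm (f i) (δ i k)) (cong (_* f i) (δ-sym i k)))
                 (∑-δˡ k f)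

infixl 7 _⊗_
_⊗_ : ∀ {l m n} → (Fin l → Fin m → ℤ) → (Fin m → Fin n → ℤ) → Fin l → Fin n → ℤ
(A ⊗ B) i j = ∑ (λ k → A i k * B k j)

_ᵀ : ∀ {m n} → (Fin m → Fin n → ℤ) → Fin n → Fin m → ℤ
(A ᵀ) i j = A j i

infixr 8 _∙_
_∙_ : ∀ {m n} → ℤ → (Fin m → Fin n → ℤ) → Fin m → Fin n → ℤ
(c ∙ A) i j = c * A i j

∑-assoc : ∀ {m n} (a : Vector m) (B : Fin m → Fin n → ℤ) (c : Vector n) →
          ∑ (λ j → ∑ (λ k → a k * B k j) * c j) ≡ ∑ (λ k → a k * ∑ (λ j → B k j * c j))
∑-assoc a B c =
  trans (∑-cong λ j → *-distribʳ-∑ (c j) (λ k → a k * B k j))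
  (trans (∑-swap (λ j k → a k * B k j * c j))
  (∑-cong λ k → trans (∑-cong λ j → ℤP.*-assoc (a k) (B k j) (c j))
                      (sym (*-distribˡ-∑ (a k) (λ j → B k j * c j)))))

⊗-assoc : ∀ {k l m n} (A : Fin k → Fin l → ℤ) (B : Fin l → Fin m → ℤ) (C : Fin m → Fin n → ℤ) →
          (A ⊗ B) ⊗ C ≋ A ⊗ (B ⊗ C)
⊗-assoc A B C i j = ∑-assoc (A i) B ((C ᵀ) j)

⊗-congˡ : ∀ {l m n} (A : Fin l → Fin m → ℤ) {B B′ : Fin m → Fin n → ℤ} →
          B ≋ B′ → A ⊗ B ≋ A ⊗ B′
⊗-congˡ A q i j = ∑-cong λ k → cong (A i k *_) (q k j)

⊗-congʳ : ∀ {l m n} {A A′ : Fin l → Fin m → ℤ} (B : Fin m → Fin n → ℤ) →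
          A ≋ A′ → A ⊗ B ≋ A′ ⊗ B
⊗-congʳ B p i j = ∑-cong λ k → cong (_* B k j) (p i k)

⊗-identityˡ : ∀ {m n} (A : Fin m → Fin n → ℤ) → δ ⊗ A ≋ A
⊗-identityˡ A i j = ∑-δˡ i ((A ᵀ) j)

⊗-identityʳ : ∀ {m n} (A : Fin m → Fin n → ℤ) → A ⊗ δ ≋ A
⊗-identityʳ A i j = ∑-δʳ j (A i)

∙-⊗ˡ : ∀ {l m n} c (A : Fin l → Fin m → ℤ) (B : Fin m → Fin n → ℤ) → (c ∙ A) ⊗ B ≋ c ∙ (A ⊗ B)
∙-⊗ˡ c A B i j = trans (∑-cong λ k → ℤP.*-assoc c (A i k) (B k j)) (sym (*-distribˡ-∑ c _))

∙-⊗ʳ : ∀ {l m n} c (A : Fin l → Fin m → ℤ) (B : Fin m → Fin n → ℤ) → A ⊗ (c ∙ B) ≋ c ∙ (A ⊗ B)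
∙-⊗ʳ c A B i j = trans (∑-cong λ k → comm (A i k) c (B k j)) (sym (*-distribˡ-∑ c _))
  where
  comm : ∀ a c b → a * (c * b) ≡ c * (a * b)
  comm = solve-∀

≋-sym : ∀ {m n} {A B : Fin m → Fin n → ℤ} → A ≋ B → B ≋ A
≋-sym p i j = sym (p i j)

-- Determinants

signR-ℤ : ∀ k a → signR ℤops k a ≡ signR ℤops k (+ 1) * a
signR-ℤ zero    a = sym (ℤP.*-identityˡ a)
signR-ℤ (suc k) a =
  trans (cong -_ (signR-ℤ k a)) (ℤP.neg-distribˡ-* (signR ℤops k (+ 1)) a)

sgn : ℕ → ℤ
sgn k = signR ℤops k (+ 1)

minor : ∀ {n} → Fin (suc n) → (Fin (suc n) → Fin (suc n) → ℤ) → Fin n → Fin n → ℤ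
minor j A i k = A (suc i) (punchIn j k)

opaque
  unfolding ∑

  det : ∀ {n} → (Fin n → Fin n → ℤ) → ℤ
  det {n} A = detℤ n A

  det-detℤ : ∀ {n} (A : Fin n → Fin n → ℤ) → det A ≡ detℤ n A
  det-detℤ A = refl

  det-[] : (A : Fin 0 → Fin 0 → ℤ) → det A ≡ + 1
  det-[] A = refl

  -- Replaces the iterated negation of `signR` by an integer factor, so that the sum laws and the
  -- ring solver apply to the expansion.
  det-expand : ∀ {n} (A : Fin (suc n) → Fin (suc n) → ℤ) →
               det A ≡ ∑ (λ j → sgn (toℕ j) * (A zero j * det (minor j A)))
  det-expand A = ∑-cong λ j → signR-ℤ (toℕ j) (A zero j * det (minor j A))

  det-cong : ∀ {n} {A B : Fin n → Fin n → ℤ} → A ≋ B → det A ≡ det B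
  det-cong {zero}  p = refl
  det-cong {suc n} {A} {B} p = ∑-cong λ j → cong (signR ℤops (toℕ j))
    (cong₂ _*_ (p zero j) (det-cong λ i k → p (suc i) (punchIn j k)))

private
  TransposeInvariant : ℕ → Set
  TransposeInvariant n = ∀ (A : Fin n → Fin n → ℤ) → det (A ᵀ) ≡ det A

  inner : ∀ {n} (A : Fin (suc (suc n)) → Fin (suc (suc n)) → ℤ) → Fin (suc n) → Fin (suc n) → Fin n → Fin n → ℤ
  inner A i j a b = A (suc (punchIn i a)) (suc (punchIn j b))

  -- Expanding along the first row and then along the first columns of the minors gives a formula
  -- which is symmetric under transposition.
  det-expand₂ : ∀ {n} → TransposeInvariant (suc n) → TransposeInvariant n → ∀ B →
    det B ≡ sgn 0 * (B zero zero * det (minor zero B)) +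
      ∑ (λ j → ∑ (λ i → - sgn (toℕ j) * (B zero (suc j) * (sgn (toℕ i) * (B (suc i) zero * det (inner {n} B i j))))))
  det-expand₂ {n} inv₁ inv₀ B =
    trans (det-expand B) (trans (∑-∷ {n = suc n} _)
    (cong (_+_ (sgn 0 * (B zero zero * det (minor zero B)))) (∑-cong λ j →
      trans (cong (λ x → - sgn (toℕ j) * (B zero (suc j) * x))
        (trans (sym (inv₁ (minor (suc j) B)))
        (trans (det-expand ((minor (suc j) B) ᵀ))
        (∑-cong λ i → cong (λ x → sgn (toℕ i) * (B (suc i) zero * x)) (inv₀ (inner B i j))))))
      (trans (cong (- sgn (toℕ j) *_) (*-distribˡ-∑ (B zero (suc j)) _)) (*-distribˡ-∑ (- sgn (toℕ j)) _)))))

det-ᵀ : ∀ {n} (A : Fin n → Fin n → ℤ) → det (A ᵀ) ≡ det A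
det-ᵀ {zero} A = trans (det-[] (A ᵀ)) (sym (det-[] A))
det-ᵀ {suc zero} A = det-cong λ { zero zero → refl }
det-ᵀ {suc (suc n)} A =
  trans (det-expand₂ (det-ᵀ {suc n}) (det-ᵀ {n}) (A ᵀ))
    (trans (cong₂ _+_ (cong (λ x → sgn 0 * (A zero zero * x)) (det-ᵀ (minor zero A))) corner)
           (sym (det-expand₂ (det-ᵀ {suc n}) (det-ᵀ {n}) A)))
  where
  rearrange : ∀ s a t b d → - s * (a * (t * (b * d))) ≡ - t * (b * (s * (a * d)))
  rearrange = solve-∀
  corner = trans
    (∑-cong λ j → ∑-cong λ i → trans
       (cong (λ x → - sgn (toℕ j) * (A (suc j) zero * (sgn (toℕ i) * (A zero (suc i) * x)))) (det-ᵀ (inner A j i)))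
       (rearrange (sgn (toℕ j)) (A (suc j) zero) (sgn (toℕ i)) (A zero (suc i)) (det (inner A j i))))
    (∑-swap (λ j i → - sgn (toℕ i) * (A zero (suc i) * (sgn (toℕ j) * (A (suc j) zero * det (inner A j i))))))

-- Row updates, multilinear and alternating forms

infixr 5 _◂_
_◂_ : ∀ {m} {V : Set} → V → (Fin m → V) → Fin (suc m) → V
(v ◂ A) zero    = v
(v ◂ A) (suc i) = A i

infix 6 _[_↦_]
_[_↦_] : ∀ {m} {V : Set} → (Fin m → V) → Fin m → V → Fin m → V
(A [ zero  ↦ v ]) zero    = v
(A [ zero  ↦ v ]) (suc j) = A (suc j)
(A [ suc i ↦ v ]) zero    = A zero
(A [ suc i ↦ v ]) (suc j) = (A ∘ suc [ i ↦ v ]) j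

update-same : ∀ {m} {V : Set} (A : Fin m → V) i v → (A [ i ↦ v ]) i ≡ v
update-same A zero    v = refl
update-same A (suc i) v = update-same (A ∘ suc) i v

update-other : ∀ {m} {V : Set} (A : Fin m → V) {i j} v → j ≢ i → (A [ i ↦ v ]) j ≡ A j
update-other A {zero}  {zero}  v j≢i = ⊥-elim (j≢i refl)
update-other A {zero}  {suc j} v j≢i = refl
update-other A {suc i} {zero}  v j≢i = refl
update-other A {suc i} {suc j} v j≢i = update-other (A ∘ suc) v (j≢i ∘ cong suc)

update-cong : ∀ {m n} {A B : Fin m → Vector n} i {v w : Vector n} →
              A ≋ B → (∀ k → v k ≡ w k) → A [ i ↦ v ] ≋ B [ i ↦ w ]
update-cong zero    p q zero    = q
update-cong zero    p q (suc j) = p (suc j)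
update-cong (suc i) p q zero    = p zero
update-cong (suc i) p q (suc j) = update-cong i (p ∘ suc) q j

update-self : ∀ {m n} (A : Fin m → Vector n) i → A [ i ↦ A i ] ≋ A
update-self A zero    zero    k = refl
update-self A zero    (suc j) k = refl
update-self A (suc i) zero    k = refl
update-self A (suc i) (suc j) k = update-self (A ∘ suc) i j k

minor-update : ∀ {n} (A : Fin (suc n) → Fin (suc n) → ℤ) i v j →
               minor j (A [ suc i ↦ v ]) ≋ minor j A [ i ↦ v ∘ punchIn j ]
minor-update A i v j = go (A ∘ suc) i
  where
  go : ∀ {m} (B : Fin m → Vector _) i →
       (λ a b → (B [ i ↦ v ]) a (punchIn j b)) ≋ (λ a b → B a (punchIn j b)) [ i ↦ v ∘ punchIn j ]
  go B zero    zero    k = refl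
  go B zero    (suc a) k = refl
  go B (suc i) zero    k = refl
  go B (suc i) (suc a) k = go (B ∘ suc) i a k

-- The number of rows is independent of their length, because fixing the first row of a form lowers
-- only the former; the induction in `alternating-det` relies on this.
record Multilinear (m n : ℕ) (G : (Fin m → Vector n) → ℤ) : Set where
  field
    resp   : ∀ {A B} → A ≋ B → G A ≡ G B
    linear : ∀ A i v c w → G (A [ i ↦ (λ k → v k + c * w k) ]) ≡ G (A [ i ↦ v ]) + c * G (A [ i ↦ w ])

record Alternating (m n : ℕ) (G : (Fin m → Vector n) → ℤ) : Set where
  field
    multilinear : Multilinear m n G
    vanish      : ∀ A {i j} → i ≢ j → (∀ k → A i k ≡ A j k) → G A ≡ + 0
  open Multilinear multilinear public

det-multilinear : ∀ {n} → Multilinear n n det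
det-multilinear = record { resp = det-cong ; linear = linear }
  where
  arith₀ : ∀ s a c b x → s * ((a + c * b) * x) ≡ s * (a * x) + c * (s * (b * x))
  arith₀ = solve-∀
  arith₁ : ∀ s a c x y → s * (a * (x + c * y)) ≡ s * (a * x) + c * (s * (a * y))
  arith₁ = solve-∀
  collect : ∀ {n} c (f g h : Vector n) → (∀ j → f j ≡ g j + c * h j) → ∑ f ≡ ∑ g + c * ∑ h
  collect c f g h p = trans (∑-cong p) (trans (∑-distrib-+ g (λ j → c * h j))
                        (cong (_+_ (∑ g)) (sym (*-distribˡ-∑ c h))))
  linear : ∀ {n} (A : Fin n → Vector n) i v c w →
           det (A [ i ↦ (λ k → v k + c * w k) ]) ≡ det (A [ i ↦ v ]) + c * det (A [ i ↦ w ])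
  linear {suc n} A zero v c w =
    trans (det-expand _) (trans (collect c _ _ _ λ j →
      arith₀ (sgn (toℕ j)) (v j) c (w j) (det (minor j A)))
      (cong₂ (λ x y → x + c * y) (sym (det-expand (A [ zero ↦ v ]))) (sym (det-expand (A [ zero ↦ w ])))))
  linear {suc n} A (suc i) v c w =
    trans (det-expand _) (trans (collect c _ _ _ λ j →
      trans (cong (λ x → sgn (toℕ j) * (A zero j * x))
              (trans (det-cong (minor-update A i _ j))
              (trans (linear (minor j A) i (v ∘ punchIn j) c (w ∘ punchIn j))
                (cong₂ (λ x y → x + c * y) (sym (det-cong (minor-update A i v j)))
                                           (sym (det-cong (minor-update A i w j)))))))
            (arith₁ (sgn (toℕ j)) (A zero j) c (det (minor j (A [ suc i ↦ v ]))) (det (minor j (A [ suc i ↦ w ])))))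
      (cong₂ (λ x y → x + c * y) (sym (det-expand (A [ suc i ↦ v ]))) (sym (det-expand (A [ suc i ↦ w ])))))

module _ {m n : ℕ} {G : (Fin m → Vector n) → ℤ} (ml : Multilinear m n G) where
  open Multilinear ml

  linear-zero : ∀ A i {v} → (∀ k → v k ≡ + 0) → G (A [ i ↦ v ]) ≡ + 0
  linear-zero A i {v} h =
    trans (resp (update-cong i (λ _ _ → refl) (λ k → trans (h k) (sym (cancel k)))))
          (trans (linear A i v (- + 1) v) (arith (G (A [ i ↦ v ]))))
    where
    cancel : ∀ k → v k + - + 1 * v k ≡ + 0
    cancel k = trans (cong₂ (λ x y → x + - + 1 * y) (h k) (h k)) refl
    arith : ∀ x → x + - + 1 * x ≡ + 0
    arith = solve-∀

  linear-∑ : ∀ {p} A i (c : Vector p) (B : Fin p → Vector n) →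
             G (A [ i ↦ (λ k → ∑ (λ l → c l * B l k)) ]) ≡ ∑ (λ l → c l * G (A [ i ↦ B l ]))
  linear-∑ {zero} A i c B = trans (linear-zero A i (λ k → ∑-[] _)) (sym (∑-[] _))
  linear-∑ {suc p} A i c B =
    trans (resp (update-cong i (λ _ _ → refl)
            (λ k → trans (∑-∷ (λ l → c l * B l k)) (ℤP.+-comm (c zero * B zero k) _))))
    (trans (linear A i _ (c zero) (B zero))
    (trans (ℤP.+-comm _ (c zero * G (A [ i ↦ B zero ])))
    (trans (cong (_+_ (c zero * G (A [ i ↦ B zero ]))) (linear-∑ A i (c ∘ suc) (B ∘ suc)))
           (sym (∑-∷ (λ l → c l * G (A [ i ↦ B l ])))))))

head-update : ∀ {m n} (A : Fin (suc m) → Vector n) v → A [ zero ↦ v ] ≋ v ◂ A ∘ suc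
head-update A v zero    k = refl
head-update A v (suc i) k = refl

◂-η : ∀ {m n} (A : Fin (suc m) → Vector n) → A ≋ A zero ◂ A ∘ suc
◂-η A zero    k = refl
◂-η A (suc i) k = refl

◂-cong : ∀ {m n} {v w : Vector n} {A B : Fin m → Vector n} → (∀ k → v k ≡ w k) → A ≋ B → v ◂ A ≋ w ◂ B
◂-cong p q zero    = p
◂-cong p q (suc i) = q i

multilinear-◂ : ∀ {m n G} → Multilinear (suc m) n G → ∀ v → Multilinear m n (λ A → G (v ◂ A))
multilinear-◂ {m} {n} ml v = record
  { resp   = λ p → resp (◂-cong (λ _ → refl) p)
  ; linear = λ A i u c w → trans (resp (step A i _)) (trans (linear (v ◂ A) (suc i) u c w)
      (cong₂ (λ x y → x + c * y) (resp (≋-sym (step A i u))) (resp (≋-sym (step A i w)))))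
  }
  where
  open Multilinear ml
  step : ∀ (A : Fin m → Vector n) i u → v ◂ A [ i ↦ u ] ≋ (v ◂ A) [ suc i ↦ u ]
  step A i u zero    k = refl
  step A i u (suc j) k = refl

alternating-◂ : ∀ {m n G} → Alternating (suc m) n G → ∀ v → Alternating m n (λ A → G (v ◂ A))
alternating-◂ alt v = record
  { multilinear = multilinear-◂ multilinear v
  ; vanish      = λ A {i} {j} i≢j p → vanish (v ◂ A) {suc i} {suc j} (i≢j ∘ FinP.suc-injective) p
  }
  where open Alternating alt

head-linear : ∀ {m n G} → Multilinear (suc m) n G → ∀ v c w A →
              G ((λ k → v k + c * w k) ◂ A) ≡ G (v ◂ A) + c * G (w ◂ A)
head-linear ml v c w A =
  trans (resp (≋-sym (head-update (v ◂ A) _))) (trans (linear (v ◂ A) zero v c w)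
    (cong₂ (λ x y → x + c * y) (resp (head-update (v ◂ A) v)) (resp (head-update (v ◂ A) w))))
  where open Multilinear ml

-- Polarization: the form vanishes on a repeated v + w, and the expansion leaves the two mixed
-- terms.
swap₀₁ : ∀ {m n G} → Multilinear (suc (suc m)) n G → (∀ v A → G (v ◂ v ◂ A) ≡ + 0) →
         ∀ v w A → G (v ◂ w ◂ A) ≡ - G (w ◂ v ◂ A)
swap₀₁ {G = G} ml van v w A =
  arith (G (v ◂ v ◂ A)) (G (v ◂ w ◂ A)) (G (w ◂ v ◂ A)) (G (w ◂ w ◂ A)) (van v A) (van w A)
    (trans (sym expanded) (van s A))
  where
  s : Vector _
  s k = v k + + 1 * w k
  expanded : G (s ◂ s ◂ A) ≡ (G (v ◂ v ◂ A) + + 1 * G (v ◂ w ◂ A)) + + 1 * (G (w ◂ v ◂ A) + + 1 * G (w ◂ w ◂ A))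
  expanded = trans (head-linear ml v (+ 1) w (s ◂ A))
    (cong₂ (λ x y → x + + 1 * y) (head-linear (multilinear-◂ ml v) v (+ 1) w A)
                                 (head-linear (multilinear-◂ ml w) v (+ 1) w A))
  arith : ∀ a b c d → a ≡ + 0 → d ≡ + 0 → (a + + 1 * b) + + 1 * (c + + 1 * d) ≡ + 0 → b ≡ - c
  arith _ b c _ refl refl h = trans (lem b c) (trans (cong (_- c) h) (ℤP.+-identityˡ (- c)))
    where
    lem : ∀ b c → b ≡ ((+ 0 + + 1 * b) + + 1 * (c + + 1 * + 0)) - c
    lem = solve-∀

-- Along the first row, the first two terms have equal minors and opposite signs, and every later
-- minor again has two equal leading columns.
det-equal-columns₀₁ : ∀ {n} (B : Fin (suc (suc n)) → Fin (suc (suc n)) → ℤ) →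
                      (∀ i → B i zero ≡ B i (suc zero)) → det B ≡ + 0
det-equal-columns₀₁ {n} B h =
  trans (det-expand B) (trans (∑-∷ {n = suc n} f) (trans (cong (_+_ (f zero)) (∑-∷ {n = n} (f ∘ suc)))
  (trans (cong₂ (λ x y → f zero + (x + y)) second (∑-zero {n} (rest n B h)))
    (cancel (B zero zero) (det (minor zero B))))))
  where
  f : Vector (suc (suc n))
  f j = sgn (toℕ j) * (B zero j * det (minor j B))
  minors : minor (suc zero) B ≋ minor zero B
  minors i zero    = h (suc i)
  minors i (suc k) = refl
  second : f (suc zero) ≡ - + 1 * (B zero zero * det (minor zero B))
  second = cong₂ (λ x y → - + 1 * (x * y)) (sym (h zero)) (det-cong minors)
  cancel : ∀ a d → + 1 * (a * d) + (- + 1 * (a * d) + + 0) ≡ + 0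
  cancel = solve-∀
  rest : ∀ n (B : Fin (suc (suc n)) → Fin (suc (suc n)) → ℤ) → (∀ i → B i zero ≡ B i (suc zero)) →
         ∀ j → sgn (toℕ (suc (suc j))) * (B zero (suc (suc j)) * det (minor (suc (suc j)) B)) ≡ + 0
  rest (suc n) B h j =
    trans (cong (λ x → sgn (toℕ (suc (suc j))) * (B zero (suc (suc j)) * x))
                (det-equal-columns₀₁ (minor (suc (suc j)) B) (h ∘ suc)))
          (zero-out (sgn (toℕ (suc (suc j)))) (B zero (suc (suc j))))
    where
    zero-out : ∀ s b → s * (b * + 0) ≡ + 0
    zero-out = solve-∀

private
  EqualRowsVanish : ℕ → Set
  EqualRowsVanish n = ∀ (A : Fin n → Vector n) {i j} → i ≢ j → (∀ k → A i k ≡ A j k) → det A ≡ + 0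

  vanish-below : ∀ {n} → EqualRowsVanish n → ∀ (A : Fin (suc n) → Vector (suc n)) {i j} → i ≢ j →
                 (∀ k → A (suc i) k ≡ A (suc j) k) → det A ≡ + 0
  vanish-below van A {i} {j} i≢j p =
    trans (det-expand A) (∑-zero λ l →
      trans (cong (λ x → sgn (toℕ l) * (A zero l * x)) (van (minor l A) i≢j (p ∘ punchIn l)))
            (zero-out (sgn (toℕ l)) (A zero l)))
    where
    zero-out : ∀ s b → s * (b * + 0) ≡ + 0
    zero-out = solve-∀

  -- Equal rows 0 and 1 become equal columns under transposition. In the other cases, exchanging
  -- rows 0 and 1 moves the equal pair below the first row.
  vanish-top : ∀ {n} → EqualRowsVanish n → ∀ (A : Fin (suc n) → Vector (suc n)) j →
               (∀ k → A zero k ≡ A (suc j) k) → det A ≡ + 0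
  vanish-top van A zero p = trans (sym (det-ᵀ A)) (det-equal-columns₀₁ (A ᵀ) p)
  vanish-top {suc n} van A (suc j) p =
    trans (det-cong A≋) (trans (swap₀₁ {n} det-multilinear eq₀₁ (A zero) (A (suc zero)) (λ l → A (suc (suc l))))
      (cong -_ (vanish-below van (A (suc zero) ◂ A zero ◂ (λ l → A (suc (suc l)))) {zero} {suc j} (λ ()) p)))
    where
    A≋ : A ≋ A zero ◂ A (suc zero) ◂ (λ l → A (suc (suc l)))
    A≋ zero          k = refl
    A≋ (suc zero)    k = refl
    A≋ (suc (suc l)) k = refl
    eq₀₁ : ∀ v B → det (v ◂ v ◂ B) ≡ + 0
    eq₀₁ v B = trans (sym (det-ᵀ (v ◂ v ◂ B))) (det-equal-columns₀₁ ((v ◂ v ◂ B) ᵀ) λ _ → refl)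

det-vanish : ∀ {n} → EqualRowsVanish n
det-vanish         A {zero}  {zero}  i≢j p = ⊥-elim (i≢j refl)
det-vanish {suc n} A {suc i} {suc j} i≢j p = vanish-below (det-vanish {n}) A (i≢j ∘ cong suc) p
det-vanish {suc n} A {zero}  {suc j} i≢j p = vanish-top (det-vanish {n}) A j p
det-vanish {suc n} A {suc i} {zero}  i≢j p = vanish-top (det-vanish {n}) A i (sym ∘ p)

det-alternating : ∀ {n} → Alternating n n det
det-alternating = record { multilinear = det-multilinear ; vanish = det-vanish }

-- In the application `H` is an alternating form with `r` already inserted as its first row, so it
-- vanishes once another row equals `r`, and multiples of `r` can be cleared from the remaining
-- rows.
add-multiples : ∀ {m n H} → Multilinear m n H → (r : Vector n) →
                (∀ A i → (∀ k → A i k ≡ r k) → H A ≡ + 0) →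
                ∀ (c : Vector m) A → H (λ i k → A i k + c i * r k) ≡ H A
add-multiples {zero} ml r van c A = Multilinear.resp ml λ ()
add-multiples {suc m} {H = H} ml r van c A =
  trans (resp (◂-η _))
  (trans (head-linear ml (A zero) (c zero) r tail)
  (trans (cong (λ x → H (A zero ◂ tail) + c zero * x) (van (r ◂ tail) zero (λ _ → refl)))
  (trans (simplify (H (A zero ◂ tail)) (c zero))
  (trans (add-multiples (multilinear-◂ ml (A zero)) r (λ B i → van (A zero ◂ B) (suc i)) (c ∘ suc) (A ∘ suc))
         (resp (≋-sym (◂-η A)))))))
  where
  open Multilinear ml
  tail : Fin m → Vector _
  tail i k = A (suc i) k + c (suc i) * r k
  simplify : ∀ x c → x + c * + 0 ≡ x
  simplify = solve-∀

move-to-front : ∀ {m n G} → Alternating (suc m) n G → ∀ l B →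
                G (B l ◂ B ∘ punchIn l) ≡ sgn (toℕ l) * G B
move-to-front alt zero B = trans (Alternating.resp alt (≋-sym (◂-η B))) (sym (ℤP.*-identityˡ _))
move-to-front {suc m} {G = G} alt (suc l) B =
  trans (resp (◂-cong (λ _ → refl) (◂-η (B ∘ punchIn (suc l)))))
  (trans (swap₀₁ {m} multilinear (λ v A → vanish (v ◂ v ◂ A) {zero} {suc zero} (λ ()) (λ _ → refl))
                 (B (suc l)) (B zero) (B ∘ suc ∘ punchIn l))
  (trans (cong -_ (trans (move-to-front (alternating-◂ alt (B zero)) l (B ∘ suc))
                         (cong (sgn (toℕ l) *_) (resp (≋-sym (◂-η B))))))
         (ℤP.neg-distribˡ-* (sgn (toℕ l)) (G B))))
  where open Alternating alt

-- Linearity in the first row puts `B l` in front. Multiples of `B l` then drop out of the other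
-- rows, which leaves `minor l A` and the alternating form with first row fixed to `B l`; moving
-- `B l` back to its place produces the cofactor sign.
alternating-det : ∀ {m n G} → Alternating m n G → (A : Fin m → Fin m → ℤ) (B : Fin m → Vector n) →
                  G (A ⊗ B) ≡ det A * G B
alternating-det {zero} {G = G} alt A B =
  trans (Alternating.resp alt λ ()) (sym (trans (cong (_* G B) (det-[] A)) (ℤP.*-identityˡ (G B))))
alternating-det {suc m} {n} {G} alt A B =
  trans (resp (◂-η (A ⊗ B)))
  (trans (resp (≋-sym (head-update base _)))
  (trans (linear-∑ multilinear base zero (A zero) B)
  (trans (∑-cong λ l → trans (cong (A zero l *_) (term l)) (arith (A zero l) (det (minor l A)) (sgn (toℕ l)) (G B)))
  (trans (sym (*-distribʳ-∑ (G B) (λ l → sgn (toℕ l) * (A zero l * det (minor l A)))))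
         (cong (_* G B) (sym (det-expand A)))))))
  where
  open Alternating alt
  rest : Fin m → Vector n
  rest i = (A ⊗ B) (suc i)
  base : Fin (suc m) → Vector n
  base = (λ _ → + 0) ◂ rest
  arith : ∀ a d s g → a * (d * (s * g)) ≡ s * (a * d) * g
  arith = solve-∀
  term : ∀ l → G (base [ zero ↦ B l ]) ≡ det (minor l A) * (sgn (toℕ l) * G B)
  term l =
    trans (resp (head-update base (B l)))
    (trans (resp (◂-cong (λ _ → refl) (λ i k →
       trans (∑-punchIn l (λ j → A (suc i) j * B j k)) (ℤP.+-comm (A (suc i) l * B l k) _))))
    (trans (add-multiples (multilinear-◂ multilinear (B l)) (B l)
              (λ X i p → vanish (B l ◂ X) {zero} {suc i} (λ ()) (sym ∘ p)) (λ i → A (suc i) l)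
                (minor l A ⊗ (B ∘ punchIn l)))
    (trans (alternating-det (alternating-◂ alt (B l)) (minor l A) (B ∘ punchIn l))
           (cong (det (minor l A) *_) (move-to-front alt l B)))))

det-⊗ : ∀ {n} (A B : Fin n → Fin n → ℤ) → det (A ⊗ B) ≡ det A * det B
det-⊗ = alternating-det det-alternating

-- Adjugate and special determinants

replace-row : ∀ {n} (A : Fin n → Fin n → ℤ) i (c : Vector n) →
              det (A [ i ↦ (λ k → ∑ (λ l → c l * A l k)) ]) ≡ c i * det A
replace-row A i c =
  trans (linear-∑ det-multilinear A i c A)
  (trans (∑-single i _ λ l l≢i → trans (cong (c l *_) (repeated l l≢i)) (ℤP.*-zeroʳ (c l)))
         (cong (c i *_) (det-cong (update-self A i))))
  where
  repeated : ∀ l → l ≢ i → det (A [ i ↦ A l ]) ≡ + 0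
  repeated l l≢i = det-vanish (A [ i ↦ A l ]) {i} {l} (l≢i ∘ sym) λ k →
    trans (cong (λ v → v k) (update-same A i (A l))) (sym (cong (λ v → v k) (update-other A (A l) l≢i)))

-- Cofactors are full-size determinants with a unit row, since `minor` deletes the first row only.
adj : ∀ {n} → (Fin n → Fin n → ℤ) → Fin n → Fin n → ℤ
adj A j i = det (A [ i ↦ δ j ])

-- By linearity, the entry at (k, i) is the determinant of A with row i replaced by row k, which has
-- a repeated row unless k = i.
⊗-adj : ∀ {n} (A : Fin n → Fin n → ℤ) → A ⊗ adj A ≋ det A ∙ δ
⊗-adj A k i =
  trans (sym (linear-∑ det-multilinear A i (A k) δ))
  (trans (det-cong (update-cong i (λ _ _ → refl) (⊗-identityʳ A k))) (lem k))
  where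
  lem : ∀ k → det (A [ i ↦ A k ]) ≡ det A * δ k i
  lem k with k ≟ i
  ... | yes refl = trans (det-cong (update-self A i)) (sym (ℤP.*-identityʳ (det A)))
  ... | no k≢i   = trans (det-vanish (A [ i ↦ A k ]) {i} {k} (k≢i ∘ sym) λ c →
      trans (cong (λ v → v c) (update-same A i (A k))) (sym (cong (λ v → v c) (update-other A (A k) k≢i))))
      (sym (ℤP.*-zeroʳ (det A)))

det-first-row : ∀ {n} (A : Fin (suc n) → Fin (suc n) → ℤ) → (∀ j → A zero (suc j) ≡ + 0) →
                det A ≡ A zero zero * det (minor zero A)
det-first-row {n} A h =
  trans (det-expand A) (trans (∑-∷ _)
  (trans (cong (_+_ (+ 1 * (A zero zero * det (minor zero A)))) (∑-zero {n} λ j →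
            trans (cong (λ x → sgn (toℕ (suc j)) * (x * det (minor (suc j) A))) (h j))
                  (zero-out (sgn (toℕ (suc j))) (det (minor (suc j) A)))))
         (simplify (A zero zero * det (minor zero A)))))
  where
  zero-out : ∀ s d → s * (+ 0 * d) ≡ + 0
  zero-out = solve-∀
  simplify : ∀ x → + 1 * x + + 0 ≡ x
  simplify = solve-∀

det-δ : ∀ n → det (δ {n}) ≡ + 1
det-δ zero    = det-[] δ
det-δ (suc n) = trans (det-first-row δ λ _ → refl)
                (trans (ℤP.*-identityˡ (det (minor zero (δ {suc n})))) (trans (det-cong λ _ _ → refl) (det-δ n)))

∏ : ∀ {n} → Vector n → ℤ
∏ {zero}  d = + 1
∏ {suc n} d = d zero * ∏ (d ∘ suc)

det-scale-rows : ∀ {n} (d : Vector n) (A : Fin n → Fin n → ℤ) →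
                 det (λ i j → d i * A i j) ≡ ∏ d * det A
det-scale-rows {zero} d A = trans (det-cong λ ()) (sym (ℤP.*-identityˡ (det A)))
det-scale-rows {suc n} d A =
  trans (det-expand _)
  (trans (∑-cong λ j → trans
     (cong (λ x → sgn (toℕ j) * (d zero * A zero j * x)) (det-scale-rows (d ∘ suc) (minor j A)))
     (arith (sgn (toℕ j)) (d zero) (A zero j) (∏ (d ∘ suc)) (det (minor j A))))
  (trans (sym (*-distribˡ-∑ (∏ d) (λ j → sgn (toℕ j) * (A zero j * det (minor j A)))))
         (cong (∏ d *_) (sym (det-expand A)))))
  where
  arith : ∀ s d a p m → s * (d * a * (p * m)) ≡ d * p * (s * (a * m))
  arith = solve-∀

det-scale-row : ∀ {n} (A : Fin n → Fin n → ℤ) i c v → det (A [ i ↦ (λ k → c * v k) ]) ≡ c * det (A [ i ↦ v ])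
det-scale-row A i c v =
  trans (det-cong (update-cong i (λ _ _ → refl) (λ k → sym (ℤP.+-identityˡ (c * v k)))))
  (trans (Multilinear.linear det-multilinear A i (λ _ → + 0) c v)
  (trans (cong (λ x → x + c * det (A [ i ↦ v ])) (linear-zero det-multilinear A i (λ _ → refl)))
         (ℤP.+-identityˡ (c * det (A [ i ↦ v ])))))

-- Both sides are the determinant of the bordered matrix with first row (1, −b) and remaining rows (aᵢ, eᵢ),
-- computed by clearing its first column by row operations, respectively by column operations.
det-rank-one : ∀ {n} (a b : Vector n) → det (λ i j → δ i j + a i * b j) ≡ + 1 + a · b
det-rank-one {n} a b = trans (sym left) right
  where
  M L : Fin (suc n) → Fin (suc n) → ℤ
  M zero    zero    = + 1
  M zero    (suc j) = - b j
  M (suc i) zero    = a i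
  M (suc i) (suc j) = δ i j
  L zero    zero    = + 1
  L zero    (suc j) = + 0
  L (suc i) zero    = - a i
  L (suc i) (suc j) = δ i j
  det-L : det L ≡ + 1
  det-L = trans (det-first-row L λ _ → refl) (trans (cong (+ 1 *_) (det-δ n)) refl)
  left : det M ≡ det (λ i j → δ i j + a i * b j)
  left = trans (sym (trans (cong (_* det M) det-L) (ℤP.*-identityˡ (det M))))
    (trans (sym (det-⊗ L M))
    (trans (sym (det-ᵀ (L ⊗ M)))
    (trans (det-first-row ((L ⊗ M) ᵀ) column)
    (trans (cong₂ _*_ corner (trans (det-ᵀ _) (det-cong block))) (ℤP.*-identityˡ _)))))
    where
    corner : (L ⊗ M) zero zero ≡ + 1
    corner = trans (∑-∷ {n} _) (cong (_+_ (+ 1)) (∑-zero {n} λ _ → refl))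
    column : ∀ i → (L ⊗ M) (suc i) zero ≡ + 0
    column i = trans (∑-∷ {n} _) (trans (cong (_+_ (- a i * + 1)) (∑-δˡ i a)) (arith (a i)))
      where
      arith : ∀ a → - a * + 1 + a ≡ + 0
      arith = solve-∀
    block : ∀ i j → (L ⊗ M) (suc i) (suc j) ≡ δ i j + a i * b j
    block i j = trans (∑-∷ {n} _) (trans (cong (_+_ (- a i * - b j)) (∑-δˡ i (λ k → δ k j)))
      (arith (a i) (b j) (δ i j)))
      where
      arith : ∀ a b d → - a * - b + d ≡ d + a * b
      arith = solve-∀
  right : det M ≡ + 1 + a · b
  right = trans (sym (trans (cong (det M *_) det-L) (ℤP.*-identityʳ (det M))))
    (trans (sym (det-⊗ M L))
    (trans (sym (det-ᵀ (M ⊗ L)))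
    (trans (det-first-row ((M ⊗ L) ᵀ) column)
    (trans (cong₂ _*_ corner (trans (det-ᵀ _) (trans (det-cong block) (det-δ n)))) (ℤP.*-identityʳ _)))))
    where
    corner : (M ⊗ L) zero zero ≡ + 1 + a · b
    corner = trans (∑-∷ {n} _) (cong (_+_ (+ 1)) (∑-cong λ k → arith (a k) (b k)))
      where
      arith : ∀ a b → - b * - a ≡ a * b
      arith = solve-∀
    column : ∀ i → (M ⊗ L) (suc i) zero ≡ + 0
    column i = trans (∑-∷ {n} _) (trans (cong (_+_ (a i * + 1)) (∑-δˡ i (λ k → - a k))) (arith (a i)))
      where
      arith : ∀ a → a * + 1 + - a ≡ + 0
      arith = solve-∀
    block : ∀ i j → (M ⊗ L) (suc i) (suc j) ≡ δ i j
    block i j = trans (∑-∷ {n} _) (trans (cong (_+_ (a i * + 0)) (⊗-identityˡ δ i j)) (arith (a i) (δ i j)))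
      where
      arith : ∀ a d → a * + 0 + d ≡ d
      arith = solve-∀

-- Laws of the dot product

·-comm : ∀ {n} (u v : Vector n) → u · v ≡ v · u
·-comm u v = ∑-cong λ i → ℤP.*-comm (u i) (v i)

·-scaleʳ : ∀ {n} c (u v : Vector n) → u · (λ i → c * v i) ≡ c * (u · v)
·-scaleʳ c u v = trans (∑-cong λ i → arith (u i) c (v i)) (sym (*-distribˡ-∑ c _))
  where
  arith : ∀ u c v → u * (c * v) ≡ c * (u * v)
  arith = solve-∀

·-+ʳ : ∀ {n} (u v w : Vector n) → u · (λ i → v i + w i) ≡ u · v + u · w
·-+ʳ u v w = trans (∑-cong λ i → ℤP.*-distribˡ-+ (u i) (v i) (w i)) (∑-distrib-+ (λ i → u i * v i) (λ i → u i * w i))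

·-linearʳ : ∀ {n} (u v w : Vector n) c → u · (λ i → v i + c * w i) ≡ u · v + c * (u · w)
·-linearʳ u v w c = trans (·-+ʳ u v (λ i → c * w i)) (cong (_+_ (u · v)) (·-scaleʳ c u w))

·-linearˡ : ∀ {n} (u v w : Vector n) c → (λ i → v i + c * w i) · u ≡ v · u + c * (w · u)
·-linearˡ u v w c = trans (·-comm (λ i → v i + c * w i) u) (trans (·-linearʳ u v w c)
                      (cong₂ (λ x y → x + c * y) (·-comm u v) (·-comm u w)))

·-congʳ : ∀ {n} (u : Vector n) {v w : Vector n} → (∀ i → v i ≡ w i) → u · v ≡ u · w
·-congʳ u p = ∑-cong λ i → cong (u i *_) (p i)

·-congˡ : ∀ {n} {u v : Vector n} (w : Vector n) → (∀ i → u i ≡ v i) → u · w ≡ v · w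
·-congˡ w p = ∑-cong λ i → cong (_* w i) (p i)

neg-·ˡ : ∀ {n} (u v : Vector n) → (λ i → - u i) · v ≡ - (u · v)
neg-·ˡ u v = trans (∑-cong λ i → lem (u i) (v i))
  (trans (sym (*-distribˡ-∑ (- + 1) (λ i → u i * v i))) (ℤP.-1*i≡-i (u · v)))
  where
  lem : ∀ a b → - a * b ≡ - + 1 * (a * b)
  lem = solve-∀

neg-·ʳ : ∀ {n} (u v : Vector n) → u · (λ i → - v i) ≡ - (u · v)
neg-·ʳ u v = trans (·-comm u (λ i → - v i)) (trans (neg-·ˡ v u) (cong -_ (·-comm v u)))

-- Divisibility and congruences

∣-∑ : ∀ {n d} {f : Vector n} → (∀ i → d ∣ f i) → d ∣ ∑ f
∣-∑ {zero}  {f = f} h = subst (_ ∣_) (sym (∑-[] f)) (divides (+ 0) refl)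
∣-∑ {suc n} {f = f} h = subst (_ ∣_) (sym (∑-∷ f)) (ℤS.∣m∣n⇒∣m+n (h zero) (∣-∑ (h ∘ suc)))

all-or-counterexample : ∀ {n} {P : Fin n → Set} → (∀ i → Dec (P i)) → (∀ i → P i) ⊎ (∃ λ i → ¬ P i)
all-or-counterexample {n} {P} P? with FinP.all? P?
... | yes h = inj₁ h
... | no ¬h = inj₂ (FinP.¬∀⟶∃¬ n P P? ¬h)

-- A record, so that both sides of a congruence can be inferred.
infix 4 _≈_[mod_]
record _≈_[mod_] (a b D : ℤ) : Set where
  constructor congruent
  field difference : D ∣ a - b
open _≈_[mod_] public

module Mod (D : ℤ) where
  infix 4 _≈_
  _≈_ : ℤ → ℤ → Set
  a ≈ b = a ≈ b [mod D ]

  ≈-reflexive : ∀ {a b} → a ≡ b → a ≈ b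
  ≈-reflexive {a} refl = congruent (subst (D ∣_) (sym (ℤP.+-inverseʳ a)) (divides (+ 0) refl))

  ≈-refl : ∀ {a} → a ≈ a
  ≈-refl = ≈-reflexive refl

  ≈-sym : ∀ {a b} → a ≈ b → b ≈ a
  ≈-sym {a} {b} (congruent p) = congruent (subst (D ∣_) (arith a b) (ℤS.∣m⇒∣-m p))
    where
    arith : ∀ a b → - (a - b) ≡ b - a
    arith = solve-∀

  ≈-trans : ∀ {a b c} → a ≈ b → b ≈ c → a ≈ c
  ≈-trans {a} {b} {c} (congruent p) (congruent q) = congruent (subst (D ∣_) (arith a b c) (ℤS.∣m∣n⇒∣m+n p q))
    where
    arith : ∀ a b c → (a - b) + (b - c) ≡ a - c
    arith = solve-∀

  ≈-setoid : Setoid _ _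
  ≈-setoid = record { Carrier = ℤ ; _≈_ = _≈_ ; isEquivalence = record
    { refl = ≈-refl ; sym = ≈-sym ; trans = ≈-trans } }

  module ≈-Reasoning = SetoidReasoning ≈-setoid

  ∣⇒≈0 : ∀ {a} → D ∣ a → a ≈ + 0
  ∣⇒≈0 {a} p = congruent (subst (D ∣_) (sym (ℤP.+-identityʳ a)) p)

  ≈0⇒∣ : ∀ {a} → a ≈ + 0 → D ∣ a
  ≈0⇒∣ {a} (congruent p) = subst (D ∣_) (ℤP.+-identityʳ a) p

  +-cong : ∀ {a b c d} → a ≈ b → c ≈ d → a + c ≈ b + d
  +-cong {a} {b} {c} {d} (congruent p) (congruent q) = congruent (subst (D ∣_) (arith a b c d) (ℤS.∣m∣n⇒∣m+n p q))
    where
    arith : ∀ a b c d → (a - b) + (c - d) ≡ (a + c) - (b + d)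
    arith = solve-∀

  *-cong : ∀ {a b c d} → a ≈ b → c ≈ d → a * c ≈ b * d
  *-cong {a} {b} {c} {d} (congruent p) (congruent q) =
    congruent (subst (D ∣_) (arith a b c d) (ℤS.∣m∣n⇒∣m+n (ℤS.∣m⇒∣m*n c p) (ℤS.∣n⇒∣m*n b q)))
    where
    arith : ∀ a b c d → (a - b) * c + b * (c - d) ≡ a * c - b * d
    arith = solve-∀

  *-congˡ : ∀ a {b c} → b ≈ c → a * b ≈ a * c
  *-congˡ a = *-cong (≈-refl {a})

  *-congʳ : ∀ c {a b} → a ≈ b → a * c ≈ b * c
  *-congʳ c p = *-cong p (≈-refl {c})

  neg-cong : ∀ {a b} → a ≈ b → - a ≈ - b
  neg-cong {a} {b} (congruent p) = congruent (subst (D ∣_) (arith a b) (ℤS.∣m⇒∣-m p))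
    where
    arith : ∀ a b → - (a - b) ≡ - a - - b
    arith = solve-∀

  *-zero : ∀ a {b} → b ≈ + 0 → a * b ≈ + 0
  *-zero a p = ≈-trans (*-congˡ a p) (≈-reflexive (ℤP.*-zeroʳ a))

  zero-* : ∀ b {a} → a ≈ + 0 → a * b ≈ + 0
  zero-* b p = *-congʳ b p

  ∑-≈ : ∀ {n} {f g : Vector n} → (∀ i → f i ≈ g i) → ∑ f ≈ ∑ g
  ∑-≈ {zero} {f} {g} h = ≈-reflexive (trans (∑-[] f) (sym (∑-[] g)))
  ∑-≈ {suc n} {f} {g} h =
    ≈-trans (≈-reflexive (∑-∷ f)) (≈-trans (+-cong (h zero) (∑-≈ (h ∘ suc))) (≈-reflexive (sym (∑-∷ g))))

  ∑-≈0 : ∀ {n} {f : Vector n} → (∀ i → f i ≈ + 0) → ∑ f ≈ + 0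
  ∑-≈0 h = ≈-trans (∑-≈ h) (≈-reflexive (∑-zero λ _ → refl))

  ·-≈ʳ : ∀ {n} (u : Vector n) {v w : Vector n} → (∀ i → v i ≈ w i) → u · v ≈ u · w
  ·-≈ʳ u h = ∑-≈ λ i → *-congˡ (u i) (h i)

  ·-≈ˡ : ∀ {n} {u v : Vector n} (w : Vector n) → (∀ i → u i ≈ v i) → u · w ≈ v · w
  ·-≈ˡ w h = ∑-≈ λ i → *-congʳ (w i) (h i)

  det-≈ : ∀ {n} {A B : Fin n → Fin n → ℤ} → (∀ i j → A i j ≈ B i j) → det A ≈ det B
  det-≈ {zero} {A} {B} h = ≈-reflexive (trans (det-[] A) (sym (det-[] B)))
  det-≈ {suc n} {A} {B} h =
    ≈-trans (≈-reflexive (det-expand A)) (≈-trans (∑-≈ λ j → *-congˡ (sgn (toℕ j))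
      (*-cong (h zero j) (det-≈ λ i k → h (suc i) (punchIn j k)))) (≈-reflexive (sym (det-expand B))))

  _≈0? : ∀ a → Dec (a ≈ + 0)
  a ≈0? with D ℤS.∣? a
  ... | yes p = yes (∣⇒≈0 p)
  ... | no ¬p = no (¬p ∘ ≈0⇒∣)

-- Linear algebra modulo a prime

prime-∣-* : ∀ {p} → Prime p → ∀ a b → + p ∣ a * b → + p ∣ a ⊎ + p ∣ b
prime-∣-* {p} pr a b h with euclidsLemma ℤ.∣ a ∣ ℤ.∣ b ∣ pr (subst (p ℕD.∣_) (ℤP.abs-* a b) (ℤS.∣⇒∣ᵤ h))
... | inj₁ q = inj₁ (ℤS.∣ᵤ⇒∣ q)
... | inj₂ q = inj₂ (ℤS.∣ᵤ⇒∣ q)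

prime-coprime : ∀ {p} → Prime p → ∀ {a} → ¬ (p ℕD.∣ a) → ℕC.Coprime p a
prime-coprime pr ¬p {d} (d∣p , d∣a) with prime⇒irreducible pr d∣p
... | inj₁ d≡1  = d≡1
... | inj₂ refl = ⊥-elim (¬p d∣a)

module ModPrime (p : ℕ) (pr : Prime p) where
  open Mod (+ p) public

  *-≈0 : ∀ {a b} → a * b ≈ + 0 → a ≈ + 0 ⊎ b ≈ + 0
  *-≈0 {a} {b} h with prime-∣-* pr a b (≈0⇒∣ h)
  ... | inj₁ q = inj₁ (∣⇒≈0 q)
  ... | inj₂ q = inj₂ (∣⇒≈0 q)

  1≉0 : ¬ (+ 1 ≈ + 0)
  1≉0 h = ¬prime[1] (subst Prime (ℕD.∣1⇒≡1 (ℤS.∣⇒∣ᵤ (≈0⇒∣ h))) pr)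

  opaque
    invert : ∀ {a} → ¬ (a ≈ + 0) → ∃ λ s → s * a ≈ + 1
    invert {a} a≉0 = fromAbs (inverse ℤ.∣ a ∣ (ℕC.coprime-Bézout (prime-coprime pr ¬p∣)))
      where
      ¬p∣ : ¬ (p ℕD.∣ ℤ.∣ a ∣)
      ¬p∣ h = a≉0 (∣⇒≈0 (ℤS.∣ᵤ⇒∣ h))
      inverse : ∀ m → ℕG.Bézout.Identity 1 p m → ∃ λ s → s * + m ≈ + 1
      inverse m (ℕG.Bézout.+- x y eq) = - + y , congruent (divides (- + x) (arith (+ x) (+ y) (+ m) (+ p)
        (trans (cong (_+_ (+ 1)) (sym (ℤP.pos-* y m))) (trans (cong +_ eq) (ℤP.pos-* x p)))))
        where
        arith : ∀ x y m p → + 1 + y * m ≡ x * p → - y * m - + 1 ≡ - x * p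
        arith x y m p h = trans (lem₁ y m) (trans (cong -_ h) (lem₂ x p))
          where
          lem₁ : ∀ y m → - y * m - + 1 ≡ - (+ 1 + y * m)
          lem₁ = solve-∀
          lem₂ : ∀ x p → - (x * p) ≡ - x * p
          lem₂ = solve-∀
      inverse m (ℕG.Bézout.-+ x y eq) = + y , congruent (divides (+ x) (arith (+ x) (+ y) (+ m) (+ p)
        (trans (cong (_+_ (+ 1)) (sym (ℤP.pos-* x p))) (trans (cong +_ eq) (ℤP.pos-* y m)))))
        where
        arith : ∀ x y m p → + 1 + x * p ≡ y * m → y * m - + 1 ≡ x * p
        arith x y m p h = trans (cong (_- + 1) (sym h)) (lem x p)
          where
          lem : ∀ x p → + 1 + x * p - + 1 ≡ x * p
          lem = solve-∀
      fromAbs : (∃ λ s → s * + ℤ.∣ a ∣ ≈ + 1) → ∃ λ s → s * a ≈ + 1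
      fromAbs (s , h) with ℤP.+∣i∣≡i⊎+∣i∣≡-i a
      ... | inj₁ eq = s , subst (λ x → s * x ≈ + 1) eq h
      ... | inj₂ eq = - s , subst (λ x → x ≈ + 1) (trans (cong (s *_) eq) (lem s a)) h
        where
        lem : ∀ s a → s * - a ≡ - s * a
        lem = solve-∀

  Solvable : ∀ {m n} → (Fin m → Fin n → ℤ) → Vector m → Set
  Solvable A b = ∃ λ y → ∀ i → A i · y ≈ b i

  Obstructed : ∀ {m n} → (Fin m → Fin n → ℤ) → Vector m → Set
  Obstructed A b = ∃ λ w → (∀ j → w · (A ᵀ) j ≈ + 0) × ¬ (w · b ≈ + 0)

  -- Gaussian elimination of one unknown at a time. An unknown with vanishing column is set to 0;
  -- otherwise a pivot row removes it, and solutions as well as obstructions of the reduced system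
  -- extend to the given one.
  fredholm : ∀ {m n} (A : Fin m → Fin n → ℤ) (b : Vector m) → Solvable A b ⊎ Obstructed A b
  fredholm {m} {zero} A b with all-or-counterexample (λ i → b i ≈0?)
  ... | inj₁ h = inj₁ ((λ ()) , λ i → ≈-trans (≈-reflexive (∑-[] _)) (≈-sym (h i)))
  ... | inj₂ (i , ¬h) = inj₂ (δ i , (λ ()) , λ q → ¬h (≈-trans (≈-reflexive (sym (∑-δˡ i b))) q))
  fredholm {m} {suc n} A b with all-or-counterexample (λ i → A i zero ≈0?)
  ... | inj₁ h = lift (fredholm (λ i j → A i (suc j)) b)
    where
    lift : Solvable (λ i j → A i (suc j)) b ⊎ Obstructed (λ i j → A i (suc j)) b → Solvable A b ⊎ Obstructed A b
    lift (inj₁ (y , q)) = inj₁ ((+ 0 ◂ y) , λ i → ≈-trans (≈-reflexive (trans (∑-∷ _)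
      (trans (cong (_+ (λ j → A i (suc j)) · y) (ℤP.*-zeroʳ (A i zero))) (ℤP.+-identityˡ _)))) (q i))
    lift (inj₂ (w , q , r)) = inj₂ (w , (λ { zero → ∑-≈0 λ i → *-zero (w i) (h i) ; (suc j) → q j }) , r)
  ... | inj₂ (i₀ , ≉0) = lift (fredholm A′ b′)
    where
    s = proj₁ (invert ≉0)
    s-inv = proj₂ (invert ≉0)
    A′ : Fin m → Fin n → ℤ
    A′ i j = A i (suc j) + - (s * A i₀ (suc j)) * A i zero
    b′ : Vector m
    b′ i = b i + - (s * b i₀) * A i zero
    lift : Solvable A′ b′ ⊎ Obstructed A′ b′ → Solvable A b ⊎ Obstructed A b
    lift (inj₁ (y , q)) = inj₁ ((y₀ ◂ y) , λ i → ≈-trans (≈-reflexive (step i))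
      (≈-trans (+-cong (q i) ≈-refl) (≈-reflexive (finish (b i) s (b i₀) (A i zero)))))
      where
      T = (λ j → A i₀ (suc j)) · y
      y₀ = s * (b i₀ - T)
      row : ∀ i → A′ i · y ≡ (λ j → A i (suc j)) · y + - (A i zero * s) * T
      row i = trans (·-congˡ y (λ j → lem (A i (suc j)) s (A i₀ (suc j)) (A i zero)))
                    (·-linearˡ y (λ j → A i (suc j)) (λ j → A i₀ (suc j)) (- (A i zero * s)))
        where
        lem : ∀ a s b c → a + - (s * b) * c ≡ a + - (c * s) * b
        lem = solve-∀
      finish : ∀ b s c a → b + - (s * c) * a + a * s * c ≡ b
      finish = solve-∀
      step : ∀ i → A i · (y₀ ◂ y) ≡ A′ i · y + A i zero * s * b i₀
      step i = trans (∑-∷ _) (trans (lem (A i zero) s (b i₀) T ((λ j → A i (suc j)) · y))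
                     (cong (_+ A i zero * s * b i₀) (sym (row i))))
        where
        lem : ∀ a s b t r → a * (s * (b - t)) + r ≡ r + - (a * s) * t + a * s * b
        lem = solve-∀
    lift (inj₂ (w , q , r)) = inj₂ (w′ , columns , λ h → r
      (≈-trans (≈-reflexive (trans (·-linearʳ w b (λ i → A i zero) (- (s * b i₀)))
        (trans (rearrange (w · b) s (b i₀) (w · (λ i → A i zero))) (sym (expand b))))) h))
      where
      -- The multiple of the pivot row that makes `w′` orthogonal to the eliminated column.
      C = - (s * (w · (λ i → A i zero)))
      w′ : Vector m
      w′ i = w i + C * δ i₀ i
      expand : ∀ v → w′ · v ≡ w · v + C * v i₀
      expand v = trans (·-linearˡ v w (δ i₀) C) (cong (λ x → w · v + C * x) (∑-δˡ i₀ v))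
      rearrange : ∀ x s b y → x + - (s * b) * y ≡ x + - (s * y) * b
      rearrange = solve-∀
      columns : ∀ j → w′ · (A ᵀ) j ≈ + 0
      columns zero = ≈-trans (≈-reflexive (trans (expand _) (lem (w · (λ i → A i zero)) s (A i₀ zero))))
        (*-zero (w · (λ i → A i zero)) (≈-trans (+-cong (≈-refl {+ 1}) (neg-cong s-inv)) ≈-refl))
        where
        lem : ∀ x s a → x + - (s * x) * a ≡ x * (+ 1 + - (s * a))
        lem = solve-∀
      columns (suc j) = ≈-trans (≈-reflexive (trans (expand _) (trans
          (rearrange (w · (λ i → A i (suc j))) s (w · (λ i → A i zero)) (A i₀ (suc j)))
          (sym (·-linearʳ w (λ i → A i (suc j)) (λ i → A i zero) (- (s * A i₀ (suc j)))))))) (q j)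

  -- A vector with nonzero first coordinate serves as pivot: subtracting multiples of it removes one
  -- vector and one coordinate, and its own coefficient is restored afterwards.
  dependent : ∀ {n m} → n ℕ.< m → (V : Fin m → Vector n) →
              ∃ λ (c : Vector m) → (∀ k → ∑ (λ l → c l * V l k) ≈ + 0) × ∃ λ l → ¬ (c l ≈ + 0)
  dependent {zero}  {suc m} n<m V = (λ _ → + 1) , (λ ()) , zero , 1≉0
  dependent {suc n} {suc m} (ℕ.s≤s n<m) V with all-or-counterexample (λ l → V l zero ≈0?)
  ... | inj₁ h with dependent {n} (ℕP.m<n⇒m<1+n n<m) (λ l k → V l (suc k))
  ...   | c , q , r = c , (λ { zero → ∑-≈0 λ l → *-zero (c l) (h l) ; (suc k) → q k }) , r
  dependent {suc n} {suc m} (ℕ.s≤s n<m) V | inj₂ (l₀ , ≉0)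
    with dependent {n} n<m (λ l k → V (punchIn l₀ l) (suc k) + - (proj₁ (invert ≉0) * V l₀ (suc k)) * V
      (punchIn l₀ l) zero)
  ...   | c , q , (l , c≉0) = c′ , relation , punchIn l₀ l , λ h → c≉0 (subst (_≈ + 0) (insertAt-punchIn c l₀ C l) h)
    where
    s = proj₁ (invert ≉0)
    T = c · (λ l → V (punchIn l₀ l) zero)
    C = - (s * T)
    c′ : Vector (suc m)
    c′ = insertAt c l₀ C
    expand : ∀ k → ∑ (λ l → c′ l * V l k) ≡ C * V l₀ k + c · (λ l → V (punchIn l₀ l) k)
    expand k = trans (∑-punchIn l₀ (λ l → c′ l * V l k)) (cong₂ _+_ (cong (_* V l₀ k) (insertAt-lookup c l₀ C))
                  (∑-cong λ l → cong (_* V (punchIn l₀ l) k) (insertAt-punchIn c l₀ C l)))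
    relation : ∀ k → ∑ (λ l → c′ l * V l k) ≈ + 0
    relation zero = ≈-trans (≈-reflexive (trans (expand zero) (lem s T (V l₀ zero))))
        (*-zero T (+-cong (≈-refl {+ 1}) (neg-cong (proj₂ (invert ≉0)))))
      where
      lem : ∀ s x a → - (s * x) * a + x ≡ x * (+ 1 + - (s * a))
      lem = solve-∀
    relation (suc k) = ≈-trans (≈-reflexive (trans (expand (suc k)) (trans
        (lem s T (V l₀ (suc k)) (c · (λ l → V (punchIn l₀ l) (suc k))))
        (sym (·-linearʳ c (λ l → V (punchIn l₀ l) (suc k)) (λ l → V (punchIn l₀ l) zero) (- (s * V l₀ (suc k))))))))
          (q k)
      where
      lem : ∀ s x a y → - (s * x) * a + y ≡ y + - (s * a) * x
      lem = solve-∀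

-- Rational matrices

toℚᵘ-toℚ : ∀ a → ℚ.toℚᵘ (toℚ a) ℚᵘ.≃ ℚᵘ.mkℚᵘ a 0
toℚᵘ-toℚ a = ℚP.toℚᵘ-fromℚᵘ (ℚᵘ.mkℚᵘ a 0)

toℚ-+ : ∀ a b → toℚ (a + b) ≡ toℚ a ℚ.+ toℚ b
toℚ-+ a b = ℚP.toℚᵘ-injective (ℚᵘP.≃-trans (toℚᵘ-toℚ (a + b)) (ℚᵘP.≃-trans (ℚᵘ.*≡* (arith a b))
  (ℚᵘP.≃-sym (ℚᵘP.≃-trans (ℚP.toℚᵘ-homo-+ (toℚ a) (toℚ b)) (ℚᵘP.+-cong (toℚᵘ-toℚ a) (toℚᵘ-toℚ b))))))
  where
  arith : ∀ a b → (a + b) * + 1 ≡ (a * + 1 + b * + 1) * + 1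
  arith = solve-∀

toℚ-* : ∀ a b → toℚ (a * b) ≡ toℚ a ℚ.* toℚ b
toℚ-* a b = ℚP.toℚᵘ-injective (ℚᵘP.≃-trans (toℚᵘ-toℚ (a * b)) (ℚᵘP.≃-trans (ℚᵘ.*≡* refl)
  (ℚᵘP.≃-sym (ℚᵘP.≃-trans (ℚP.toℚᵘ-homo-* (toℚ a) (toℚ b)) (ℚᵘP.*-cong (toℚᵘ-toℚ a) (toℚᵘ-toℚ b))))))

toℚ-neg : ∀ a → toℚ (- a) ≡ ℚ.- toℚ a
toℚ-neg a = ℚP.toℚᵘ-injective (ℚᵘP.≃-trans (toℚᵘ-toℚ (- a))
  (ℚᵘP.≃-sym (ℚᵘP.≃-trans (ℚP.toℚᵘ-homo‿- (toℚ a)) (ℚᵘP.-‿cong (toℚᵘ-toℚ a)))))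

toℚ-injective : ∀ {a b} → toℚ a ≡ toℚ b → a ≡ b
toℚ-injective {a} {b} h with ℚP.fromℚᵘ-injective {ℚᵘ.mkℚᵘ a 0} {ℚᵘ.mkℚᵘ b 0} h
... | ℚᵘ.*≡* eq = trans (sym (ℤP.*-identityʳ a)) (trans eq (ℤP.*-identityʳ b))

toℚ-*-/ : ∀ r k → toℚ (+ suc k) ℚ.* (r ℚ./ suc k) ≡ toℚ r
toℚ-*-/ r k = ℚP.toℚᵘ-injective (ℚᵘP.≃-trans (ℚP.toℚᵘ-homo-* (toℚ (+ suc k)) (r ℚ./ suc k))
  (ℚᵘP.≃-trans (ℚᵘP.*-cong (toℚᵘ-toℚ (+ suc k)) (ℚP.toℚᵘ-fromℚᵘ (ℚᵘ.mkℚᵘ r k)))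
  (ℚᵘP.≃-trans (ℚᵘ.*≡* (trans (arith (+ suc k) r) (cong (λ x → r * (+ suc x)) (sym (ℕP.+-identityʳ k)))))
    (ℚᵘP.≃-sym (toℚᵘ-toℚ r)))))
  where
  arith : ∀ u r → u * r * + 1 ≡ r * u
  arith = solve-∀

sumℚ-cong : ∀ n {f g : Fin n → ℚ} → (∀ i → f i ≡ g i) → sumR ℚops n f ≡ sumR ℚops n g
sumℚ-cong zero    h = refl
sumℚ-cong (suc n) h = cong₂ ℚ._+_ (h zero) (sumℚ-cong n (h ∘ suc))

*-distribˡ-sumℚ : ∀ n c (f : Fin n → ℚ) → c ℚ.* sumR ℚops n f ≡ sumR ℚops n (λ i → c ℚ.* f i)
*-distribˡ-sumℚ zero    c f = ℚP.*-zeroʳ c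
*-distribˡ-sumℚ (suc n) c f =
  trans (ℚP.*-distribˡ-+ c (f zero) _) (cong (ℚ._+_ (c ℚ.* f zero)) (*-distribˡ-sumℚ n c (f ∘ suc)))

opaque
  unfolding ∑ det

  toℚ-∑ : ∀ n (f : Vector n) → toℚ (∑ f) ≡ sumR ℚops n (λ i → toℚ (f i))
  toℚ-∑ zero    f = refl
  toℚ-∑ (suc n) f = trans (toℚ-+ (f zero) _) (cong (ℚ._+_ (toℚ (f zero))) (toℚ-∑ n (f ∘ suc)))

  toℚ-sign : ∀ k a → toℚ (signR ℤops k a) ≡ signR ℚops k (toℚ a)
  toℚ-sign zero    a = refl
  toℚ-sign (suc k) a = trans (toℚ-neg (signR ℤops k a)) (cong ℚ.-_ (toℚ-sign k a))

  toℚ-det : ∀ n (A : Fin n → Fin n → ℤ) → toℚ (det A) ≡ detR ℚops n (λ i j → toℚ (A i j))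
  toℚ-det zero    A = refl
  toℚ-det (suc n) A = trans (toℚ-∑ (suc n) (λ j → signR ℤops (toℕ j) (A zero j * det (minor j A))))
    (sumℚ-cong (suc n) λ j → trans (toℚ-sign (toℕ j) (A zero j * det (minor j A)))
      (cong (signR ℚops (toℕ j)) (trans (toℚ-* (A zero j) (det (minor j A)))
        (cong (toℚ (A zero j) ℚ.*_) (toℚ-det n (minor j A))))))

detℚ-cong : ∀ n {A B : Fin n → Fin n → ℚ} → (∀ i j → A i j ≡ B i j) → detR ℚops n A ≡ detR ℚops n B
detℚ-cong zero    h = refl
detℚ-cong (suc n) h = sumℚ-cong (suc n) λ j → cong (signR ℚops (toℕ j))
  (cong₂ ℚ._*_ (h zero j) (detℚ-cong n λ i k → h (suc i) (punchIn j k)))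

powℚ : ℕ → ℚ → ℚ
powℚ zero    c = ℚ.1ℚ
powℚ (suc n) c = c ℚ.* powℚ n c

signℚ-* : ∀ k c a → signR ℚops k (c ℚ.* a) ≡ c ℚ.* signR ℚops k a
signℚ-* zero    c a = refl
signℚ-* (suc k) c a = trans (cong ℚ.-_ (signℚ-* k c a)) (ℚP.neg-distribʳ-* c (signR ℚops k a))

detℚ-scale : ∀ n c (A : Fin n → Fin n → ℚ) → detR ℚops n (λ i j → c ℚ.* A i j) ≡ powℚ n c ℚ.* detR ℚops n A
detℚ-scale zero    c A = sym (ℚP.*-identityʳ ℚ.1ℚ)
detℚ-scale (suc n) c A = trans (sumℚ-cong (suc n) λ j →
    trans (cong (λ x → signR ℚops (toℕ j) (c ℚ.* A zero j ℚ.* x)) (detℚ-scale n c (λ i k → A (suc i) (punchIn j k))))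
    (trans (cong (signR ℚops (toℕ j)) (arith c (A zero j) (powℚ n c) _)) (signℚ-* (toℕ j) (powℚ (suc n) c) _)))
  (sym (*-distribˡ-sumℚ (suc n) (powℚ (suc n) c)
    (λ j → signR ℚops (toℕ j) (A zero j ℚ.* detR ℚops n (λ i k → A (suc i) (punchIn j k))))))
  where
  arith : ∀ c a p d → c ℚ.* a ℚ.* (p ℚ.* d) ≡ c ℚ.* p ℚ.* (a ℚ.* d)
  arith = solve 4 (λ c a p d → c :* a :* (p :* d) := c :* p :* (a :* d)) refl
    where open +-*-Solver

-- Evaluation of polynomials

eval : ℚ → Poly → ℚ
eval q []      = ℚ.0ℚ
eval q (a ∷ p) = toℚ a ℚ.+ q ℚ.* eval q p

eval-add : ∀ q p r → eval q (polyAdd p r) ≡ eval q p ℚ.+ eval q r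
eval-add q []      r       = sym (ℚP.+-identityˡ (eval q r))
eval-add q (a ∷ p) []      = sym (ℚP.+-identityʳ _)
eval-add q (a ∷ p) (b ∷ r) = trans (cong₂ (λ x y → x ℚ.+ q ℚ.* y) (toℚ-+ a b) (eval-add q p r))
                                   (arith (toℚ a) (toℚ b) q (eval q p) (eval q r))
  where
  arith : ∀ a b q x y → a ℚ.+ b ℚ.+ q ℚ.* (x ℚ.+ y) ≡ a ℚ.+ q ℚ.* x ℚ.+ (b ℚ.+ q ℚ.* y)
  arith = solve 5 (λ a b q x y → a :+ b :+ q :* (x :+ y) := a :+ q :* x :+ (b :+ q :* y)) refl
    where open +-*-Solver

eval-scale : ∀ q c p → eval q (polyScale c p) ≡ toℚ c ℚ.* eval q p
eval-scale q c []      = sym (ℚP.*-zeroʳ (toℚ c))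
eval-scale q c (a ∷ p) = trans (cong₂ (λ x y → x ℚ.+ q ℚ.* y) (toℚ-* c a) (eval-scale q c p))
                               (arith (toℚ c) (toℚ a) q (eval q p))
  where
  arith : ∀ c a q x → c ℚ.* a ℚ.+ q ℚ.* (c ℚ.* x) ≡ c ℚ.* (a ℚ.+ q ℚ.* x)
  arith = solve 4 (λ c a q x → c :* a :+ q :* (c :* x) := c :* (a :+ q :* x)) refl
    where open +-*-Solver

eval-neg : ∀ q p → eval q (polyNeg p) ≡ ℚ.- eval q p
eval-neg q []      = refl
eval-neg q (a ∷ p) = trans (cong₂ (λ x y → x ℚ.+ q ℚ.* y) (toℚ-neg a) (eval-neg q p)) (arith (toℚ a) q (eval q p))
  where
  arith : ∀ a q x → ℚ.- a ℚ.+ q ℚ.* (ℚ.- x) ≡ ℚ.- (a ℚ.+ q ℚ.* x)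
  arith = solve 3 (λ a q x → :- a :+ q :* (:- x) := :- (a :+ q :* x)) refl
    where open +-*-Solver

eval-mul : ∀ q p r → eval q (polyMul p r) ≡ eval q p ℚ.* eval q r
eval-mul q []      r = sym (ℚP.*-zeroˡ (eval q r))
eval-mul q (a ∷ p) r = trans (eval-add q (polyScale a r) (+ 0 ∷ polyMul p r))
  (trans (cong₂ (λ x y → x ℚ.+ (ℚ.0ℚ ℚ.+ q ℚ.* y)) (eval-scale q a r) (eval-mul q p r))
         (trans (cong (ℚ._+_ (toℚ a ℚ.* eval q r)) (ℚP.+-identityˡ _)) (arith (toℚ a) q (eval q p) (eval q r))))
  where
  arith : ∀ a q x y → a ℚ.* y ℚ.+ q ℚ.* (x ℚ.* y) ≡ (a ℚ.+ q ℚ.* x) ℚ.* y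
  arith = solve 4 (λ a q x y → a :* y :+ q :* (x :* y) := (a :+ q :* x) :* y) refl
    where open +-*-Solver

eval-norm : ∀ q p → eval q (normPoly p) ≡ eval q p
eval-norm q []      = refl
eval-norm q (a ∷ p) with normPoly p | eval-norm q p
... | b ∷ r | ih = cong (λ x → toℚ a ℚ.+ q ℚ.* x) ih
... | []    | ih with a ℤ.≟ + 0
...   | yes refl = sym (trans (cong (λ x → ℚ.0ℚ ℚ.+ q ℚ.* x) (sym ih)) (trans (ℚP.+-identityˡ _) (ℚP.*-zeroʳ q)))
...   | no _     = cong (λ x → toℚ a ℚ.+ q ℚ.* x) ih

eval-sum : ∀ q n (f : Fin n → Poly) → eval q (sumR polyOps n f) ≡ sumR ℚops n (λ i → eval q (f i))
eval-sum q zero    f = refl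
eval-sum q (suc n) f = trans (eval-add q (f zero) _) (cong (ℚ._+_ (eval q (f zero))) (eval-sum q n (f ∘ suc)))

eval-sign : ∀ q k p → eval q (signR polyOps k p) ≡ signR ℚops k (eval q p)
eval-sign q zero    p = refl
eval-sign q (suc k) p = trans (eval-neg q (signR polyOps k p)) (cong ℚ.-_ (eval-sign q k p))

eval-det : ∀ q n (M : Fin n → Fin n → Poly) → eval q (detR polyOps n M) ≡ detR ℚops n (λ i j → eval q (M i j))
eval-det q zero    M = trans (cong (ℚ._+_ ℚ.1ℚ) (ℚP.*-zeroʳ q)) (ℚP.+-identityʳ ℚ.1ℚ)
eval-det q (suc n) M = trans (eval-sum q (suc n) (λ j → signR polyOps (toℕ j) (term j))) (sumℚ-cong (suc n) λ j →
  trans (eval-sign q (toℕ j) (term j)) (cong (signR ℚops (toℕ j))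
    (trans (eval-mul q (M zero j) (detR polyOps n (minorP j)))
      (cong (eval q (M zero j) ℚ.*_) (eval-det q n (minorP j))))))
  where
  minorP : Fin (suc n) → Fin n → Fin n → Poly
  minorP j i k = M (suc i) (punchIn j k)
  term : Fin (suc n) → Poly
  term j = polyMul (M zero j) (detR polyOps n (minorP j))

-- The n-th power of the denominator clears all fractions, so a rational value of the characteristic
-- polynomial becomes an integer determinant.
charPoly-scaled : ∀ n (A : Mat n) r k →
  powℚ n (toℚ (+ suc k)) ℚ.* eval (r ℚ./ suc k) (charPoly n A) ≡ toℚ (det (λ i j → r * δ i j + - (+ suc k) * A i j))
charPoly-scaled n A r k =
  trans (cong (powℚ n (toℚ (+ suc k)) ℚ.*_) (trans (eval-norm q (detR polyOps n _)) (eval-det q n _)))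
  (trans (sym (detℚ-scale n u _))
  (trans (detℚ-cong n entry) (sym (toℚ-det n _))))
  where
  q = r ℚ./ suc k
  u = toℚ (+ suc k)
  off : ∀ a → u ℚ.* (toℚ (- a) ℚ.+ q ℚ.* ℚ.0ℚ) ≡ toℚ (r * + 0 + - (+ suc k) * a)
  off a = trans (cong (u ℚ.*_) (trans (cong (ℚ._+_ (toℚ (- a))) (ℚP.*-zeroʳ q)) (ℚP.+-identityʳ (toℚ (- a)))))
          (trans (sym (toℚ-* (+ suc k) (- a))) (cong toℚ (lem r (+ suc k) a)))
    where
    lem : ∀ r u a → u * - a ≡ r * + 0 + - u * a
    lem = solve-∀
  diag : ∀ a → u ℚ.* (toℚ (- a) ℚ.+ q ℚ.* (toℚ (+ 1) ℚ.+ q ℚ.* ℚ.0ℚ)) ≡ toℚ (r * + 1 + - (+ suc k) * a)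
  diag a = trans (cong (λ x → u ℚ.* (toℚ (- a) ℚ.+ q ℚ.* (toℚ (+ 1) ℚ.+ x))) (ℚP.*-zeroʳ q))
    (trans (arith u (toℚ (- a)) q)
    (trans (cong₂ ℚ._+_ (sym (toℚ-* (+ suc k) (- a))) (toℚ-*-/ r k))
    (trans (sym (toℚ-+ (+ suc k * - a) r)) (cong toℚ (lem r (+ suc k) a)))))
    where
    arith : ∀ u a q → u ℚ.* (a ℚ.+ q ℚ.* (ℚ.1ℚ ℚ.+ ℚ.0ℚ)) ≡ u ℚ.* a ℚ.+ u ℚ.* q
    arith = solve 3 (λ u a q → u :* (a :+ q :* (con ℚ.1ℚ :+ con ℚ.0ℚ)) := u :* a :+ u :* q) refl
      where open +-*-Solver
    lem : ∀ r u a → u * - a + r ≡ r * + 1 + - u * a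
    lem = solve-∀
  entry : ∀ i j → u ℚ.* eval q (if does (i ≟ j) then (- A i j) ∷ + 1 ∷ [] else (- A i j) ∷ [])
          ≡ toℚ (r * δ i j + - (+ suc k) * A i j)
  entry i j with i ≟ j
  ... | yes _ = diag (A i j)
  ... | no _  = off (A i j)

spectrum-det : ∀ n {A B : Mat n} → SameSpectrum n A B → ∀ r k →
  det (λ i j → r * δ i j + - (+ suc k) * A i j) ≡ det (λ i j → r * δ i j + - (+ suc k) * B i j)
spectrum-det n {A} {B} h r k = toℚ-injective (trans (sym (charPoly-scaled n A r k))
  (trans (cong (λ p → powℚ n (toℚ (+ suc k)) ℚ.* eval (r ℚ./ suc k) p) h) (charPoly-scaled n B r k)))

-- Walk vectors and their moments

𝟏 : ∀ {n} → Vector n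
𝟏 _ = + 1

infixr 7 _⊙_
_⊙_ : ∀ {m n} → (Fin m → Fin n → ℤ) → Vector n → Vector m
(A ⊙ v) i = A i · v

walk : ∀ {n} → Mat n → ℕ → Vector n
walk A zero    = 𝟏
walk A (suc k) = A ⊙ walk A k

moment : ∀ {n} → Mat n → ℕ → ℤ
moment A k = walk A k · 𝟏

Skew : ∀ {n} → Mat n → Set
Skew A = ∀ i j → A i j ≡ - A j i

powVec-walk : ∀ n (A : Mat n) k i → powVec n A k i ≡ walk A k i
powVec-walk n A zero    i = refl
powVec-walk n A (suc k) i = trans (sym (∑-sumR (λ j → A i j * powVec n A k j)))
  (∑-cong λ j → cong (A i j *_) (powVec-walk n A k j))

-- The geometric series of (I - wA)⁻¹𝟏, truncated after K terms; integers modulo wᴷ take the place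
-- of formal power series.
module WalkSeries {n} (A : Mat n) (w : ℤ) where

  resolvent : Mat n
  resolvent i j = δ i j + - w * A i j

  partialSum : ℕ → Vector n
  partialSum zero    i = + 0
  partialSum (suc K) i = partialSum K i + w ℤ.^ K * walk A K i

  momentSum : ℕ → ℤ
  momentSum zero    = + 0
  momentSum (suc K) = momentSum K + w ℤ.^ K * moment A K

  partialSum-moment : ∀ K → partialSum K · 𝟏 ≡ momentSum K
  partialSum-moment zero    = ∑-zero λ _ → refl
  partialSum-moment (suc K) = trans (·-linearˡ 𝟏 (partialSum K) (walk A K) (w ℤ.^ K))
                                    (cong (_+ w ℤ.^ K * moment A K) (partialSum-moment K))

  resolvent-· : ∀ i v → resolvent i · v ≡ v i + - w * (A i · v)
  resolvent-· i v = trans (·-linearˡ v (δ i) (A i) (- w)) (cong (_+ - w * (A i · v)) (∑-δˡ i v))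

  resolvent-partialSum : ∀ K i → resolvent i · partialSum K ≡ + 1 + - (w ℤ.^ K * walk A K i)
  resolvent-partialSum zero i = ∑-zero λ j → ℤP.*-zeroʳ (resolvent i j)
  resolvent-partialSum (suc K) i =
    trans (·-linearʳ (resolvent i) (partialSum K) (walk A K) (w ℤ.^ K))
    (trans (cong₂ (λ x y → x + w ℤ.^ K * y) (resolvent-partialSum K i) (resolvent-· i (walk A K)))
           (arith (w ℤ.^ K) (walk A K i) w (walk A (suc K) i)))
    where
    arith : ∀ p x w y → (+ 1 + - (p * x)) + p * (x + - w * y) ≡ + 1 + - (w * p * y)
    arith = solve-∀

  -- Modulo wᴷ, the all-ones matrix J equals resolvent · partialSum · 𝟏ᵀ.
  det-resolvent+J : ∀ K → det (λ i j → resolvent i j + w) ≈ det resolvent * (+ 1 + w * momentSum K) [mod w ℤ.^ K ]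
  det-resolvent+J K = begin
    det (λ i j → resolvent i j + w) ≈⟨ det-≈ (λ i j → ≈-sym (entry i j)) ⟩
    det (resolvent ⊗ rankOne) ≡⟨ det-⊗ resolvent rankOne ⟩
    det resolvent * det rankOne ≡⟨ cong (det resolvent *_) (det-rank-one (λ i → w * partialSum K i) 𝟏) ⟩
    det resolvent * (+ 1 + (λ i → w * partialSum K i) · 𝟏)
      ≡⟨ cong (λ x → det resolvent * (+ 1 + x)) (trans (·-comm (λ i → w * partialSum K i) 𝟏)
           (trans (·-scaleʳ w 𝟏 (partialSum K)) (cong (w *_)
             (trans (·-comm 𝟏 (partialSum K)) (partialSum-moment K))))) ⟩
    det resolvent * (+ 1 + w * momentSum K) ∎
    where
    open Mod (w ℤ.^ K)
    open ≈-Reasoning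
    rankOne : Mat n
    rankOne i j = δ i j + w * partialSum K i * + 1
    expand : ∀ i j → (resolvent ⊗ rankOne) i j ≡ resolvent i j + w * (+ 1 + - (w ℤ.^ K * walk A K i))
    expand i j = trans (·-congʳ (resolvent i) λ k → cong (_+_ (δ k j)) (ℤP.*-identityʳ (w * partialSum K k)))
      (trans (·-linearʳ (resolvent i) (λ k → δ k j) (partialSum K) w)
             (cong₂ (λ x y → x + w * y) (⊗-identityʳ resolvent i j) (resolvent-partialSum K i)))
    entry : ∀ i j → (resolvent ⊗ rankOne) i j ≈ resolvent i j + w
    entry i j = ≈-trans (≈-reflexive (expand i j)) (congruent (divides (- (w * walk A K i))
                  (arith (resolvent i j) w (w ℤ.^ K) (walk A K i))))
      where
      arith : ∀ r w p x → r + w * (+ 1 + - (p * x)) - (r + w) ≡ - (w * x) * p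
      arith = solve-∀

  det-resolvent≈1 : det resolvent ≈ + 1 [mod w ]
  det-resolvent≈1 = ≈-trans (det-≈ λ i j → congruent (divides (- A i j) (arith (δ i j) w (A i j))))
    (≈-reflexive (det-δ n))
    where
    open Mod w
    arith : ∀ d w a → d + - w * a - d ≡ - a * w
    arith = solve-∀

-- R is a unit modulo every power of w. Each step shows w ∣ x, divides x by w and lowers the
-- exponent.
unit-cancel : ∀ {R w} .{{_ : ℤ.NonZero w}} → R ≈ + 1 [mod w ] → ∀ K x → w ℤ.^ K ∣ R * x → w ℤ.^ K ∣ x
unit-cancel R≈1 zero    x h = divides x (sym (ℤP.*-identityʳ x))
unit-cancel {R} {w} R≈1 (suc K) x h = subst (w * w ℤ.^ K ∣_) (trans (ℤP.*-comm w x′) (sym x≡)) (ℤS.*-monoʳ-∣ w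
  (unit-cancel {R} {w} R≈1 K x′ (ℤS.*-cancelˡ-∣ w (subst (w * w ℤ.^ K ∣_) (trans (cong (R *_) x≡) (arith R x′ w)) h))))
  where
  arith : ∀ R x w → R * (x * w) ≡ w * (R * x)
  arith = solve-∀
  w∣x : w ∣ x
  w∣x = subst (w ∣_) (lem R x) (ℤS.∣m∣n⇒∣m-n (ℤS.∣-trans (divides (w ℤ.^ K) (ℤP.*-comm w (w ℤ.^ K))) h)
    (ℤS.∣m⇒∣m*n x (difference R≈1)))
    where
    lem : ∀ R x → R * x - (R - + 1) * x ≡ x
    lem = solve-∀
  x′ = _∣_.quotient w∣x
  x≡ : x ≡ x′ * w
  x≡ = _∣_.equality w∣x

∣-all⇒≡0 : ∀ x → (∀ k → -[1+ k ] ∣ x) → x ≡ + 0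
∣-all⇒≡0 x h with ℤ.∣ x ∣ in eq
... | zero  = ℤP.∣i∣≡0⇒i≡0 eq
-- The chosen divisor has absolute value m + 2, one more than x.
... | suc m = ⊥-elim (ℕD.>⇒∤ ℕP.≤-refl (subst (suc (suc m) ℕD.∣_) eq (ℤS.∣⇒∣ᵤ (h (suc m)))))

-- Strong induction: if the moments below j agree, the two sums differ by wʲ(Δⱼ + wΔⱼ₊₁), where Δ
-- denotes the difference of moments. Hence w ∣ Δⱼ for every negative w, and Δⱼ = 0.
moments-equal : ∀ {n} (A B : Mat n) →
  (∀ k → det (WalkSeries.resolvent A -[1+ k ]) ≡ det (WalkSeries.resolvent B -[1+ k ])) →
  (∀ k → det (λ i j → WalkSeries.resolvent A -[1+ k ] i j + -[1+ k ]) ≡ det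
    (λ i j → WalkSeries.resolvent B -[1+ k ] i j + -[1+ k ])) →
  ∀ j → moment A j ≡ moment B j
moments-equal A B dets detsJ = <-rec _ step
  where
  module _ (k : ℕ) where
    w = -[1+ k ]
    module 𝔸 = WalkSeries A w
    module 𝔹 = WalkSeries B w

    -- The moment sum enters the determinant with a factor w, so working modulo the next power
    -- leaves wᴷ after cancellation.
    sums-congruent : ∀ K → w ℤ.^ K ∣ 𝔸.momentSum (suc K) - 𝔹.momentSum (suc K)
    sums-congruent K = ℤS.*-cancelˡ-∣ w (unit-cancel {det 𝔸.resolvent} {w} 𝔸.det-resolvent≈1 (suc K) _
      (subst (w ℤ.^ suc K ∣_) (arith (det 𝔸.resolvent) w (𝔸.momentSum (suc K)) (𝔹.momentSum (suc K)))
        (difference both)))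
      where
      open Mod (w ℤ.^ suc K)
      both : det 𝔸.resolvent * (+ 1 + w * 𝔸.momentSum (suc K)) ≈ det 𝔸.resolvent * (+ 1 + w * 𝔹.momentSum (suc K))
      both = ≈-trans (≈-sym (𝔸.det-resolvent+J (suc K)))
        (≈-trans (≈-reflexive (detsJ k)) (≈-trans (𝔹.det-resolvent+J (suc K))
               (≈-reflexive (cong (_* (+ 1 + w * 𝔹.momentSum (suc K))) (sym (dets k))))))
      arith : ∀ R w x y → R * (+ 1 + w * x) - R * (+ 1 + w * y) ≡ R * (w * (x - y))
      arith = solve-∀

    prefix-equal : ∀ K → (∀ {i} → i ℕ.< K → moment A i ≡ moment B i) → 𝔸.momentSum K ≡ 𝔹.momentSum K
    prefix-equal zero    h = refl
    prefix-equal (suc K) h = cong₂ (λ x y → x + w ℤ.^ K * y) (prefix-equal K (λ i<K → h (ℕP.m<n⇒m<1+n i<K)))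
      (h ℕP.≤-refl)

    w∣difference : ∀ j → (∀ {i} → i ℕ.< j → moment A i ≡ moment B i) → w ∣ moment A j - moment B j
    w∣difference j ih = subst (w ∣_) (undo (moment A j - moment B j) w (moment A (suc j) - moment B (suc j)))
      (ℤS.∣m∣n⇒∣m-n {w} (ℤS.*-cancelˡ-∣ (w ℤ.^ j) {{ℤ.≢-nonZero (λ h → -[1+]≢0 (ℤP.i^n≡0⇒i≡0 w j h))}}
        (subst (w ℤ.^ j * w ∣_) expand (subst (_∣ 𝔸.momentSum (suc (suc j)) - 𝔹.momentSum (suc (suc j)))
          (ℤP.*-comm w (w ℤ.^ j)) (sums-congruent (suc j)))))
        (divides (moment A (suc j) - moment B (suc j)) (ℤP.*-comm w _)))
      where
      -[1+]≢0 : w ≢ + 0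
      -[1+]≢0 ()
      undo : ∀ x w y → x + w * y - w * y ≡ x
      undo = solve-∀
      arith : ∀ g p w a b c d → (g + p * a + w * p * b) - (g + p * c + w * p * d) ≡ p * (a - c + w * (b - d))
      arith = solve-∀
      expand : 𝔸.momentSum (suc (suc j)) - 𝔹.momentSum (suc (suc j)) ≡ w ℤ.^ j *
        (moment A j - moment B j + w * (moment A (suc j) - moment B (suc j)))
      expand = trans (cong (λ g → 𝔸.momentSum (suc (suc j)) -
        (g + w ℤ.^ j * moment B j + w ℤ.^ suc j * moment B (suc j))) (sym (prefix-equal j ih)))
        (arith (𝔸.momentSum j) (w ℤ.^ j) w (moment A j) (moment A (suc j)) (moment B j) (moment B (suc j)))

  step : ∀ j → (∀ {i} → i ℕ.< j → moment A i ≡ moment B i) → moment A j ≡ moment B j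
  step j ih = ℤP.i-j≡0⇒i≡j _ _ (∣-all⇒≡0 _ (λ k → w∣difference k j ih))

-- Put u = k + 1 and w = -u. Then I - wS = I + uS is the transpose of I - uS, and I - wS + wJ = (1 -
-- u)I - u(J - I - S). Both determinants are thus scaled characteristic polynomials, taken at 1/u
-- and (1 - u)/u.
cospectral-moments : ∀ n (Γ Δ : OGraph n) → GenCospectral n Γ Δ → ∀ k → moment (S Γ) k ≡ moment (S Δ) k
cospectral-moments n Γ Δ (h₁ , h₂) = moments-equal (S Γ) (S Δ)
  (λ k → trans (dets Γ k) (trans (spectrum-det n h₁ (+ 1) k) (sym (dets Δ k))))
  (λ k → trans (detsJ Γ k) (trans (spectrum-det n h₂ (+ 1 + -[1+ k ]) k) (sym (detsJ Δ k))))
  where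
  dets : ∀ (Θ : OGraph n) k → det (WalkSeries.resolvent (S Θ) -[1+ k ]) ≡ det (λ i j → + 1 * δ i j + -[1+ k ] * S Θ i j)
  dets Θ k = trans (sym (det-ᵀ (WalkSeries.resolvent (S Θ) -[1+ k ]))) (det-cong λ i j →
    trans (cong₂ (λ d s → d + + suc k * s) (δ-sym j i) (skew Θ j i)) (arith (δ i j) (+ suc k) (S Θ i j)))
    where
    arith : ∀ d u s → d + u * - s ≡ + 1 * d + - u * s
    arith = solve-∀
  detsJ : ∀ (Θ : OGraph n) k → det (λ i j → WalkSeries.resolvent (S Θ) -[1+ k ] i j + -[1+ k ]) ≡
          det (λ i j → (+ 1 + -[1+ k ]) * δ i j + -[1+ k ] * JIS n Θ i j)
  detsJ Θ k = det-cong entry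
    where
    diag : ∀ u s → + 1 + u * s + - u ≡ (+ 1 + - u) * + 1 + - u * (+ 0 - s)
    diag = solve-∀
    off : ∀ u s → + 0 + u * s + - u ≡ (+ 1 + - u) * + 0 + - u * (+ 1 - s)
    off = solve-∀
    entry : ∀ i j → WalkSeries.resolvent (S Θ) -[1+ k ] i j + -[1+ k ] ≡ (+ 1 + -[1+ k ]) * δ i j + -[1+ k ] * JIS n Θ
      i j
    entry i j with i ≟ j
    ... | yes _ = diag (+ suc k) (S Θ i j)
    ... | no _  = off (+ suc k) (S Θ i j)

-- Adjoints and the Gram matrix of the walk vectors

⊙-cong : ∀ {m n} (A : Fin m → Fin n → ℤ) {u v : Vector n} → (∀ i → u i ≡ v i) → ∀ i → (A ⊙ u) i ≡ (A ⊙ v) i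
⊙-cong A h i = ·-congʳ (A i) h

⊙-assoc : ∀ {l m n} (A : Fin l → Fin m → ℤ) (B : Fin m → Fin n → ℤ) v i → ((A ⊗ B) ⊙ v) i ≡ (A ⊙ (B ⊙ v)) i
⊙-assoc A B v i = ∑-assoc (A i) B v

⊙-adjoint : ∀ {m n} (M : Fin m → Fin n → ℤ) a v → (M ⊙ a) · v ≡ a · ((M ᵀ) ⊙ v)
⊙-adjoint M a v = trans (·-congˡ v λ i → ·-comm (M i) a) (∑-assoc a (M ᵀ) v)

skew-adjoint : ∀ {n} {A : Mat n} → Skew A → ∀ u v → (A ⊙ u) · v ≡ - (u · (A ⊙ v))
skew-adjoint {A = A} sk u v = trans (⊙-adjoint A u v)
  (trans (·-congʳ u λ i → trans (·-congˡ v λ j → sk j i) (neg-·ˡ (A i) v)) (neg-·ʳ u (A ⊙ v)))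

∙δ-⊙ : ∀ {n} c (v : Vector n) i → ((c ∙ δ) ⊙ v) i ≡ c * v i
∙δ-⊙ c v i = trans (∑-cong λ k → ℤP.*-assoc c (δ i k) (v k))
  (trans (sym (*-distribˡ-∑ c (λ k → δ i k * v k))) (cong (c *_) (∑-δˡ i v)))

col : ∀ {m n} → (Fin m → Fin n → ℤ) → Fin n → Vector m
col M j i = M i j

-- Each factor S moved across the product costs one sign.
gram : ∀ {n} {A : Mat n} → Skew A → ∀ i j → walk A i · walk A j ≡ sgn i * moment A (i ℕ.+ j)
gram {A = A} sk zero    j = trans (·-comm 𝟏 (walk A j)) (sym (ℤP.*-identityˡ (moment A j)))
gram {A = A} sk (suc i) j =
  trans (skew-adjoint sk (walk A i) (walk A j))
  (trans (cong -_ (gram sk i (suc j)))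
  (trans (cong (λ k → - (sgn i * moment A k)) (ℕP.+-suc i j)) (ℤP.neg-distribˡ-* (sgn i) _)))

-- N / d is a regular rational orthogonal matrix Q with Qᵀ A Q = B.
record Conjugation {n} (A B : Mat n) (d : ℤ) (N : Mat n) : Set where
  field
    nonzero    : d ≢ + 0
    orthogonal : ∀ i j → col N i · col N j ≡ d * d * δ i j
    regular    : ∀ i → col N i · 𝟏 ≡ d
    conjugates : ∀ i j → col N i · (A ⊙ col N j) ≡ d * d * B i j

-- Cancellation and consequences of a conjugation

*-≢0 : ∀ {a b} → a ≢ + 0 → b ≢ + 0 → a * b ≢ + 0
*-≢0 {a} {b} a≢0 b≢0 h with ℤP.i*j≡0⇒i≡0∨j≡0 a h
... | inj₁ p = a≢0 p
... | inj₂ p = b≢0 p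

*-cancelˡ-≢0 : ∀ {c} → c ≢ + 0 → ∀ a b → c * a ≡ c * b → a ≡ b
*-cancelˡ-≢0 {c} c≢0 a b = ℤP.*-cancelˡ-≡ c a b {{ℤ.≢-nonZero c≢0}}

skew-self-orthogonal : ∀ {n} {A : Mat n} → Skew A → ∀ x → x · (A ⊙ x) ≡ + 0
skew-self-orthogonal {A = A} skA x = double
  (trans (cong (_+_ (x · (A ⊙ x))) (trans (·-comm x (A ⊙ x)) (skew-adjoint skA x x))) (ℤP.+-inverseʳ (x · (A ⊙ x))))
  where
  double : ∀ {a} → a + a ≡ + 0 → a ≡ + 0
  double {a} h = *-cancelˡ-≢0 {+ 2} (λ ()) a (+ 0) (trans (lem a) h)
    where
    lem : ∀ a → + 2 * a ≡ a + a
    lem = solve-∀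

∏-const-≢0 : ∀ n {c} → c ≢ + 0 → ∏ {n} (λ _ → c) ≢ + 0
∏-const-≢0 zero    c≢0 ()
∏-const-≢0 (suc n) c≢0 = *-≢0 c≢0 (∏-const-≢0 n c≢0)

-- With Y the adjugate of N, multiplying by Y on the right gives det N · X = cY, and N ⊗ Y is
-- scalar. The factor det N cancels because det X · det N = cⁿ.
left-inverse⇒right-inverse : ∀ {n} (X N : Mat n) {c} → c ≢ + 0 → X ⊗ N ≋ c ∙ δ → N ⊗ X ≋ c ∙ δ
left-inverse⇒right-inverse {n} X N {c} c≢0 h i j = *-cancelˡ-≢0 D≢0 _ _ (begin
  D * (N ⊗ X) i j ≡⟨ ∙-⊗ʳ D N X i j ⟨
  (N ⊗ (D ∙ X)) i j ≡⟨ ⊗-congˡ N DX≋cY i j ⟩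
  (N ⊗ (c ∙ Y)) i j ≡⟨ ∙-⊗ʳ c N Y i j ⟩
  c * (N ⊗ Y) i j ≡⟨ cong (c *_) (⊗-adj N i j) ⟩
  c * (D * δ i j) ≡⟨ arith c D (δ i j) ⟩
  D * (c * δ i j) ∎)
  where
  open ≡-Reasoning
  D = det N
  Y = adj N
  arith : ∀ c d x → c * (d * x) ≡ d * (c * x)
  arith = solve-∀
  DX≋cY : D ∙ X ≋ c ∙ Y
  DX≋cY i j = begin
    D * X i j ≡⟨ cong (D *_) (⊗-identityʳ X i j) ⟨
    D * (X ⊗ δ) i j ≡⟨ ∙-⊗ʳ D X δ i j ⟨
    (X ⊗ (D ∙ δ)) i j ≡⟨ ⊗-congˡ X (⊗-adj N) i j ⟨
    (X ⊗ (N ⊗ Y)) i j ≡⟨ ⊗-assoc X N Y i j ⟨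
    ((X ⊗ N) ⊗ Y) i j ≡⟨ ⊗-congʳ Y h i j ⟩
    ((c ∙ δ) ⊗ Y) i j ≡⟨ ∙-⊗ˡ c δ Y i j ⟩
    c * (δ ⊗ Y) i j ≡⟨ cong (c *_) (⊗-identityˡ Y i j) ⟩
    c * Y i j ∎
  D≢0 : D ≢ + 0
  D≢0 D≡0 = *-≢0 (∏-const-≢0 n c≢0) (λ ()) (trans (cong (∏ {n} (λ _ → c) *_) (sym (det-δ n)))
    (trans (sym (det-scale-rows (λ _ → c) δ)) (trans (det-cong (≋-sym h))
    (trans (det-⊗ X N) (trans (cong (det X *_) D≡0) (ℤP.*-zeroʳ (det X)))))))

iterate : ∀ {n} → Mat n → ℕ → Vector n → Vector n
iterate A zero    v = v
iterate A (suc k) v = A ⊙ iterate A k v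

module Conjugated {n} {A B : Mat n} {d N} (C : Conjugation A B d N) where
  open Conjugation C public
  open ≡-Reasoning

  d²≢0 : d * d ≢ + 0
  d²≢0 = *-≢0 nonzero nonzero

  orthogonal′ : N ⊗ (N ᵀ) ≋ (d * d) ∙ δ
  orthogonal′ = left-inverse⇒right-inverse (N ᵀ) N d²≢0 orthogonal

  A⊗N≋N⊗B : A ⊗ N ≋ N ⊗ B
  A⊗N≋N⊗B i j = *-cancelˡ-≢0 d²≢0 _ _ (begin
    d * d * (A ⊗ N) i j ≡⟨ cong (d * d *_) (⊗-identityˡ (A ⊗ N) i j) ⟨
    d * d * (δ ⊗ (A ⊗ N)) i j ≡⟨ ∙-⊗ˡ (d * d) δ (A ⊗ N) i j ⟨
    (((d * d) ∙ δ) ⊗ (A ⊗ N)) i j ≡⟨ ⊗-congʳ (A ⊗ N) orthogonal′ i j ⟨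
    ((N ⊗ (N ᵀ)) ⊗ (A ⊗ N)) i j ≡⟨ ⊗-assoc N (N ᵀ) (A ⊗ N) i j ⟩
    (N ⊗ ((N ᵀ) ⊗ (A ⊗ N))) i j ≡⟨ ⊗-congˡ N conjugates i j ⟩
    (N ⊗ ((d * d) ∙ B)) i j ≡⟨ ∙-⊗ʳ (d * d) N B i j ⟩
    d * d * (N ⊗ B) i j ∎)

  ⊙-commutes : ∀ v i → (A ⊙ (N ⊙ v)) i ≡ (N ⊙ (B ⊙ v)) i
  ⊙-commutes v i = begin
    (A ⊙ (N ⊙ v)) i ≡⟨ ⊙-assoc A N v i ⟨
    ((A ⊗ N) ⊙ v) i ≡⟨ ·-congˡ v (A⊗N≋N⊗B i) ⟩
    ((N ⊗ B) ⊙ v) i ≡⟨ ⊙-assoc N B v i ⟩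
    (N ⊙ (B ⊙ v)) i ∎

  iterate-commutes : ∀ k v i → iterate A k (N ⊙ v) i ≡ (N ⊙ iterate B k v) i
  iterate-commutes zero    v i = refl
  iterate-commutes (suc k) v i = trans (⊙-cong A (iterate-commutes k v) i) (⊙-commutes (iterate B k v) i)

  isometry : ∀ u v → (N ⊙ u) · (N ⊙ v) ≡ d * d * (u · v)
  isometry u v = begin
    (N ⊙ u) · (N ⊙ v) ≡⟨ ⊙-adjoint N u (N ⊙ v) ⟩
    u · ((N ᵀ) ⊙ (N ⊙ v)) ≡⟨ ·-congʳ u (λ i → ⊙-assoc (N ᵀ) N v i) ⟨
    u · (((N ᵀ) ⊗ N) ⊙ v) ≡⟨ ·-congʳ u (λ i → ·-congˡ v (orthogonal i)) ⟩
    u · (((d * d) ∙ δ) ⊙ v) ≡⟨ ·-congʳ u (∙δ-⊙ (d * d) v) ⟩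
    u · (λ i → d * d * v i) ≡⟨ ·-scaleʳ (d * d) u v ⟩
    d * d * (u · v) ∎

  col-⊙ : ∀ c i → (N ⊙ (λ k → δ k c)) i ≡ col N c i
  col-⊙ c i = ∑-δʳ c (N i)

  -- Only column sums are recorded in `Conjugation`; here dN𝟏 = N(Nᵀ𝟏) = d²𝟏.
  rows-sum : ∀ i → (N ⊙ 𝟏) i ≡ d
  rows-sum i = *-cancelˡ-≢0 nonzero _ _ (begin
    d * (N ⊙ 𝟏) i ≡⟨ ·-scaleʳ d (N i) 𝟏 ⟨
    N i · (λ j → d * + 1) ≡⟨ ·-congʳ (N i) (λ j → trans (regular j) (sym (ℤP.*-identityʳ d))) ⟨
    (N ⊙ ((N ᵀ) ⊙ 𝟏)) i ≡⟨ ⊙-assoc N (N ᵀ) 𝟏 i ⟨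
    ((N ⊗ (N ᵀ)) ⊙ 𝟏) i ≡⟨ ·-congˡ 𝟏 (orthogonal′ i) ⟩
    (((d * d) ∙ δ) ⊙ 𝟏) i ≡⟨ ∙δ-⊙ (d * d) 𝟏 i ⟩
    d * d * + 1 ≡⟨ ℤP.*-identityʳ (d * d) ⟩
    d * d ∎)

  -- In matrix form NᵀW(A) = dW(B): every prime power dividing d divides all products of walk
  -- vectors of A with columns of N. Passing S through N uses skew-symmetry of A and of B, and the
  -- two signs cancel.
  col-walk : Skew A → Skew B → ∀ k c → col N c · walk A k ≡ d * walk B k c
  col-walk skA skB zero    c = trans (regular c) (sym (ℤP.*-identityʳ d))
  col-walk skA skB (suc k) c = begin
    col N c · (A ⊙ walk A k) ≡⟨ neg-swap (skew-adjoint skA (col N c) (walk A k)) ⟩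
    - ((A ⊙ col N c) · walk A k) ≡⟨ cong -_ (·-congˡ (walk A k) λ i → trans (A⊗N≋N⊗B i c) (·-comm (N i) (col B c))) ⟩
    - ((λ i → ∑ (λ l → B l c * N i l)) · walk A k) ≡⟨ cong -_ (∑-assoc (col B c) (N ᵀ) (walk A k)) ⟩
    - (col B c · (λ l → col N l · walk A k)) ≡⟨ cong -_ (·-congʳ (col B c) (col-walk skA skB k)) ⟩
    - (col B c · (λ l → d * walk B k l)) ≡⟨ cong -_ (·-scaleʳ d (col B c) (walk B k)) ⟩
    - (d * (col B c · walk B k)) ≡⟨ cong (λ x → - (d * x))
      (trans (·-congˡ (walk B k) (λ l → skB l c)) (neg-·ˡ (B c) (walk B k))) ⟩
    - (d * - (B c · walk B k)) ≡⟨ simplify d (B c · walk B k) ⟩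
    d * walk B (suc k) c ∎
    where
    neg-swap : ∀ {x y} → x ≡ - y → y ≡ - x
    neg-swap {x} {y} h = sym (trans (cong -_ h) (ℤP.neg-involutive y))
    simplify : ∀ d x → - (d * - x) ≡ d * x
    simplify = solve-∀

-- Conjugations between graphs with equal moments

walks : ∀ {n} → Mat n → Mat n
walks A i k = walk A (toℕ k) i

-- A bilinear form on combinations of columns depends only on its values at the columns. For walk
-- matrices these values are moments up to sign.
transfer : ∀ {n} {M M′ X X′ : Mat n} → (∀ k l → col M k · (X ⊙ col M l) ≡ col M′ k · (X′ ⊙ col M′ l)) →
           ∀ a b → (M ⊙ a) · (X ⊙ (M ⊙ b)) ≡ (M′ ⊙ a) · (X′ ⊙ (M′ ⊙ b))
transfer {M = M} {M′} {X} {X′} h a b = trans (expand M X) (trans (·-congʳ a λ k → ·-congˡ b (h k)) (sym (expand M′ X′)))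
  where
  expand : ∀ M X → (M ⊙ a) · (X ⊙ (M ⊙ b)) ≡ a · ((λ k l → col M k · (X ⊙ col M l)) ⊙ b)
  expand M X = trans (⊙-adjoint M a (X ⊙ (M ⊙ b))) (·-congʳ a λ k →
    trans (⊙-cong (M ᵀ) (λ i → sym (⊙-assoc X M b i)) k) (sym (⊙-assoc (M ᵀ) (X ⊗ M) b k)))

module _ {n} {A B : Mat n} (skA : Skew A) (skB : Skew B) (moments : ∀ k → moment A k ≡ moment B k)
         (det≢0 : det (walks B) ≢ + 0) where
  private
    d = det (walks B)
    Y = adj (walks B)
    N = walks A ⊗ Y

    gram-equal : ∀ i j → walk A i · walk A j ≡ walk B i · walk B j
    gram-equal i j = trans (gram skA i j) (trans (cong (sgn i *_) (moments (i ℕ.+ j))) (sym (gram skB i j)))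

    δ-⊙ : ∀ (v : Vector n) i → (δ ⊙ v) i ≡ v i
    δ-⊙ v i = ∑-δˡ i v

    column : ∀ j i → (walks B ⊙ col Y j) i ≡ d * δ i j
    column j i = ⊗-adj (walks B) i j

  -- N is dW(A)W(B)⁻¹ with d = det W(B). By `transfer`, products of columns of N may be computed
  -- with W(B) in place of W(A), and W(B) times its adjugate is d times the identity.
  conjugation-from-moments : Conjugation A B d N
  conjugation-from-moments = record
    { nonzero    = det≢0
    ; orthogonal = λ i j → trans (·-congʳ (col N i) λ k → sym (δ-⊙ (col N j) k))
        (trans (transfer {M = walks A} {walks B} {δ} {δ}
          (λ k l → trans (·-congʳ (col (walks A) k) (δ-⊙ (col (walks A) l)))
                 (trans (gram-equal (toℕ k) (toℕ l)) (sym (·-congʳ (col (walks B) k) (δ-⊙ (col (walks B) l))))))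
                   (col Y i) (col Y j))
        (trans (·-congʳ (walks B ⊙ col Y i) (δ-⊙ (walks B ⊙ col Y j)))
        (trans (∑-cong λ k → cong₂ _*_ (column i k) (column j k))
        (trans (∑-cong λ k → arith d (δ k i) (δ k j)) (trans (sym (*-distribˡ-∑ (d * d) (λ k → δ k i * δ k j)))
          (cong (d * d *_) (∑-δʳ j (λ k → δ k i)) ∙≡ cong (d * d *_) (δ-sym j i)))))))
    ; regular    = λ i → trans (⊙-adjoint (walks A) (col Y i) 𝟏)
        (trans (·-congʳ (col Y i) λ k → moments (toℕ k))
        (trans (sym (⊙-adjoint (walks B) (col Y i) 𝟏))
        (trans (·-congˡ 𝟏 (column i)) (trans (·-comm (λ k → d * δ k i) 𝟏) (trans (·-scaleʳ d 𝟏 (λ k → δ k i))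
          (trans (cong (d *_) (∑-δʳ i 𝟏)) (ℤP.*-identityʳ d)))))))
    ; conjugates = λ i j → trans (transfer {M = walks A} {walks B} {A} {B} (λ k l → gram-equal (toℕ k) (suc (toℕ l)))
      (col Y i) (col Y j))
        (trans (·-congʳ (walks B ⊙ col Y i) λ k → trans (·-congʳ (B k) (column j))
          (trans (·-scaleʳ d (B k) (λ l → δ l j)) (cong (d *_) (∑-δʳ j (B k)))))
        (trans (∑-cong λ k → cong (_* (d * B k j)) (column i k))
        (trans (∑-cong λ k → arith d (δ k i) (B k j)) (trans (sym (*-distribˡ-∑ (d * d) (λ k → δ k i * B k j)))
          (cong (d * d *_) (trans (∑-cong λ k → cong (_* B k j) (δ-sym k i)) (∑-δˡ i (col B j))))))))
    }
    where
    infixr 4 _∙≡_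
    _∙≡_ : ∀ {a b c : ℤ} → a ≡ b → b ≡ c → a ≡ c
    _∙≡_ = trans
    arith : ∀ d x y → d * x * (d * y) ≡ d * d * (x * y)
    arith = solve-∀

-- The fraction N / d is in lowest terms at every prime, so for d ≠ 0 the level of N / d is |d|. The
-- first witness is the column of an entry prime to p.
Primitive : ∀ {n} → ℤ → Mat n → Set
Primitive d N = ∀ p → Prime p → + p ∣ d → ∃ λ j → ∃ λ i → ¬ (+ p ∣ N i j)

divide-out : ∀ {n} {A B : Mat n} {d N c} d₁ (N₁ : Mat n) → d ≡ d₁ * c → (∀ i j → N i j ≡ N₁ i j * c) →
             Conjugation A B d N → Conjugation A B d₁ N₁
divide-out {n} {A} {B} {d} {N} {c} d₁ N₁ d≡ N≡ C = record
  { nonzero    = λ d₁≡0 → nonzero (trans d≡ (cong (_* c) d₁≡0))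
  ; orthogonal = λ i j → cancel² (trans (sym
    (trans (∑-cong λ k → trans (cong₂ _*_ (N≡ k i) (N≡ k j)) (arith (N₁ k i) c (N₁ k j)))
                   (sym (*-distribˡ-∑ (c * c) _)))) (trans (orthogonal i j) (scaled (δ i j))))
  ; regular    = λ i → *-cancelˡ-≢0 c≢0 _ _
    (trans (trans (sym (·-scaleˡ (col N₁ i) 𝟏))
    (∑-cong λ k → cong (_* + 1) (trans (ℤP.*-comm c (N₁ k i)) (sym (N≡ k i)))))
                   (trans (regular i) (trans d≡ (ℤP.*-comm d₁ c))))
  ; conjugates = λ i j → cancel² (trans (sym
    (trans (∑-cong λ k → trans (cong₂ _*_ (N≡ k i)
    (trans (·-congʳ (A k) (λ l → trans (N≡ l j) (ℤP.*-comm (N₁ l j) c)))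
    (trans (·-scaleʳ c (A k) (col N₁ j)) (ℤP.*-comm c _)))) (arith (N₁ k i) c _))
                   (sym (*-distribˡ-∑ (c * c) _)))) (trans (conjugates i j) (scaled (B i j))))
  }
  where
  open Conjugation C
  c≢0 : c ≢ + 0
  c≢0 c≡0 = nonzero (trans d≡ (trans (cong (d₁ *_) c≡0) (ℤP.*-zeroʳ d₁)))
  arith : ∀ x c y → x * c * (y * c) ≡ c * c * (x * y)
  arith = solve-∀
  cancel² : ∀ {x y} → c * c * x ≡ c * c * y → x ≡ y
  cancel² {x} {y} = *-cancelˡ-≢0 (*-≢0 c≢0 c≢0) x y
  scaled : ∀ x → d * d * x ≡ c * c * (d₁ * d₁ * x)
  scaled x = trans (cong (λ e → e * e * x) d≡) (lem d₁ c x)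
    where
    lem : ∀ d c x → d * c * (d * c) * x ≡ c * c * (d * d * x)
    lem = solve-∀
  ·-scaleˡ : ∀ u v → (λ i → c * u i) · v ≡ c * (u · v)
  ·-scaleˡ u v = trans (·-comm (λ i → c * u i) v) (trans (·-scaleʳ c v u) (cong (c *_) (·-comm v u)))

-- The cancelled factor g is kept because `isomorphism-criterion` compares the powers of p in g and
-- in the denominators.
CommonMultiple : ∀ {n} → ℤ → Mat n → ℤ → Mat n → Set
CommonMultiple d N d′ N′ = ∃ λ g → d ≡ d′ * g × (∀ i j → N i j ≡ N′ i j * g)

primitive-conjugation : ∀ {n} {A B : Mat n} {d N} → Conjugation A B d N →
                        ∃ λ d′ → ∃ λ N′ → Conjugation A B d′ N′ × Primitive d′ N′ × CommonMultiple d N d′ N′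
primitive-conjugation {n} {A} {B} {d} {N} C = <-rec P step ℤ.∣ d ∣ d N refl C
  where
  P : ℕ → Set
  P m = ∀ d (N : Mat n) → ℤ.∣ d ∣ ≡ m → Conjugation A B d N →
        ∃ λ d′ → ∃ λ N′ → Conjugation A B d′ N′ × Primitive d′ N′ × CommonMultiple d N d′ N′
  Common : ℤ → Mat n → ℕ → Set
  Common d N p = Prime p × (+ p ∣ d) × (∀ i j → + p ∣ N i j)
  step : ∀ m → (∀ {k} → k ℕ.< m → P k) → P m
  -- A prime dividing the nonzero d is at most |d|, so the search for a common prime factor is
  -- finite.
  step m rec d N refl C with FinP.any? {suc m} {P = λ p → Common d N (toℕ p)}
    (λ p → prime? (toℕ p) ×-dec (+ toℕ p ℤS.∣? d) ×-dec FinP.all? (λ i → FinP.all? (λ j → + toℕ p ℤS.∣? N i j)))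
  ... | yes (p , pr , divides d₁ d≡ , h) =
    extend (rec smaller d₁ N₁ refl (divide-out d₁ N₁ d≡ (λ i j → _∣_.equality (h i j)) C))
    where
    N₁ : Mat n
    N₁ i j = _∣_.quotient (h i j)
    extend : (∃ λ d′ → ∃ λ N′ → Conjugation A B d′ N′ × Primitive d′ N′ × CommonMultiple d₁ N₁ d′ N′) →
             ∃ λ d′ → ∃ λ N′ → Conjugation A B d′ N′ × Primitive d′ N′ × CommonMultiple d N d′ N′
    extend (d′ , N′ , C′ , P′ , g , d₁≡ , N₁≡) = d′ , N′ , C′ , P′ , g * + toℕ p
      , trans d≡ (trans (cong (_* + toℕ p) d₁≡) (ℤP.*-assoc d′ g (+ toℕ p)))
      , λ i j → trans (_∣_.equality (h i j)) (trans (cong (_* + toℕ p) (N₁≡ i j)) (ℤP.*-assoc (N′ i j) g (+ toℕ p)))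
    instance
      nt = prime⇒nonTrivial pr
      d₁≢0 : ℕ.NonZero ℤ.∣ d₁ ∣
      d₁≢0 = ℕ.≢-nonZero λ e → Conjugation.nonzero C (trans d≡ (cong (_* + toℕ p) {d₁} {+ 0} (ℤP.∣i∣≡0⇒i≡0 e)))
    smaller : ℤ.∣ d₁ ∣ ℕ.< ℤ.∣ d ∣
    smaller = subst (ℤ.∣ d₁ ∣ ℕ.<_) (sym (trans (cong ℤ.∣_∣ d≡) (ℤP.abs-* d₁ (+ toℕ p))))
                    (ℕP.m<m*n ℤ.∣ d₁ ∣ (toℕ p) (ℕ.nonTrivial⇒n>1 (toℕ p)))
  ... | no none = d , N , C , isPrimitive , + 1 , sym (ℤP.*-identityʳ d) , λ i j → sym (ℤP.*-identityʳ (N i j))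
    where
    instance
      d≢0 : ℕ.NonZero ℤ.∣ d ∣
      d≢0 = ℕ.≢-nonZero λ e → Conjugation.nonzero C (ℤP.∣i∣≡0⇒i≡0 {d} e)
    isPrimitive : Primitive d N
    isPrimitive p pr p∣d with all-or-counterexample (λ j → FinP.all? (λ i → + p ℤS.∣? N i j))
    ... | inj₁ h = ⊥-elim (none (fromℕ< p<1+m , subst (Common d N) (sym (FinP.toℕ-fromℕ< p<1+m))
      (pr , p∣d , λ i j → h j i)))
      where
      p<1+m : p ℕ.< suc ℤ.∣ d ∣
      p<1+m = ℕ.s≤s (ℕD.∣⇒≤ (ℤS.∣⇒∣ᵤ p∣d))
    ... | inj₂ (j , ¬h) with all-or-counterexample (λ i → + p ℤS.∣? N i j)
    ...   | inj₁ h = ⊥-elim (¬h h)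
    ...   | inj₂ (i , ¬p∣) = j , i , ¬p∣

-- Square factors of determinants

adj-left : ∀ {n} (M : Mat n) x i → ∑ (λ k → (x · col M k) * adj M k i) ≡ det M * x i
adj-left M x i = trans (∑-assoc x M (col (adj M) i))
  (trans (·-congʳ x λ j → ⊗-adj M j i)
  (trans (·-scaleʳ (det M) x (λ j → δ j i)) (cong (det M *_) (∑-δʳ i x))))

rows-∣-det : ∀ {n q} (M : Mat n) {i j} → i ≢ j → (∀ k → q ∣ M i k) → (∀ k → q ∣ M j k) → q * q ∣ det M
rows-∣-det {n} {q} M {i} {j} i≢j hi hj = divides (det ((M [ i ↦ v ]) [ j ↦ w ])) (begin
  det M ≡⟨ det-cong (update-self M i) ⟨
  det (M [ i ↦ M i ]) ≡⟨ det-cong (update-cong i (λ _ _ → refl) (eq hi)) ⟩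
  det (M [ i ↦ (λ k → q * v k) ]) ≡⟨ det-scale-row M i q v ⟩
  q * det (M [ i ↦ v ]) ≡⟨ cong (q *_) (det-cong (update-self (M [ i ↦ v ]) j)) ⟨
  q * det ((M [ i ↦ v ]) [ j ↦ (M [ i ↦ v ]) j ])
    ≡⟨ cong (q *_) (det-cong (update-cong j (λ _ _ → refl) λ k → trans
      (cong (λ r → r k) (update-other M v (i≢j ∘ sym))) (eq hj k))) ⟩
  q * det ((M [ i ↦ v ]) [ j ↦ (λ k → q * w k) ]) ≡⟨ cong (q *_) (det-scale-row (M [ i ↦ v ]) j q w) ⟩
  q * (q * det ((M [ i ↦ v ]) [ j ↦ w ])) ≡⟨ arith q (det ((M [ i ↦ v ]) [ j ↦ w ])) ⟩
  det ((M [ i ↦ v ]) [ j ↦ w ]) * (q * q) ∎)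
  where
  open ≡-Reasoning
  v w : Vector n
  v k = _∣_.quotient (hi k)
  w k = _∣_.quotient (hj k)
  eq : ∀ {f : Vector n} (h : ∀ k → q ∣ f k) k → f k ≡ q * _∣_.quotient (h k)
  eq h k = trans (_∣_.equality (h k)) (ℤP.*-comm _ q)
  arith : ∀ q d → q * (q * d) ≡ d * (q * q)
  arith = solve-∀

-- Polynomials in a matrix, applied to a vector

module Polynomial {n} (A : Mat n) where

  -- Horner's scheme; the index `m` counts coefficients, so the degree is below `m`.
  poly : ∀ {m} → Vector m → Vector n → Vector n
  poly {zero}  a u i = + 0
  poly {suc m} a u i = a zero * u i + (A ⊙ poly (a ∘ suc) u) i

  poly-linear : ∀ {m} (a : Vector m) u c v i → poly a (λ i → u i + c * v i) i ≡ poly a u i + c * poly a v i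
  poly-linear {zero}  a u c v i = sym (trans (ℤP.+-identityˡ (c * + 0)) (ℤP.*-zeroʳ c))
  poly-linear {suc m} a u c v i =
    trans (cong (_+_ (a zero * (u i + c * v i)))
      (trans (⊙-cong A (poly-linear (a ∘ suc) u c v) i) (·-linearʳ (A i) _ _ c)))
          (arith (a zero) (u i) c (v i) _ _)
    where
    arith : ∀ a u c v x y → a * (u + c * v) + (x + c * y) ≡ a * u + x + c * (a * v + y)
    arith = solve-∀

  poly-cong : ∀ {m} (a : Vector m) {u v} → (∀ i → u i ≡ v i) → ∀ i → poly a u i ≡ poly a v i
  poly-cong {zero}  a h i = refl
  poly-cong {suc m} a h i = cong₂ (λ x y → a zero * x + y) (h i) (⊙-cong A (poly-cong (a ∘ suc) h) i)

  poly-zero : ∀ {m} (a : Vector m) i → poly a (λ _ → + 0) i ≡ + 0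
  poly-zero {zero}  a i = refl
  poly-zero {suc m} a i = cong₂ _+_ (ℤP.*-zeroʳ (a zero))
    (∑-zero λ j → trans (cong (A i j *_) (poly-zero (a ∘ suc) j)) (ℤP.*-zeroʳ (A i j)))

  poly-⊙ : ∀ {m} (a : Vector m) u i → poly a (A ⊙ u) i ≡ (A ⊙ poly a u) i
  poly-⊙ {zero}  a u i = sym (∑-zero λ j → ℤP.*-zeroʳ (A i j))
  poly-⊙ {suc m} a u i = sym (trans (·-congʳ (A i) λ j → ℤP.+-comm (a zero * u j) _)
    (trans (·-linearʳ (A i) (A ⊙ poly (a ∘ suc) u) u (a zero))
    (trans (ℤP.+-comm (A i · (A ⊙ poly (a ∘ suc) u)) _)
           (cong (_+_ (a zero * (A i · u))) (sym (⊙-cong A (poly-⊙ (a ∘ suc) u) i))))))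

  poly-comm : ∀ {l m} (a : Vector l) (b : Vector m) u i → poly b (poly a u) i ≡ poly a (poly b u) i
  poly-comm {m = zero}  a b u i = sym (poly-zero a i)
  poly-comm {m = suc m} a b u i = sym (trans (poly-cong a (λ i → ℤP.+-comm (b zero * u i) _) i)
    (trans (poly-linear a (A ⊙ poly (b ∘ suc) u) (b zero) u i)
    (trans (ℤP.+-comm _ (b zero * poly a u i))
           (cong (_+_ (b zero * poly a u i)) (trans (poly-⊙ a (poly (b ∘ suc) u) i)
             (⊙-cong A (λ i → sym (poly-comm a (b ∘ suc) u i)) i))))))

  poly-walk : ∀ {m} (a : Vector m) k i → poly a (walk A k) i ≡ ∑ (λ l → walk A (k ℕ.+ toℕ l) i * a l)
  poly-walk {zero}  a k i = sym (∑-[] (λ l → walk A (k ℕ.+ toℕ l) i * a l))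
  poly-walk {suc m} a k i = trans (cong₂ _+_ first rest) (sym (∑-∷ (λ l → walk A (k ℕ.+ toℕ l) i * a l)))
    where
    first : a zero * walk A k i ≡ walk A (k ℕ.+ 0) i * a zero
    first = trans (ℤP.*-comm (a zero) (walk A k i)) (cong (λ l → walk A l i * a zero) (sym (ℕP.+-identityʳ k)))
    rest : (A ⊙ poly (a ∘ suc) (walk A k)) i ≡ ∑ (λ l → walk A (k ℕ.+ suc (toℕ l)) i * a (suc l))
    rest = trans (sym (poly-⊙ (a ∘ suc) (walk A k) i)) (trans (poly-walk (a ∘ suc) (suc k) i)
      (∑-cong λ l → cong (λ x → walk A x i * a (suc l)) (sym (ℕP.+-suc k (toℕ l)))))

  module PolynomialMod (D : ℤ) where
    open Mod D

    ⊙-≈ : ∀ {u v} → (∀ i → u i ≈ v i) → ∀ i → (A ⊙ u) i ≈ (A ⊙ v) i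
    ⊙-≈ h i = ·-≈ʳ (A i) h

    poly-≈ : ∀ {m} (a : Vector m) {u v} → (∀ i → u i ≈ v i) → ∀ i → poly a u i ≈ poly a v i
    poly-≈ {zero}  a h i = ≈-refl
    poly-≈ {suc m} a h i = +-cong (*-congˡ (a zero) (h i)) (⊙-≈ (poly-≈ (a ∘ suc) h) i)

    poly-kernel : ∀ {m} (a : Vector m) {u} → (∀ i → (A ⊙ u) i ≈ + 0) → ∀ i → (A ⊙ poly a u) i ≈ + 0
    poly-kernel a {u} h i = ≈-trans (≈-reflexive (sym (poly-⊙ a u i)))
      (≈-trans (poly-≈ a h i) (≈-reflexive (poly-zero a i)))

-- Kernel of the transposed walk matrix when p² does not divide its determinant

scale-≈ : ∀ {a b q} → a ≈ b [mod q ] → q * a ≈ q * b [mod q * q ]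
scale-≈ {a} {b} {q} (congruent h) = congruent (subst (q * q ∣_) (arith q a b) (ℤS.*-monoʳ-∣ q h))
  where
  arith : ∀ q a b → q * (a - b) ≡ q * a - q * b
  arith = solve-∀

prime²-cancel : ∀ {p} → Prime p → ∀ {b a} → ¬ (+ p ∣ b) → + p * + p ∣ b * a → + p * + p ∣ a
prime²-cancel {p} pr {b} {a} p∤b h = first (prime-∣-* pr b a (ℤS.∣-trans (divides (+ p) refl) h))
  where
  instance
    p≢0 : ℤ.NonZero (+ p)
    p≢0 = prime⇒nonZero pr
  arith : ∀ b a p → b * (a * p) ≡ p * (b * a)
  arith = solve-∀
  second : ∀ a′ → + p ∣ b ⊎ + p ∣ a′ → + p * + p ∣ a′ * + p
  second a′ (inj₁ r) = ⊥-elim (p∤b r)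
  second a′ (inj₂ r) = ℤS.*-monoˡ-∣ (+ p) r
  first : + p ∣ b ⊎ + p ∣ a → + p * + p ∣ a
  first (inj₁ r) = ⊥-elim (p∤b r)
  first (inj₂ (divides a′ a≡)) = subst (+ p * + p ∣_) (sym a≡) (second a′ (prime-∣-* pr b a′
    (ℤS.*-cancelˡ-∣ (+ p) (subst (+ p * + p ∣_) (trans (cong (b *_) a≡) (arith b a′ (+ p))) h))))

module OddPart {n} {A : Mat n} (skA : Skew A) (p : ℕ) (pr : Prime p) (p²∤det : ¬ (+ p * + p ∣ det (walks A))) where
  open ModPrime p pr
  open Polynomial A
  open PolynomialMod (+ p)

  Killed : Vector n → Set
  Killed x = ∀ (k : Fin n) → walk A (toℕ k) · x ≈ + 0

  -- Since xᵀW adj W = det W · xᵀ, an entry of x prime to p would force p² ∣ det W.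
  kernel-lift : ∀ x → (∀ (k : Fin n) → + p * + p ∣ walk A (toℕ k) · x) → ∀ i → x i ≈ + 0
  kernel-lift x h i with x i ≈0?
  ... | yes q = q
  ... | no x≉0 = ⊥-elim (p²∤det (prime²-cancel pr {x i} (x≉0 ∘ ∣⇒≈0)
    (subst (+ p * + p ∣_) (trans (adj-left (walks A) x i) (ℤP.*-comm (det (walks A)) (x i)))
      (∣-∑ λ k → ℤS.∣m⇒∣m*n (adj (walks A) k i) (subst (+ p * + p ∣_) (·-comm (walk A (toℕ k)) x) (h k))))))

  -- Suppose `u` is nonzero modulo p at j. Replacing rows i and j of W by the combinations with
  -- coefficients `x` and `u` multiplies the determinant by x i · u j, a unit modulo p, and makes
  -- both rows divisible by p; so p² ∣ det W.
  unique-kernel : ∀ {x i} → Killed x → ¬ (x i ≈ + 0) → ∀ y → Killed y → ∃ λ c → ∀ j → y j ≈ c * x j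
  unique-kernel {x} {i} kx x≉0 y ky = c , combine
    where
    W = walks A
    s = proj₁ (invert x≉0)
    -- Chosen so that `u` vanishes at i modulo p; then row i, already replaced in `W₁`, does not
    -- disturb the second combination.
    c = y i * s
    u : Vector n
    u j = y j + - c * x j
    uᵢ≈0 : u i ≈ + 0
    uᵢ≈0 = ≈-trans (≈-reflexive (arith (y i) s (x i)))
      (*-zero (y i) (+-cong (≈-refl {+ 1}) (neg-cong (proj₂ (invert x≉0)))))
      where
      arith : ∀ y s x → y + - (y * s) * x ≡ y * (+ 1 + - (s * x))
      arith = solve-∀
    W₁ : Mat n
    W₁ = W [ i ↦ (λ k → ∑ (λ l → x l * W l k)) ]
    W₁-row : ∀ k → W₁ i k ≈ + 0
    W₁-row k = ≈-trans (≈-reflexive (trans (cong (λ r → r k) (update-same W i _)) (·-comm x (col W k)))) (kx k)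
    u-killed : ∀ k → ∑ (λ l → u l * W l k) ≈ + 0
    u-killed k = ≈-trans (≈-reflexive (trans (·-comm u (col W k)) (·-linearʳ (col W k) y x (- c))))
                         (+-cong (ky k) (*-zero (- c) (kx k)))
    rows : ∀ l k → u l * W₁ l k ≈ u l * W l k
    rows l k with l ≟ i
    ... | yes refl = ≈-trans (zero-* (W₁ l k) uᵢ≈0) (≈-sym (zero-* (W l k) uᵢ≈0))
    ... | no l≢i   = ≈-reflexive (cong (λ r → u l * r k) (update-other W _ l≢i))
    u≈0 : ∀ j → u j ≈ + 0
    u≈0 j with u j ≈0?
    ... | yes q = q
    ... | no u≉0 = ⊥-elim (kernel-contradiction p²∣)
      where
      i≢j : i ≢ j
      i≢j refl = u≉0 uᵢ≈0
      W₂ : Mat n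
      W₂ = W₁ [ j ↦ (λ k → ∑ (λ l → u l * W₁ l k)) ]
      p²∣ : + p * + p ∣ u j * (x i * det W)
      p²∣ = subst (+ p * + p ∣_) (trans (replace-row W₁ j u) (cong (u j *_) (replace-row W i x)))
        (rows-∣-det W₂ i≢j
          (λ k → ≈0⇒∣ (≈-trans (≈-reflexive (cong (λ r → r k) (update-other W₁ _ i≢j))) (W₁-row k)))
          (λ k → ≈0⇒∣ (≈-trans (≈-reflexive (cong (λ r → r k) (update-same W₁ j _)))
            (≈-trans (∑-≈ (λ l → rows l k)) (u-killed k)))))
      kernel-contradiction : ¬ (+ p * + p ∣ u j * (x i * det W))
      kernel-contradiction h = p²∤det (prime²-cancel pr {x i} (x≉0 ∘ ∣⇒≈0) (prime²-cancel pr {u j} (u≉0 ∘ ∣⇒≈0) h))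
    combine : ∀ j → y j ≈ c * x j
    combine j = ≈-trans (≈-reflexive (arith (y j) c (x j)))
      (≈-trans (+-cong (u≈0 j) (≈-refl {c * x j})) (≈-reflexive (ℤP.+-identityˡ (c * x j))))
      where
      arith : ∀ y c x → y ≡ y + - c * x + c * x
      arith = solve-∀

  private
    poly-constant : ∀ {m} (c : Vector (suc m)) {v} → (∀ j → (A ⊙ v) j ≈ + 0) → ∀ j → poly c v j ≈ c zero * v j
    poly-constant c {v} kv j = ≈-trans (+-cong (≈-refl {c zero * v j}) (poly-kernel (c ∘ suc) kv j))
      (≈-reflexive (ℤP.+-identityʳ (c zero * v j)))

    -- On the kernel of A a polynomial acts by its constant term, and polynomials in A commute: b₀w
    -- ≡ b(A)a(A)u ≡ a₀x.
    proportional : ∀ {l m} (a : Vector (suc l)) (b : Vector (suc m)) u {w x : Vector n} →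
      (∀ j → w j ≈ poly a u j) → (∀ j → x j ≈ poly b u j) →
      (∀ j → (A ⊙ w) j ≈ + 0) → (∀ j → (A ⊙ x) j ≈ + 0) → ∀ j → b zero * w j ≈ a zero * x j
    proportional a b u hw hx kw kx j = ≈-trans (≈-sym (poly-constant b kw j))
      (≈-trans (poly-≈ b hw j) (≈-trans (≈-reflexive (poly-comm a b u j))
      (≈-trans (≈-sym (poly-≈ a hx j)) (poly-constant a kx j))))

    shift : ∀ {m} (c : Vector (suc m)) u {v : Vector n} → (∀ j → v j ≈ poly c u j) → c zero ≈ + 0 →
            ∀ j → v j ≈ poly (c ∘ suc) (A ⊙ u) j
    shift c u {v} hv c≈0 j = ≈-trans (hv j) (≈-trans (+-cong (zero-* (u j) c≈0) (≈-refl {(A ⊙ poly (c ∘ suc) u) j}))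
      (≈-reflexive (trans (ℤP.+-identityˡ ((A ⊙ poly (c ∘ suc) u) j)) (sym (poly-⊙ (c ∘ suc) u j)))))

  -- The kernel of A on the cyclic module generated by u is at most one-dimensional: compare the
  -- lowest non-vanishing coefficients of the polynomials expressing the two vectors.
  cyclic-kernel : ∀ {l m} (a : Vector l) (b : Vector m) u {w x : Vector n} {i} →
    (∀ j → w j ≈ poly a u j) → (∀ j → x j ≈ poly b u j) →
    (∀ j → (A ⊙ w) j ≈ + 0) → (∀ j → (A ⊙ x) j ≈ + 0) → ¬ (x i ≈ + 0) →
    ∃ λ c → ∀ j → w j ≈ c * x j
  cyclic-kernel {zero}  a b u hw hx kw kx x≉0 = + 0 , hw
  cyclic-kernel {suc l} {zero} a b u {i = i} hw hx kw kx x≉0 = ⊥-elim (x≉0 (hx i))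
  cyclic-kernel {suc l} {suc m} a b u {w} {x} {i} hw hx kw kx x≉0 with b zero ≈0?
  ... | no b≉0 = s * a zero , λ j → ≈-trans (≈-reflexive (sym (ℤP.*-identityˡ (w j))))
      (≈-trans (*-congʳ (w j) (≈-sym (proj₂ (invert b≉0)))) (≈-trans (≈-reflexive (ℤP.*-assoc s (b zero) (w j)))
      (≈-trans (*-congˡ s (proportional a b u hw hx kw kx j)) (≈-reflexive (sym (ℤP.*-assoc s (a zero) (x j)))))))
    where
    s = proj₁ (invert b≉0)
  ... | yes b≈0 = cyclic-kernel (a ∘ suc) (b ∘ suc) (A ⊙ u) (shift a u hw a≈0) (shift b u hx b≈0) kw kx x≉0
    where
    a≈0 : a zero ≈ + 0
    a≈0 with *-≈0 (≈-trans (≈-sym (proportional a b u hw hx kw kx i)) (zero-* (w i) b≈0))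
    ... | inj₁ q = q
    ... | inj₂ q = ⊥-elim (x≉0 q)

  -- An obstruction to solving Wa ≡ v is a kernel vector of Wᵀ, hence a multiple of x, hence
  -- orthogonal to v.
  image : ∀ {x i} → Killed x → ¬ (x i ≈ + 0) → ∀ v → x · v ≈ + 0 → ∃ λ a → ∀ i → v i ≈ poly {n} a 𝟏 i
  image {x} kx x≉0 v xv≈0 with fredholm (walks A) v
  ... | inj₁ (a , h) = a , λ i → ≈-trans (≈-sym (h i)) (≈-reflexive (sym (poly-walk a 0 i)))
  ... | inj₂ (u , h , u·v≉0) = ⊥-elim (u·v≉0
    (orthogonal (unique-kernel kx x≉0 u λ k → ≈-trans (≈-reflexive (·-comm (walk A (toℕ k)) u)) (h k))))
    where
    orthogonal : (∃ λ c → ∀ j → u j ≈ c * x j) → u · v ≈ + 0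
    orthogonal (c , q) = ≈-trans (·-≈ˡ v q) (≈-trans
      (≈-reflexive (trans (·-comm (λ j → c * x j) v) (trans (·-scaleʳ c v x) (cong (c *_) (·-comm v x)))))
      (*-zero c xv≈0))

  -- The vector x is to be corrected by a multiple of p so that Wᵀ kills it modulo p². Such a
  -- correction contradicts `kernel-lift`, and `fredholm` leaves only an obstruction, which is
  -- excluded too. Here `ℓ` and `z` are the quotients of 𝟏 · x and Ax by p.
  module Isotropic {x : Vector n} {i : Fin n} (hx : ∀ k → walk A k · x ≈ + 0) (kx : ∀ j → (A ⊙ x) j ≈ + 0)
                   (xx≈0 : x · x ≈ + 0) (x≉0 : ¬ (x i ≈ + 0)) where
    ℓ : ℤ
    ℓ = _∣_.quotient (≈0⇒∣ (hx 0))

    z : Vector n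
    z j = _∣_.quotient (≈0⇒∣ (kx j))

    ℓ≡ : 𝟏 · x ≡ ℓ * + p
    ℓ≡ = _∣_.equality (≈0⇒∣ (hx 0))

    z≡ : ∀ j → (A ⊙ x) j ≡ z j * + p
    z≡ j = _∣_.equality (≈0⇒∣ (kx j))

    -- The unknowns are (c, y); a solution makes x + p y killed modulo p², with A (x + p y) ≡ p c x.
    system : Fin (suc n) → Fin (suc n) → ℤ
    system = (+ 0 ◂ 𝟏) ◂ (λ j → - x j ◂ A j)

    target : Vector (suc n)
    target = - ℓ ◂ (λ j → - z j)

    unsolvable : ¬ Solvable system target
    unsolvable (y , h) = x≉0 (≈-trans (≈-sym x′≈x) (kernel-lift x′ killed i))
      where
      c = y zero
      y′ : Vector n
      y′ = y ∘ suc
      x′ : Vector n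
      x′ j = x j + + p * y′ j
      x′≈x : x′ i ≈ x i
      x′≈x = congruent (divides (y′ i) (lem (x i) (+ p) (y′ i)))
        where
        lem : ∀ x p y → x + p * y - x ≡ y * p
        lem = solve-∀
      h₀ : 𝟏 · y′ ≈ - ℓ
      h₀ = ≈-trans (≈-reflexive (sym (trans (∑-∷ _) (ℤP.+-identityˡ (𝟏 · y′))))) (h zero)
      h₁ : ∀ j → z j + (A ⊙ y′) j ≈ c * x j
      h₁ j = ≈-trans (≈-reflexive (trans (lem (z j) (x j) c ((A ⊙ y′) j))
        (cong (λ r → z j + r + x j * c) (sym (∑-∷ _)))))
        (≈-trans (+-cong (+-cong (≈-refl {z j}) (h (suc j))) (≈-refl {x j * c})) (≈-reflexive (lem₂ (z j) (x j) c)))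
        where
        lem : ∀ z x c a → z + a ≡ z + (- x * c + a) + x * c
        lem = solve-∀
        lem₂ : ∀ z x c → z + - z + x * c ≡ c * x
        lem₂ = solve-∀
      module P² = Mod (+ p * + p)
      Ax′ : ∀ j → P²._≈_ ((A ⊙ x′) j) (+ p * (c * x j))
      Ax′ j = P².≈-trans (P².≈-reflexive (trans (·-linearʳ (A j) x y′ (+ p))
        (trans (cong (_+ + p * (A j · y′)) (z≡ j)) (lem (z j) (+ p) (A j · y′)))))
        (scale-≈ (h₁ j))
        where
        lem : ∀ z p a → z * p + p * a ≡ p * (z + a)
        lem = solve-∀
      -- One factor A moves onto x′, giving -pc(𝟏ᵀ-moment with x) from the previous walk vector; the
      -- product of that walk vector with x supplies the second factor p.
      killedℕ : ∀ k → P²._≈_ (walk A k · x′) (+ 0)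
      killedℕ zero = P².≈-trans (P².≈-reflexive
        (trans (·-linearʳ 𝟏 x y′ (+ p)) (trans (cong (_+ + p * (𝟏 · y′)) ℓ≡) (lem ℓ (+ p) (𝟏 · y′)))))
        (P².≈-trans (scale-≈ (+-cong (≈-refl {ℓ}) h₀)) (P².≈-reflexive (lem₂ ℓ (+ p))))
        where
        lem : ∀ l p a → l * p + p * a ≡ p * (l + a)
        lem = solve-∀
        lem₂ : ∀ l p → p * (l + - l) ≡ + 0
        lem₂ = solve-∀
      killedℕ (suc k) = P².≈-trans (P².≈-reflexive (skew-adjoint skA (walk A k) x′))
        (P².≈-trans (P².neg-cong (P².·-≈ʳ (walk A k) Ax′))
        (P².≈-trans (P².≈-reflexive (trans (cong -_
          (trans (·-scaleʳ (+ p) (walk A k) (λ j → c * x j)) (cong (+ p *_) (·-scaleʳ c (walk A k) x))))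
          (lem (+ p) c (walk A k · x))))
        (P².≈-trans (scale-≈ (*-zero (- c) (hx k))) (P².≈-reflexive (ℤP.*-zeroʳ (+ p))))))
        where
        lem : ∀ p c a → - (p * (c * a)) ≡ p * (- c * a)
        lem = solve-∀
      killed : ∀ (k : Fin n) → + p * + p ∣ walk A (toℕ k) · x′
      killed k = P².≈0⇒∣ (killedℕ (toℕ k))

    -- An obstruction (s, w) satisfies w · x ≡ 0 and Aw ≡ s𝟏. By `image`, w ≡ a(A)𝟏 and x ≡ b(A)𝟏,
    -- so sx ≡ b(A)Aw ≡ a(A)Ax ≡ 0 and s ≡ 0. Then w lies in the kernel of A, is a multiple of x by
    -- `cyclic-kernel`, and x · z = 0 because p(x · z) = x · Ax = 0.
    unobstructed : ¬ Obstructed system target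
    unobstructed (w′ , h , ≉0) = ≉0 (≈-trans (≈-reflexive (∑-∷ _)) (finish (s ≈0?)))
      where
      s = w′ zero
      w : Vector n
      w = w′ ∘ suc
      x·w≈0 : x · w ≈ + 0
      x·w≈0 = ≈-trans (≈-reflexive (trans (lem s (x · w)) (cong -_ (trans (cong (_+_ (s * + 0))
          (trans (cong -_ (·-comm x w)) (sym (neg-·ʳ w x)))) (sym (∑-∷ _)))))) (neg-cong (h zero))
        where
        lem : ∀ s a → a ≡ - (s * + 0 + - a)
        lem = solve-∀
      Aw≈s : ∀ j → (A ⊙ w) j ≈ s
      Aw≈s j = ≈-trans (≈-reflexive (trans (trans (·-congˡ w (skA j))
        (trans (neg-·ˡ (col A j) w) (cong -_ (·-comm (col A j) w))))
          (trans (lem s (w · col A j)) (cong (λ r → s + - r) (sym (∑-∷ _))))))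
        (≈-trans (+-cong (≈-refl {s}) (neg-cong (h (suc j)))) (≈-reflexive (ℤP.+-identityʳ s)))
        where
        lem : ∀ s a → - a ≡ s + - (s * + 1 + a)
        lem = solve-∀
      killed : Killed x
      killed k = hx (toℕ k)
      a = proj₁ (image killed x≉0 w x·w≈0)
      w≈ = proj₂ (image killed x≉0 w x·w≈0)
      b = proj₁ (image killed x≉0 x xx≈0)
      x≈ = proj₂ (image killed x≉0 x xx≈0)
      x·z≡0 : x · z ≡ + 0
      x·z≡0 = *-cancelˡ-≢0 {+ p} p≢0 (x · z) (+ 0) (trans (sym (·-scaleʳ (+ p) x z))
        (trans (·-congʳ x λ j → trans (ℤP.*-comm (+ p) (z j)) (sym (z≡ j)))
          (trans (skew-self-orthogonal skA x) (sym (ℤP.*-zeroʳ (+ p))))))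
        where
        p≢0 : + p ≢ + 0
        p≢0 q = ℕ.≢-nonZero⁻¹ p {{prime⇒nonZero pr}} (ℤP.+-injective q)
      sx≈0 : s * x i ≈ + 0
      sx≈0 = begin
        s * x i ≈⟨ *-congˡ s (x≈ i) ⟩
        s * poly b 𝟏 i ≡⟨ trans (sym (ℤP.+-identityˡ (s * poly b 𝟏 i)))
          (cong (_+ s * poly b 𝟏 i) (sym (poly-zero b i))) ⟩
        poly b (λ _ → + 0) i + s * poly b 𝟏 i ≡⟨ poly-linear b (λ _ → + 0) s 𝟏 i ⟨
        poly b (λ _ → + 0 + s * + 1) i ≡⟨ poly-cong b (λ _ → trans (ℤP.+-identityˡ (s * + 1)) (ℤP.*-identityʳ s)) i ⟩
        poly b (λ _ → s) i ≈⟨ poly-≈ b Aw≈s i ⟨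
        poly b (A ⊙ w) i ≈⟨ poly-≈ b (⊙-≈ w≈) i ⟩
        poly b (A ⊙ poly a 𝟏) i ≡⟨ poly-⊙ b (poly a 𝟏) i ⟩
        (A ⊙ poly b (poly a 𝟏)) i ≡⟨ ⊙-cong A (poly-comm a b 𝟏) i ⟩
        (A ⊙ poly a (poly b 𝟏)) i ≈⟨ ⊙-≈ (poly-≈ a x≈) i ⟨
        (A ⊙ poly a x) i ≈⟨ poly-kernel a kx i ⟩
        + 0 ∎
        where open ≈-Reasoning
      finish : Dec (s ≈ + 0) → s * - ℓ + w · (λ j → - z j) ≈ + 0
      finish (no s≉0) with *-≈0 sx≈0
      ... | inj₁ q = ⊥-elim (s≉0 q)
      ... | inj₂ q = ⊥-elim (x≉0 q)
      finish (yes s≈0) = +-cong {s * - ℓ} {+ 0} (zero-* (- ℓ) s≈0)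
        (w·z (cyclic-kernel a b 𝟏 w≈ x≈ (λ j → ≈-trans (Aw≈s j) s≈0) kx x≉0))
        where
        w·z : (∃ λ c → ∀ j → w j ≈ c * x j) → w · (λ j → - z j) ≈ + 0
        w·z (c , q) = ≈-trans (·-≈ˡ (λ j → - z j) q) (≈-reflexive (trans (∑-cong λ j → lem c (x j) (z j))
          (trans (sym (*-distribˡ-∑ (- c) (λ j → x j * z j))) (trans (cong (- c *_) x·z≡0) (ℤP.*-zeroʳ (- c))))))
          where
          lem : ∀ c x z → c * x * - z ≡ - c * (x * z)
          lem = solve-∀

  no-isotropic-kernel : ∀ {x i} → (∀ k → walk A k · x ≈ + 0) → (∀ j → (A ⊙ x) j ≈ + 0) → x · x ≈ + 0 → x i ≈ + 0
  no-isotropic-kernel {x} {i} hx kx xx≈0 with x i ≈0?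
  ... | yes q = q
  ... | no x≉0 with fredholm (Isotropic.system {x} {i} hx kx xx≈0 x≉0) (Isotropic.target {x} {i} hx kx xx≈0 x≉0)
  ...   | inj₁ q = ⊥-elim (Isotropic.unsolvable {x} {i} hx kx xx≈0 x≉0 q)
  ...   | inj₂ q = ⊥-elim (Isotropic.unobstructed {x} {i} hx kx xx≈0 x≉0 q)

-- Converse and composition of conjugations

neg : ∀ {n} → Mat n → Mat n
neg A i j = - A i j

neg-skew : ∀ {n} {A : Mat n} → Skew A → Skew (neg A)
neg-skew sk i j = cong -_ (sk i j)

neg-⊙ : ∀ {n} (A : Mat n) v i → (neg A ⊙ v) i ≡ - (A ⊙ v) i
neg-⊙ A v i = neg-·ˡ (A i) v

walk-neg : ∀ {n} (A : Mat n) k i → walk (neg A) k i ≡ sgn k * walk A k i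
walk-neg A zero    i = refl
walk-neg A (suc k) i = trans (neg-⊙ A (walk (neg A) k) i)
  (trans (cong -_ (trans (·-congʳ (A i) (walk-neg A k)) (·-scaleʳ (sgn k) (A i) (walk A k))))
                         (ℤP.neg-distribˡ-* (sgn k) (walk A (suc k) i)))

compose : ∀ {n} {A B B′ : Mat n} {d d′ N N′} → Conjugation A B d N → Conjugation A B′ d′ N′ →
          Conjugation B B′ (d * d′) ((N ᵀ) ⊗ N′)
compose {n} {A} {B} {B′} {d} {d′} {N} {N′} C C′ = record
  { nonzero    = *-≢0 ℂ.nonzero ℂ′.nonzero
  ; orthogonal = λ i j → trans (·-isometry (col N′ i) (col N′ j))
    (trans (cong (d * d *_) (ℂ′.orthogonal i j)) (square (δ i j)))
  ; regular    = λ i → trans (⊙-adjoint (N ᵀ) (col N′ i) 𝟏)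
    (trans (·-congʳ (col N′ i) λ k → trans (ℂ.rows-sum k) (sym (ℤP.*-identityʳ d)))
      (trans (·-scaleʳ d (col N′ i) 𝟏) (cong (d *_) (ℂ′.regular i))))
  ; conjugates = λ i j → trans (·-congʳ ((N ᵀ) ⊙ col N′ i) (intertwine (col N′ j)))
      (trans (·-isometry (col N′ i) (A ⊙ col N′ j)) (trans (cong (d * d *_) (ℂ′.conjugates i j)) (square (B′ i j))))
  }
  where
  module ℂ = Conjugated C
  module ℂ′ = Conjugated C′
  open ≡-Reasoning
  square : ∀ x → d * d * (d′ * d′ * x) ≡ d * d′ * (d * d′) * x
  square x = lem d d′ x
    where
    lem : ∀ d e x → d * d * (e * e * x) ≡ d * e * (d * e) * x
    lem = solve-∀
  N-Nᵀ : ∀ v i → (N ⊙ ((N ᵀ) ⊙ v)) i ≡ d * d * v i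
  N-Nᵀ v i = trans (sym (⊙-assoc N (N ᵀ) v i)) (trans (·-congˡ v (ℂ.orthogonal′ i)) (∙δ-⊙ (d * d) v i))
  Nᵀ-N : ∀ v i → ((N ᵀ) ⊙ (N ⊙ v)) i ≡ d * d * v i
  Nᵀ-N v i = trans (sym (⊙-assoc (N ᵀ) N v i)) (trans (·-congˡ v (ℂ.orthogonal i)) (∙δ-⊙ (d * d) v i))
  ·-isometry : ∀ u v → ((N ᵀ) ⊙ u) · ((N ᵀ) ⊙ v) ≡ d * d * (u · v)
  ·-isometry u v = trans (⊙-adjoint (N ᵀ) u ((N ᵀ) ⊙ v)) (trans (·-congʳ u (N-Nᵀ v)) (·-scaleʳ (d * d) u v))
  intertwine : ∀ v i → (B ⊙ ((N ᵀ) ⊙ v)) i ≡ ((N ᵀ) ⊙ (A ⊙ v)) i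
  intertwine v i = *-cancelˡ-≢0 ℂ.d²≢0 _ _ (begin
    d * d * (B ⊙ ((N ᵀ) ⊙ v)) i ≡⟨ Nᵀ-N (B ⊙ ((N ᵀ) ⊙ v)) i ⟨
    ((N ᵀ) ⊙ (N ⊙ (B ⊙ ((N ᵀ) ⊙ v)))) i ≡⟨ ⊙-cong (N ᵀ) (ℂ.⊙-commutes ((N ᵀ) ⊙ v)) i ⟨
    ((N ᵀ) ⊙ (A ⊙ (N ⊙ ((N ᵀ) ⊙ v)))) i ≡⟨ ⊙-cong (N ᵀ) (⊙-cong A (N-Nᵀ v)) i ⟩
    ((N ᵀ) ⊙ (A ⊙ (λ k → d * d * v k))) i ≡⟨ ⊙-cong (N ᵀ) (λ k → ·-scaleʳ (d * d) (A k) v) i ⟩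
    ((N ᵀ) ⊙ (λ k → d * d * (A ⊙ v) k)) i ≡⟨ ·-scaleʳ (d * d) (col N i) (A ⊙ v) ⟩
    d * d * ((N ᵀ) ⊙ (A ⊙ v)) i ∎)

-- Integral regular orthogonal matrices are permutation matrices

square-≥ : ∀ a → ∃ λ m → a * a - a ≡ + m
square-≥ (+ zero)  = 0 , refl
square-≥ (+ suc m) = suc m ℕ.* m , trans (lem (+ m)) (sym (ℤP.pos-* (suc m) m))
  where
  lem : ∀ m → (+ 1 + m) * (+ 1 + m) - (+ 1 + m) ≡ (+ 1 + m) * m
  lem = solve-∀
square-≥ -[1+ m ]  = suc m ℕ.* suc (suc m) , trans (lem (+ m)) (sym (ℤP.pos-* (suc m) (suc (suc m))))
  where
  lem : ∀ m → - (+ 1 + m) * - (+ 1 + m) - - (+ 1 + m) ≡ (+ 1 + m) * (+ 2 + m)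
  lem = solve-∀

nonneg-∑ : ∀ {n} {f : Vector n} → (∀ i → ∃ λ m → f i ≡ + m) → ∃ λ m → ∑ f ≡ + m
nonneg-∑ {zero}  {f} h = 0 , ∑-[] f
nonneg-∑ {suc n} {f} h = proj₁ (h zero) ℕ.+ proj₁ (nonneg-∑ (h ∘ suc)) ,
  trans (∑-∷ f) (cong₂ _+_ (proj₂ (h zero)) (proj₂ (nonneg-∑ (h ∘ suc))))

nonneg-∑-zero : ∀ {n} {f : Vector n} → (∀ i → ∃ λ m → f i ≡ + m) → ∑ f ≡ + 0 → ∀ i → f i ≡ + 0
nonneg-∑-zero {suc n} {f} h s = split (h zero) (nonneg-∑ (h ∘ suc)) (trans (sym (∑-∷ f)) s)
  where
  split : (∃ λ m → f zero ≡ + m) → (∃ λ m → ∑ (f ∘ suc) ≡ + m) → f zero + ∑ (f ∘ suc) ≡ + 0 → ∀ i → f i ≡ + 0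
  split (a , p) (b , q) r zero    = trans p (cong +_ (ℕP.m+n≡0⇒m≡0 a (ℤP.+-injective (trans (sym (cong₂ _+_ p q)) r))))
  split (a , p) (b , q) r (suc i) = nonneg-∑-zero (h ∘ suc)
    (trans q (cong +_ (ℕP.m+n≡0⇒n≡0 a (ℤP.+-injective (trans (sym (cong₂ _+_ p q)) r))))) i

δ-vector : ∀ {n} (v : Vector n) → (∀ i → v i ≡ + 0 ⊎ v i ≡ + 1) → ∑ v ≡ + 1 → ∃ λ i → ∀ k → v k ≡ δ k i
δ-vector {zero}  v h s with trans (sym (∑-[] v)) s
... | ()
δ-vector {suc n} v h s with h zero
... | inj₁ v₀≡0 = lift (δ-vector (v ∘ suc) (h ∘ suc)
  (trans (sym (ℤP.+-identityˡ _)) (trans (cong (_+ ∑ (v ∘ suc)) (sym v₀≡0)) (trans (sym (∑-∷ v)) s))))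
  where
  lift : (∃ λ i → ∀ k → v (suc k) ≡ δ k i) → ∃ λ i → ∀ k → v k ≡ δ k i
  lift (i , q) = suc i , λ { zero → v₀≡0 ; (suc k) → q k }
... | inj₂ v₀≡1 = zero , λ { zero → v₀≡1 ; (suc k) → nonneg-∑-zero (nonneg ∘ suc) rest k }
  where
  nonneg : ∀ i → ∃ λ m → v i ≡ + m
  nonneg i with h i
  ... | inj₁ q = 0 , q
  ... | inj₂ q = 1 , q
  rest : ∑ (v ∘ suc) ≡ + 0
  rest = trans (lem (∑ (v ∘ suc))) (cong (_- + 1) (trans (cong (_+ ∑ (v ∘ suc)) (sym v₀≡1)) (trans (sym (∑-∷ v)) s)))
    where
    lem : ∀ x → x ≡ + 1 + x - + 1
    lem = solve-∀

-- The integers a² - a are non-negative and here sum to v · v - v · 𝟏 = 0, so all entries are 0 or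
-- 1.
unit-regular⇒δ : ∀ {n} (v : Vector n) → v · v ≡ + 1 → v · 𝟏 ≡ + 1 → ∃ λ i → ∀ k → v k ≡ δ k i
unit-regular⇒δ v vv v1 = δ-vector v zero-one (trans (∑-cong λ i → sym (ℤP.*-identityʳ (v i))) v1)
  where
  excess : ∑ (λ i → v i * v i - v i) ≡ + 0
  excess = trans (∑-cong λ i → lem (v i)) (trans (·-linearʳ v v 𝟏 (- + 1)) (cong₂ (λ x y → x + - + 1 * y) vv v1))
    where
    lem : ∀ a → a * a - a ≡ a * (a + - + 1 * + 1)
    lem = solve-∀
  zero-one : ∀ i → v i ≡ + 0 ⊎ v i ≡ + 1
  zero-one i with ℤP.i*j≡0⇒i≡0∨j≡0 (v i) {v i - + 1} (trans (lem (v i)) (nonneg-∑-zero (λ k → square-≥ (v k)) excess i))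
    where
    lem : ∀ a → a * (a - + 1) ≡ a * a - a
    lem = solve-∀
  ... | inj₁ q = inj₁ q
  ... | inj₂ q = inj₂ (ℤP.i-j≡0⇒i≡j (v i) (+ 1) q)

δ-injective : ∀ {n} {i j : Fin n} → δ i j ≡ + 1 → i ≡ j
δ-injective {i = i} {j} h with i ≟ j
... | yes p = p
δ-injective () | no _

-- Rows and columns are both unit vectors, and the positions of their ones define mutually inverse
-- maps.
conjugation⇒permutation : ∀ {n} {A B : Mat n} {P} → Conjugation A B (+ 1) P →
                          ∃ λ (π : Permutation n n) → ∀ i j → B i j ≡ A (π ⟨$⟩ʳ i) (π ⟨$⟩ʳ j)
conjugation⇒permutation {n} {A} {B} {P} C = permutation f g fg gf , entries-agree
  where
  open Conjugated C
  one : ∀ i → + 1 * + 1 * δ {n} i i ≡ + 1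
  one i = trans (ℤP.*-identityˡ (δ i i)) (δ-refl i)
  columns : ∀ j → ∃ λ i → ∀ k → P k j ≡ δ k i
  columns j = unit-regular⇒δ (col P j) (trans (orthogonal j j) (one j)) (regular j)
  rows : ∀ i → ∃ λ j → ∀ k → P i k ≡ δ k j
  rows i = unit-regular⇒δ (P i) (trans (orthogonal′ i i) (one i)) (rows-sum i)
  f g : Fin n → Fin n
  f j = proj₁ (columns j)
  g i = proj₁ (rows i)
  fg : ∀ i → f (g i) ≡ i
  fg i = sym (δ-injective (trans (sym (proj₂ (columns (g i)) i)) (trans (proj₂ (rows i) (g i)) (δ-refl (g i)))))
  gf : ∀ j → g (f j) ≡ j
  gf j = sym (δ-injective (trans (sym (proj₂ (rows (f j)) j)) (trans (proj₂ (columns j) (f j)) (δ-refl (f j)))))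
  select : ∀ j v → col P j · v ≡ v (f j)
  select j v = trans (∑-cong λ k → cong (_* v k) (trans (proj₂ (columns j) k) (δ-sym k (f j)))) (∑-δˡ (f j) v)
  entries-agree : ∀ i j → B i j ≡ A (f i) (f j)
  entries-agree i j = trans (sym (ℤP.*-identityˡ (B i j))) (trans (sym (conjugates i j))
    (trans (select i (A ⊙ col P j)) (trans (·-comm (A (f i)) (col P j)) (select j (A (f i))))))

-- A criterion for isomorphism

¬prime-divisor⇒unit : ∀ {m} → m ≢ 0 → (∀ p → Prime p → ¬ (p ℕD.∣ m)) → m ≡ 1
¬prime-divisor⇒unit {m} m≢0 h = go (factorise m {{ℕ.≢-nonZero m≢0}})
  where
  go : PrimeFactorisation m → m ≡ 1
  go record { factors = [] ; isFactorisation = eq } = eq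
  go record { factors = p ∷ ps ; isFactorisation = eq ; factorsPrime = pr ∷ _ } =
    ⊥-elim (h p pr (ℕD.divides (product ps) (trans eq (ℕP.*-comm p (product ps)))))

unit-conjugation : ∀ {n} {A B : Mat n} {d N} → Conjugation A B d N → ℤ.∣ d ∣ ≡ 1 → ∃ λ P → Conjugation A B (+ 1) P
unit-conjugation {d = + _}      {N} C refl = N , C
unit-conjugation {d = -[1+ _ ]} {N} C refl = neg N , divide-out (+ 1) (neg N) refl (λ i j → lem (N i j)) C
  where
  lem : ∀ a → a ≡ - a * - + 1
  lem = solve-∀

-- Let X / e be NᵀN′ / dd′ in lowest terms, with cancelled factor g. If p ∣ e, some entry of X is
-- prime to p while p² divides every entry of gX, so p² ∣ g and p³ ∣ ge = dd′, which is excluded.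
-- Hence e = ±1 and the composite is a permutation.
isomorphism-criterion : ∀ {n} {A B B′ : Mat n} {d d′ N N′} → Conjugation A B d N → Conjugation A B′ d′ N′ →
  (∀ p → Prime p → + p ∣ d * d′ → (∀ i j → + p * + p ∣ col N i · col N′ j) × ¬ (+ p * + p * + p ∣ d * d′)) →
  ∃ λ (π : Permutation n n) → ∀ i j → B′ i j ≡ B (π ⟨$⟩ʳ i) (π ⟨$⟩ʳ j)
isomorphism-criterion {d = d} {d′} {N} {N′} C C′ h with primitive-conjugation (compose C C′)
... | e , X , CX , prim , g , dd′≡ , X≡ = conjugation⇒permutation (proj₂ (unit-conjugation CX (¬prime-divisor⇒unit
        (λ q → Conjugation.nonzero CX (ℤP.∣i∣≡0⇒i≡0 q)) λ p pr p∣e → no-divisor p pr (ℤS.∣ᵤ⇒∣ p∣e))))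
  where
  no-divisor : ∀ p → Prime p → ¬ (+ p ∣ e)
  no-divisor p pr p∣e = proj₂ hp (subst (+ p * + p * + p ∣_) (trans (ℤP.*-comm g e) (sym dd′≡))
      (ℤS.∣-trans (ℤS.*-monoˡ-∣ (+ p) p²∣g) (ℤS.*-monoʳ-∣ g p∣e)))
    where
    hp = h p pr (subst (+ p ∣_) (sym dd′≡) (ℤS.∣m⇒∣m*n g p∣e))
    p²∣g : + p * + p ∣ g
    p²∣g with prim p pr p∣e
    ... | j , i , p∤ = prime²-cancel pr p∤ (subst (+ p * + p ∣_) (X≡ i j) (proj₁ hp i j))

-- Primes dividing the denominator of one conjugation

module OddConjugation {n} {A : Mat n} (skA : Skew A) (p : ℕ) (pr : Prime p) (p²∤det : ¬ (+ p * + p ∣ det (walks A)))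
  where
  open ModPrime p pr
  open OddPart skA p pr p²∤det
  open Polynomial A
  open PolynomialMod (+ p)

  module _ {B : Mat n} (skB : Skew B) {d N} (C : Conjugation A B d N) where
    open Conjugated C

    column-killed : + p ∣ d → ∀ c k → walk A k · col N c ≈ + 0
    column-killed p∣d c k = ∣⇒≈0 (subst (+ p ∣_) (sym (trans (·-comm (walk A k) (col N c)) (col-walk skA skB k c)))
      (ℤS.∣m⇒∣m*n (walk B k c) p∣d))

    -- By `col-walk` the columns of N are killed modulo p², so `kernel-lift` applies. For primitive
    -- N this excludes p² ∣ d.
    square-divisor⇒zero : + p * + p ∣ d → ∀ i c → N i c ≈ + 0
    square-divisor⇒zero p²∣d i c = kernel-lift (col N c) (λ k → subst (+ p * + p ∣_)
      (sym (trans (·-comm (walk A (toℕ k)) (col N c)) (col-walk skA skB (toℕ k) c)))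
        (ℤS.∣m⇒∣m*n (walk B (toℕ k) c) p²∣d)) i

    p²∣columns : + p ∣ d → ∀ i j → + p * + p ∣ col N i · col N j
    p²∣columns p∣d i j = subst (+ p * + p ∣_) (sym (orthogonal i j))
      (ℤS.∣m⇒∣m*n (δ i j) (ℤS.∣-trans (ℤS.*-monoʳ-∣ (+ p) p∣d) (ℤS.*-monoˡ-∣ d p∣d)))

    -- A kernel vector x is an eigenvector of A modulo p, and N₀ anticommutes with A; as the kernel is a
    -- line, this forces the eigenvalue to vanish unless p divides ℓ.
    converse-level : ∀ {ℓ N₀} → Conjugation A (neg A) ℓ N₀ → ¬ (+ 2 ≈ + 0) → ¬ (+ p ∣ ℓ) → + p ∣ d → ∀ i c → N i c ≈ + 0
    converse-level {ℓ} {N₀} C₀ 2≉0 p∤ℓ p∣d i c with col N c i ≈0?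
    ... | yes q = q
    ... | no x≉0 = no-isotropic-kernel (column-killed p∣d c) Ax≈0
      (∣⇒≈0 (ℤS.∣-trans (divides (+ p) refl) (p²∣columns p∣d c c)))
      where
      module ℂ₀ = Conjugated C₀
      x = col N c
      kx : Killed x
      kx k = column-killed p∣d c (toℕ k)
      y = N₀ ⊙ x
      -- N₀ᵀ maps walk vectors of A to ℓ times those of -A, which are ± those of A, so N₀ preserves
      -- the kernel of Wᵀ.
      ky : Killed y
      ky k = ≈-trans (≈-reflexive (trans (·-comm (walk A (toℕ k)) y) (trans (⊙-adjoint N₀ x (walk A (toℕ k)))
        (trans (·-congʳ x λ l → trans (ℂ₀.col-walk skA (neg-skew skA) (toℕ k) l)
          (trans (cong (ℓ *_) (walk-neg A (toℕ k) l)) (sym (ℤP.*-assoc ℓ (sgn (toℕ k)) (walk A (toℕ k) l)))))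
        (trans (·-scaleʳ (ℓ * sgn (toℕ k)) x (walk A (toℕ k)))
          (cong (ℓ * sgn (toℕ k) *_) (·-comm x (walk A (toℕ k)))))))))
        (*-zero (ℓ * sgn (toℕ k)) (kx k))
      kAx : Killed (A ⊙ x)
      kAx k = ≈-trans (≈-reflexive (trans (sym (ℤP.neg-involutive (walk A (toℕ k) · (A ⊙ x))))
        (cong -_ (sym (skew-adjoint skA (walk A (toℕ k)) x)))))
        (neg-cong (column-killed p∣d c (suc (toℕ k))))
      -- On the line of x modulo p, N₀ acts as the scalar `c₀` and A as the scalar `e`.
      c₀ = proj₁ (unique-kernel kx x≉0 y ky)
      y≈ = proj₂ (unique-kernel kx x≉0 y ky)
      e = proj₁ (unique-kernel kx x≉0 (A ⊙ x) kAx)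
      Ax≈ = proj₂ (unique-kernel kx x≉0 (A ⊙ x) kAx)
      anticommute : c₀ * (e * x i) ≈ - (e * (c₀ * x i))
      anticommute = begin
        c₀ * (e * x i) ≈⟨ *-congˡ c₀ (Ax≈ i) ⟨
        c₀ * (A ⊙ x) i ≡⟨ ·-scaleʳ c₀ (A i) x ⟨
        (A ⊙ (λ j → c₀ * x j)) i ≈⟨ ⊙-≈ y≈ i ⟨
        (A ⊙ (N₀ ⊙ x)) i ≡⟨ ℂ₀.⊙-commutes x i ⟩
        (N₀ ⊙ (neg A ⊙ x)) i ≡⟨ ⊙-cong N₀ (neg-⊙ A x) i ⟩
        N₀ i · (λ j → - (A ⊙ x) j) ≈⟨ ·-≈ʳ (N₀ i) (λ j → neg-cong (Ax≈ j)) ⟩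
        N₀ i · (λ j → - (e * x j)) ≡⟨ trans (neg-·ʳ (N₀ i) (λ j → e * x j))
          (trans (cong -_ (·-scaleʳ e (N₀ i) x)) (lem e (y i))) ⟩
        - e * y i ≈⟨ *-congˡ (- e) (y≈ i) ⟩
        - e * (c₀ * x i) ≡⟨ sym (lem e (c₀ * x i)) ⟩
        - (e * (c₀ * x i)) ∎
        where
        open ≈-Reasoning
        lem : ∀ e x → - (e * x) ≡ - e * x
        lem = solve-∀
      product≈0 : + 2 * (c₀ * (e * x i)) ≈ + 0
      product≈0 = ≈-trans (≈-reflexive (lem c₀ e (x i)))
        (≈-trans (+-cong anticommute (≈-refl {e * (c₀ * x i)})) (≈-reflexive (ℤP.+-inverseˡ (e * (c₀ * x i)))))
        where
        lem : ∀ c e x → + 2 * (c * (e * x)) ≡ c * (e * x) + e * (c * x)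
        lem = solve-∀
      -- N₀ᵀN₀ is ℓ² times the identity, so c₀ ≡ 0 would give p ∣ ℓ²xᵢ.
      c₀≉0 : ¬ (c₀ ≈ + 0)
      c₀≉0 c₀≈0 = [ p∤ℓ , (λ q → [ p∤ℓ , x≉0 ∘ ∣⇒≈0 ]′ (prime-∣-* pr ℓ (x i) q)) ]′
        (prime-∣-* pr ℓ (ℓ * x i) (≈0⇒∣ ℓ²x≈0))
        where
        ℓ²x≈0 : ℓ * (ℓ * x i) ≈ + 0
        ℓ²x≈0 = ≈-trans (≈-reflexive (sym (trans (sym (⊙-assoc (N₀ ᵀ) N₀ x i)) (trans (·-congˡ x (ℂ₀.orthogonal i))
            (trans (∙δ-⊙ (ℓ * ℓ) x i) (ℤP.*-assoc ℓ ℓ (x i)))))))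
          (∑-≈0 λ k → *-zero (N₀ k i) (≈-trans (y≈ k) (zero-* (x k) c₀≈0)))
      e≈0 : e ≈ + 0
      e≈0 = [ ⊥-elim ∘ 2≉0 , (λ q → [ ⊥-elim ∘ c₀≉0 , (λ r → [ id , ⊥-elim ∘ x≉0 ]′ (*-≈0 {e} {x i} r)) ]′
        (*-≈0 {c₀} {e * x i} q)) ]′
        (*-≈0 {+ 2} {c₀ * (e * x i)} product≈0)
      Ax≈0 : ∀ j → (A ⊙ x) j ≈ + 0
      Ax≈0 j = ≈-trans (Ax≈ j) (zero-* (x j) e≈0)

-- Two conjugations at a common prime

module Neighbours {n} {A : Mat n} (skA : Skew A) (p : ℕ) (pr : Prime p) (p²∤det : ¬ (+ p * + p ∣ det (walks A))) where
  open ModPrime p pr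
  open OddPart skA p pr p²∤det
  private
    module P² = Mod (+ p * + p)
    instance
      p≢0 : ℤ.NonZero (+ p)
      p≢0 = prime⇒nonZero pr

    lower : ∀ {a} → + p * a P².≈ + 0 → a ≈ + 0
    lower h = ∣⇒≈0 (ℤS.*-cancelˡ-∣ (+ p) (P².≈0⇒∣ h))

    raise : ∀ {a} → a ≈ + 0 → + p * a P².≈ + 0
    raise h = P².≈-trans (scale-≈ h) (P².≈-reflexive (ℤP.*-zeroʳ (+ p)))

    remainder : ∀ {u x : Vector n} {c} → (∀ j → u j ≈ c * x j) → ∃ λ (m : Vector n) → ∀ j → u j ≡ c * x j + + p * m j
    remainder {u} {x} {c} h = (λ j → _∣_.quotient (difference (h j))) , λ j →
      trans (lem (u j) (c * x j)) (cong (_+_ (c * x j)) (trans (_∣_.equality (difference (h j))) (ℤP.*-comm _ (+ p))))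
      where
      lem : ∀ u y → u ≡ y + (u - y)
      lem = solve-∀

    expand : ∀ {u x m : Vector n} {c} → (∀ j → u j ≡ c * x j + + p * m j) → ∀ v → u · v ≡ c * (x · v) + + p * (m · v)
    expand {u} {x} {m} {c} h v = trans (·-congˡ v h) (trans (·-linearˡ v (λ j → c * x j) m (+ p))
      (cong (_+ + p * (m · v)) (trans (·-comm (λ j → c * x j) v) (trans (·-scaleʳ c v x) (cong (c *_) (·-comm v x))))))

    remainder-orthogonal : ∀ {u x m : Vector n} {c} → (∀ j → u j ≡ c * x j + + p * m j) →
                           + p * + p ∣ x · x → + p * + p ∣ u · x → m · x ≈ + 0
    remainder-orthogonal {u} {x} {m} {c} h xx ux = lower (P².≈-trans (P².≈-reflexive
      (trans (lem (+ p * (m · x)) (c * (x · x))) (cong (_- c * (x · x)) (sym (expand {u} {x} {m} {c} h x)))))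
      (P².+-cong (P².∣⇒≈0 ux) (P².neg-cong (P².*-zero c (P².∣⇒≈0 xx)))))
      where
      lem : ∀ a b → a ≡ b + a - b
      lem = solve-∀

  -- All four vectors lie on one line modulo p. Divisibility of x · x, y · y, u · x and u′ · y by p²
  -- makes the remainders z, m and m′ orthogonal to x modulo p; for z this comes from 2γ(z · x) ≡ 0,
  -- where 2 must be a unit. Then every term in the expansion of u · u′ is divisible by p².
  module Cross (2≉0 : ¬ (+ 2 ≈ + 0)) {x y u u′ z m m′ : Vector n} {γ α β : ℤ} (γ≉0 : ¬ (γ ≈ + 0))
    (z≡ : ∀ j → y j ≡ γ * x j + + p * z j) (m≡ : ∀ j → u j ≡ α * x j + + p * m j)
      (m′≡ : ∀ j → u′ j ≡ β * y j + + p * m′ j)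
    (xx : + p * + p ∣ x · x) (yy : + p * + p ∣ y · y) (ux : + p * + p ∣ u · x) (u′y : + p * + p ∣ u′ · y) where
    p≈0 : + p ≈ + 0
    p≈0 = ∣⇒≈0 ℤS.∣-refl
    mx≈0 : m · x ≈ + 0
    mx≈0 = remainder-orthogonal {u} {x} {m} {α} m≡ xx ux
    m′y≈0 : m′ · y ≈ + 0
    m′y≈0 = remainder-orthogonal {u′} {y} {m′} {β} m′≡ yy u′y
    yy≡ : y · y ≡ γ * γ * (x · x) + + p * (+ 2 * (γ * (z · x)) + + p * (z · z))
    yy≡ = trans (expand {y} {x} {z} {γ} z≡ y) (trans (cong₂ (λ a b → γ * a + + p * b)
        (trans (·-comm x y) (expand {y} {x} {z} {γ} z≡ x))
          (trans (·-comm z y) (trans (expand {y} {x} {z} {γ} z≡ z) (cong (λ a → γ * a + + p * (z · z)) (·-comm x z)))))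
        (lem γ (x · x) (+ p) (z · x) (z · z)))
      where
      lem : ∀ g a p b c → g * (g * a + p * b) + p * (g * b + p * c) ≡ g * g * a + p * (+ 2 * (g * b) + p * c)
      lem = solve-∀
    zx≈0 : z · x ≈ + 0
    zx≈0 = [ ⊥-elim ∘ 2≉0 , (λ q → [ ⊥-elim ∘ γ≉0 , id ]′ (*-≈0 {γ} {z · x} q)) ]′ (*-≈0 {+ 2} {γ * (z · x)} 2γ)
      where
      step : + 2 * (γ * (z · x)) + + p * (z · z) ≈ + 0
      step = lower (P².≈-trans (P².≈-reflexive (trans (lem (γ * γ * (x · x)) _) (cong (_- γ * γ * (x · x)) (sym yy≡))))
        (P².+-cong (P².∣⇒≈0 yy) (P².neg-cong (P².*-zero (γ * γ) (P².∣⇒≈0 xx)))))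
        where
        lem : ∀ a b → b ≡ a + b - a
        lem = solve-∀
      2γ : + 2 * (γ * (z · x)) ≈ + 0
      2γ = ≈-trans (≈-reflexive (lem (+ 2 * (γ * (z · x))) (+ p * (z · z))))
        (+-cong step (neg-cong (zero-* (z · z) p≈0)))
        where
        lem : ∀ a b → a ≡ a + b - b
        lem = solve-∀
    yx≈0 : y · x P².≈ + 0
    yx≈0 = P².≈-trans (P².≈-reflexive (expand {y} {x} {z} {γ} z≡ x)) (P².+-cong (P².*-zero γ (P².∣⇒≈0 xx)) (raise zx≈0))
    ym≈0 : y · m ≈ + 0
    ym≈0 = ≈-trans (≈-reflexive (expand {y} {x} {z} {γ} z≡ m))
      (+-cong (*-zero γ (≈-trans (≈-reflexive (·-comm x m)) mx≈0)) (zero-* (z · m) p≈0))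
    m′x≈0 : m′ · x ≈ + 0
    m′x≈0 = [ ⊥-elim ∘ γ≉0 , id ]′ (*-≈0 {γ} {m′ · x} (≈-trans (≈-reflexive (lem γ (m′ · x) (+ p * (z · m′))))
        (+-cong (≈-trans (≈-reflexive (trans (cong (λ a → γ * a + + p * (z · m′)) (·-comm m′ x))
          (trans (sym (expand {y} {x} {z} {γ} z≡ m′)) (·-comm y m′)))) m′y≈0)
                (neg-cong (zero-* (z · m′) p≈0)))))
      where
      lem : ∀ g a b → g * a ≡ g * a + b - b
      lem = solve-∀
    products-divisible : + p * + p ∣ u · u′
    products-divisible = P².≈0⇒∣ (begin
      u · u′ ≡⟨ trans (expand {u} {x} {m} {α} m≡ u′) (cong₂ (λ a b → α * a + + p * b) (·-comm x u′) (·-comm m u′)) ⟩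
      α * (u′ · x) + + p * (u′ · m) ≡⟨ cong₂ (λ a b → α * a + + p * b) (expand {u′} {y} {m′} {β} m′≡ x)
        (expand {u′} {y} {m′} {β} m′≡ m) ⟩
      α * (β * (y · x) + + p * (m′ · x)) + + p * (β * (y · m) + + p * (m′ · m))
        ≈⟨ P².+-cong (P².*-zero α (P².+-cong (P².*-zero β yx≈0) (raise m′x≈0)))
          (raise (+-cong (*-zero β ym≈0) (zero-* (m′ · m) p≈0))) ⟩
      + 0 ∎)
      where open P².≈-Reasoning

  -- In the application x and u are columns of one numerator matrix, y and u′ of another, and x and
  -- y are columns that do not vanish modulo p.
  cross-divisible : ¬ (+ 2 ≈ + 0) → ∀ {x y u u′ : Vector n} {i i′} → Killed x → Killed y → Killed u → Killed u′ →
    ¬ (x i ≈ + 0) → ¬ (y i′ ≈ + 0) →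
    + p * + p ∣ x · x → + p * + p ∣ y · y → + p * + p ∣ u · x → + p * + p ∣ u′ · y → + p * + p ∣ u · u′
  cross-divisible 2≉0 {x} {y} {u} {u′} {i} {i′} kx ky ku ku′ x≉0 y≉0 xx yy ux u′y =
    combine (unique-kernel kx x≉0 y ky) (unique-kernel kx x≉0 u ku) (unique-kernel ky y≉0 u′ ku′)
    where
    combine : (∃ λ γ → ∀ j → y j ≈ γ * x j) → (∃ λ α → ∀ j → u j ≈ α * x j) → (∃ λ β → ∀ j → u′ j ≈ β * y j) → + p * +
      p ∣ u · u′
    combine (γ , y≈) (α , u≈) (β , u′≈) = Cross.products-divisible 2≉0 {γ = γ} {α} {β}
      (λ q → y≉0 (≈-trans (y≈ i′) (zero-* (x i′) q)))
      (proj₂ (remainder {y} {x} {γ} y≈)) (proj₂ (remainder {u} {x} {α} u≈)) (proj₂ (remainder {u′} {y} {β} u′≈)) xx yy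
        ux u′y

-- Parity of the moments

module 𝟐 = ModPrime 2 prime[2]

parity : ∀ a → a 𝟐.≈ + 0 ⊎ a 𝟐.≈ + 1
parity a = go (a ℤDM.%ℕ 2) (ℤDM.n%ℕd<d a 2) (ℤDM.a≡a%ℕn+[a/ℕn]*n a 2)
  where
  q = a ℤDM./ℕ 2
  lem : ∀ r q → r + q * + 2 - r ≡ q * + 2
  lem = solve-∀
  go : ∀ r → r ℕ.< 2 → a ≡ + r + q * + 2 → a 𝟐.≈ + 0 ⊎ a 𝟐.≈ + 1
  go 0 _ eq = inj₁ (congruent (divides q (trans (cong (_- + 0) eq) (lem (+ 0) q))))
  go 1 _ eq = inj₂ (congruent (divides q (trans (cong (_- + 1) eq) (lem (+ 1) q))))
  go (suc (suc r)) (ℕ.s≤s (ℕ.s≤s ())) eq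

odd⇒≈1 : ∀ {a} → ¬ (+ 2 ∣ a) → a 𝟐.≈ + 1
odd⇒≈1 {a} h = [ (λ q → ⊥-elim (h (𝟐.≈0⇒∣ q))) , id ]′ (parity a)

square≈self : ∀ a → a * a 𝟐.≈ a
square≈self a = [ (λ q → 𝟐.≈-trans (𝟐.*-cong q q) (𝟐.≈-sym q)) , (λ q → 𝟐.≈-trans (𝟐.*-cong q q) (𝟐.≈-sym q)) ]′
  (parity a)

sgn-cases : ∀ k → sgn k ≡ + 1 ⊎ sgn k ≡ - + 1
sgn-cases zero    = inj₁ refl
sgn-cases (suc k) = [ (λ q → inj₂ (cong -_ q)) , (λ q → inj₁ (cong -_ q)) ]′ (sgn-cases k)

sgn-double : ∀ k → sgn (k ℕ.+ k) ≡ + 1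
sgn-double zero    = refl
sgn-double (suc k) = trans (cong (λ m → - sgn m) (ℕP.+-suc k k))
  (trans (ℤP.neg-involutive (sgn (k ℕ.+ k))) (sgn-double k))

sgn-≢0 : ∀ k → sgn k ≢ + 0
sgn-≢0 k h = [ (λ q → 1≢0 (trans (sym q) h)) , (λ q → -1≢0 (trans (sym q) h)) ]′ (sgn-cases k)
  where
  1≢0 : + 1 ≢ + 0
  1≢0 ()
  -1≢0 : - + 1 ≢ + 0
  -1≢0 ()

halve : ∀ t → ∃ λ s → t ≡ s ℕ.+ s ⊎ t ≡ suc (s ℕ.+ s)
halve zero    = 0 , inj₁ refl
halve (suc t) = step (halve t)
  where
  step : (∃ λ s → t ≡ s ℕ.+ s ⊎ t ≡ suc (s ℕ.+ s)) → ∃ λ s → suc t ≡ s ℕ.+ s ⊎ suc t ≡ suc (s ℕ.+ s)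
  step (s , inj₁ q) = s , inj₂ (cong suc q)
  step (s , inj₂ q) = suc s , inj₁ (trans (cong suc q) (cong suc (sym (ℕP.+-suc s s))))

module Moments {n} {A : Mat n} (skA : Skew A) where

  -- Up to sign this is xᵀSx with x = Sˢ𝟏.
  moment-odd : ∀ s → moment A (suc (s ℕ.+ s)) ≡ + 0
  moment-odd s = *-cancelˡ-≢0 (sgn-≢0 s) _ _ (trans (trans (cong (λ t → sgn s * moment A t) (sym (ℕP.+-suc s s)))
    (trans (sym (gram skA s (suc s))) (skew-self-orthogonal skA (walk A s)))) (sym (ℤP.*-zeroʳ (sgn s))))

  -- Up to sign the left side is |Sˢ𝟏|², and each square is congruent to its base modulo 2.
  moment-double : ∀ s → moment A (s ℕ.+ s) 𝟐.≈ moment A s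
  moment-double s = begin
    moment A (s ℕ.+ s) ≡⟨ ℤP.*-identityˡ _ ⟨
    + 1 * moment A (s ℕ.+ s) ≈⟨ 𝟐.*-congʳ _ (sgn-odd s) ⟨
    sgn s * moment A (s ℕ.+ s) ≡⟨ gram skA s s ⟨
    walk A s · walk A s ≈⟨ 𝟐.∑-≈ (λ i → 𝟐.≈-trans (square≈self (walk A s i))
      (𝟐.≈-reflexive (sym (ℤP.*-identityʳ (walk A s i))))) ⟩
    moment A s ∎
    where
    open 𝟐.≈-Reasoning
    sgn-odd : ∀ s → sgn s 𝟐.≈ + 1
    sgn-odd s = [ 𝟐.≈-reflexive , (λ q → 𝟐.≈-trans (𝟐.≈-reflexive q) (congruent (divides (- + 1) refl))) ]′
      (sgn-cases s)

  -- Halving a positive index ends at an odd one, whose moment is 0. Only at index 0, where the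
  -- moment is the order n, must parity be supplied.
  moment-even : ∀ t → (t ≡ 0 → moment A 0 𝟐.≈ + 0) → moment A t 𝟐.≈ + 0
  moment-even = <-rec _ step
    where
    P : ℕ → Set
    P t = (t ≡ 0 → moment A 0 𝟐.≈ + 0) → moment A t 𝟐.≈ + 0
    step : ∀ t → (∀ {s} → s ℕ.< t → P s) → P t
    step zero    rec h = h refl
    step (suc t) rec h = go (halve (suc t))
      where
      go : (∃ λ s → suc t ≡ s ℕ.+ s ⊎ suc t ≡ suc (s ℕ.+ s)) → moment A (suc t) 𝟐.≈ + 0
      go (s , inj₂ q) = 𝟐.≈-reflexive (trans (cong (moment A) q) (moment-odd s))
      go (suc s , inj₁ q) = 𝟐.≈-trans (𝟐.≈-reflexive (cong (moment A) q)) (𝟐.≈-trans (moment-double (suc s))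
        (rec (subst (suc s ℕ.<_) (sym q) (ℕP.m<m+n (suc s) ℕ.z<s)) λ ()))

  gram-even : ∀ i j → (i ℕ.+ j ≡ 0 → moment A 0 𝟐.≈ + 0) → walk A i · walk A j 𝟐.≈ + 0
  gram-even i j h = 𝟐.≈-trans (𝟐.≈-reflexive (gram skA i j)) (𝟐.*-zero (sgn i) (moment-even (i ℕ.+ j) h))

∑-const : ∀ n c → ∑ {n} (λ _ → c) ≡ + n * c
∑-const zero    c = ∑-[] _
∑-const (suc n) c = trans (∑-∷ {n} _) (trans (cong (_+_ c) (∑-const n c)) (lem c (+ n)))
  where
  lem : ∀ c n → c + n * c ≡ (+ 1 + n) * c
  lem = solve-∀

-- Independence of isotropic families

all-or-some : ∀ {n} {P Q : Fin n → Set} → (∀ i → P i ⊎ Q i) → (∀ i → P i) ⊎ ∃ Q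
all-or-some {zero}  h = inj₁ λ ()
all-or-some {suc n} {P} {Q} h = go (h zero) (all-or-some (h ∘ suc))
  where
  go : P zero ⊎ Q zero → ((∀ i → P (suc i)) ⊎ ∃ (Q ∘ suc)) → (∀ i → P i) ⊎ ∃ Q
  go (inj₂ q) _ = inj₂ (zero , q)
  go (inj₁ p) (inj₂ (i , q)) = inj₂ (suc i , q)
  go (inj₁ p) (inj₁ ps) = inj₁ λ { zero → p ; (suc i) → ps i }

∑-splitAt : ∀ a b (f : Vector (a ℕ.+ b)) → ∑ f ≡ ∑ (λ i → f (i ↑ˡ b)) + ∑ (λ j → f (a ↑ʳ j))
∑-splitAt zero    b f = trans (sym (ℤP.+-identityˡ (∑ f))) (cong (_+ ∑ f) (sym (∑-[] (λ i → f (i ↑ˡ b)))))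
∑-splitAt (suc a) b f = trans (∑-∷ f) (trans (cong (_+_ (f zero)) (∑-splitAt a b (f ∘ suc)))
  (trans (sym (ℤP.+-assoc (f zero) _ _)) (cong (_+ ∑ (λ j → f (suc a ↑ʳ j))) (sym (∑-∷ (λ i → f (i ↑ˡ b)))))))

·-∑ : ∀ {m n} (u : Vector n) (c : Vector m) (V : Fin m → Vector n) → u · (λ t → ∑ (λ l → c l * V l t)) ≡ ∑
  (λ l → c l * (u · V l))
·-∑ u c V = trans (·-comm u _) (trans (∑-assoc c V u) (∑-cong λ l → cong (c l *_) (·-comm (V l) u)))

module IsotropicFamily (p : ℕ) (pr : Prime p) where
  open ModPrime p pr

  Relation : ∀ {m n} → (Fin m → Vector n) → Set
  Relation {m} V = ∃ λ (c : Vector m) → (∀ t → ∑ (λ l → c l * V l t) ≈ + 0) × ∃ λ l → ¬ (c l ≈ + 0)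

  module _ {s n} (V B : Fin s → Vector n) (VV : ∀ i j → V i · V j ≈ + 0) (VB : ∀ i j → V i · B j ≈ δ i j) where

    private
      F : Fin (s ℕ.+ s) → Vector n
      F l = [ B , V ]′ (splitAt s l)

    -- V and the dual family B would be 2s independent vectors: pairing a relation with V j isolates
    -- the coefficient of B j, and pairing what remains with B j isolates that of V j.
    isotropic-bound : ¬ (n ℕ.< s ℕ.+ s)
    isotropic-bound n<2s = go (dependent n<2s F)
      where
      go : ¬ Relation F
      go (c , rel , l , c≉0) = c≉0 (subst (λ l → c l ≈ + 0) (FinP.join-splitAt s s l) (zeros (splitAt s l)))
        where
        cB cV : Vector s
        cB i = c (i ↑ˡ s)
        cV i = c (s ↑ʳ i)
        pair : ∀ u → ∑ (λ i → cB i * (u · B i)) + ∑ (λ i → cV i * (u · V i)) ≈ + 0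
        pair u = ≈-trans (≈-reflexive (trans (sym
          (cong₂ _+_ (∑-cong λ i → cong (λ x → cB i * (u · [ B , V ]′ x)) (FinP.splitAt-↑ˡ s i s))
            (∑-cong λ i → cong (λ x → cV i * (u · [ B , V ]′ x)) (FinP.splitAt-↑ʳ s s i))))
            (trans (sym (∑-splitAt s s (λ l → c l * (u · F l)))) (sym (·-∑ u c F)))))
          (∑-≈0 λ t → *-zero (u t) (rel t))
        select : ∀ c j → ∑ (λ i → c i * δ j i) ≡ c j
        select c j = trans (∑-cong λ i → cong (c i *_) (δ-sym j i)) (∑-δʳ j c)
        cB≈0 : ∀ j → cB j ≈ + 0
        cB≈0 j = ≈-trans (≈-reflexive (sym (trans (ℤP.+-identityʳ _) (select cB j))))
          (≈-trans (≈-sym (+-cong (∑-≈ λ i → *-congˡ (cB i) (VB j i)) (∑-≈0 λ i → *-zero (cV i) (VV j i))))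
            (pair (V j)))
        cV≈0 : ∀ j → cV j ≈ + 0
        cV≈0 j = ≈-trans (≈-reflexive (sym (trans (ℤP.+-identityˡ _) (select cV j))))
          (≈-trans (≈-sym (+-cong (∑-≈0 λ i → zero-* (B j · B i) (cB≈0 i))
             (∑-≈ λ i → *-congˡ (cV i) (≈-trans (≈-reflexive (·-comm (B j) (V i)))
               (≈-trans (VB i j) (≈-reflexive (δ-sym i j)))))))
           (pair (B j)))
        zeros : ∀ x → c (join s s x) ≈ + 0
        zeros (inj₁ i) = cB≈0 i
        zeros (inj₂ i) = cV≈0 i

  -- If every unit right-hand side is solvable, the solutions form a dual family, too large for the
  -- dimension. An obstruction is itself a nontrivial relation.
  isotropic⇒relation : ∀ {s n} (V : Fin s → Vector n) → (∀ i j → V i · V j ≈ + 0) → n ℕ.< s ℕ.+ s → Relation V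
  isotropic⇒relation {s} {n} V VV n<2s = go (all-or-some λ j → fredholm V (λ i → δ i j))
    where
    go : (∀ j → Solvable V (λ i → δ i j)) ⊎ (∃ λ j → Obstructed V (λ i → δ i j)) → Relation V
    go (inj₁ B) = ⊥-elim (isotropic-bound V (λ j → proj₁ (B j)) VV (λ i j → proj₂ (B j) i) n<2s)
    go (inj₂ (j , w , h , w≉0)) = w , h , j , λ q → w≉0 (≈-trans (≈-reflexive (∑-δʳ j w)) q)

-- The column space of the walk matrix modulo 2

∑-last : ∀ {m} (f : Vector (suc m)) → ∑ f ≡ ∑ (f ∘ inject₁) + f (fromℕ m)
∑-last {zero}  f = trans (∑-∷ f) (trans (ℤP.+-comm (f zero) _)
  (cong₂ _+_ (trans (∑-[] (f ∘ suc)) (sym (∑-[] (f ∘ inject₁)))) refl))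
∑-last {suc m} f = trans (∑-∷ f) (trans (cong (_+_ (f zero)) (∑-last (f ∘ suc)))
  (trans (sym (ℤP.+-assoc (f zero) (∑ (f ∘ suc ∘ inject₁)) (f (fromℕ (suc m)))))
    (cong (_+ f (fromℕ (suc m))) (sym (∑-∷ (f ∘ inject₁))))))

snoc-elim : ∀ {m} {P : Fin (suc m) → Set} → (∀ i → P (inject₁ i)) → P (fromℕ m) → ∀ i → P i
snoc-elim {zero}  h p zero    = p
snoc-elim {suc m} h p zero    = h zero
snoc-elim {suc m} {P} h p (suc i) = snoc-elim {m} {P ∘ suc} (h ∘ suc) p i

poly-add : ∀ {n} (A : Mat n) {m} (a b : Vector m) c u i →
           Polynomial.poly A (λ l → a l + c * b l) u i ≡ Polynomial.poly A a u i + c * Polynomial.poly A b u i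
poly-add A {zero}  a b c u i = sym (trans (ℤP.+-identityˡ (c * + 0)) (ℤP.*-zeroʳ c))
poly-add A {suc m} a b c u i =
  trans (cong (_+_ ((a zero + c * b zero) * u i))
    (trans (⊙-cong A (poly-add A (a ∘ suc) (b ∘ suc) c u) i) (·-linearʳ (A i) _ _ c)))
        (arith (a zero) (b zero) c (u i) _ _)
  where
  arith : ∀ a b c u x y → (a + c * b) * u + (x + c * y) ≡ a * u + x + c * (b * u + y)
  arith = solve-∀

∏-2 : ∀ n → ∏ {n} (λ _ → + 2) ≡ + (2 ℕ.^ n)
∏-2 zero    = refl
∏-2 (suc n) = trans (cong (+ 2 *_) (∏-2 n)) (sym (ℤP.pos-* 2 (2 ℕ.^ n)))

double-≈ : ∀ {a} → a 𝟐.≈ + 0 → + 2 * a ≈ + 0 [mod + 4 ]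
double-≈ h = Mod.∣⇒≈0 (+ 4) (ℤS.*-monoʳ-∣ (+ 2) (𝟐.≈0⇒∣ h))

module TwoPart {n} {A : Mat n} (skA : Skew A) (k ε : ℕ) (n≡ : n ≡ ε ℕ.+ (k ℕ.+ k)) (ε≤1 : ε ≡ 0 ⊎ ε ≡ 1)
               (m : ℤ) (detW : det (walks A) ≡ + (2 ℕ.^ k) * m) (m-odd : ¬ (+ 2 ∣ m)) where
  open 𝟐
  open Moments skA
  open Polynomial A
  open PolynomialMod (+ 2)
  private module 𝟒 = Mod (+ 4)

  private
    W : Mat n
    W = walks A
    G : Mat n
    G i j = walk A (toℕ i) · walk A (toℕ j)

    2^k = + (2 ℕ.^ k)

    2^k≢0 : 2^k ≢ + 0
    2^k≢0 h = ℕ.≢-nonZero⁻¹ (2 ℕ.^ k) {{ℕP.m^n≢0 2 k}} (ℤP.+-injective h)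

    even-order : n ≡ k ℕ.+ k → moment A 0 ≈ + 0
    even-order q = ∣⇒≈0 (divides (+ k) (trans (∑-const n (+ 1))
      (trans (ℤP.*-identityʳ (+ n)) (trans (cong +_ q) (trans (ℤP.pos-+ k k) (lem (+ k)))))))
      where
      lem : ∀ k → k + k ≡ k * + 2
      lem = solve-∀

    det-W≢0 : det W ≢ + 0
    det-W≢0 h = *-≢0 2^k≢0 (λ { refl → m-odd (divides (+ 0) refl) }) (trans (sym detW) h)

  -- Row i of the Gram matrix G of the walk vectors is divisible by rᵢ ∈ {1, 2}; the determinant of
  -- G = r H leaves an odd determinant for H.
  record Scaling : Set where
    field
      r        : Vector n
      cases    : ∀ i → (r i ≡ + 1 × toℕ i ≡ 0) ⊎ (r i ≡ + 2 × (toℕ i ≡ 0 → moment A 0 ≈ + 0))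
      divisor  : ∀ i j → r i ∣ G i j
      product-r : ∏ r ≡ 2^k * 2^k

  scaling : Scaling
  scaling = by-parity ε≤1 n≡
    where
    pow : 2^k * 2^k ≡ + (2 ℕ.^ (k ℕ.+ k))
    pow = trans (sym (ℤP.pos-* (2 ℕ.^ k) (2 ℕ.^ k))) (cong +_ (sym (ℕP.^-distribˡ-+-* 2 k k)))
    by-parity : ε ≡ 0 ⊎ ε ≡ 1 → n ≡ ε ℕ.+ (k ℕ.+ k) → Scaling
    by-parity (inj₁ refl) refl = record
      { r = λ _ → + 2 ; cases = λ i → inj₂ (refl , λ _ → even-order refl)
      ; divisor = λ i j → ≈0⇒∣ (gram-even (toℕ i) (toℕ j) λ _ → even-order refl)
      ; product-r = trans (∏-2 n) (sym pow) }
    -- For odd n the corner entry 𝟏 · 𝟏 = n is odd, so the first row keeps the factor 1; the product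
    -- is still 2^(2k).
    by-parity (inj₂ refl) refl = record
      { r = + 1 ◂ (λ _ → + 2)
      ; cases = λ { zero → inj₁ (refl , refl) ; (suc i) → inj₂ (refl , λ ()) }
      ; divisor = λ { zero j → divides (G zero j) (sym (ℤP.*-identityʳ (G zero j)))
                    ; (suc i) j → ≈0⇒∣ (gram-even (suc (toℕ i)) (toℕ j) λ ()) }
      ; product-r = trans (ℤP.*-identityˡ (∏ {k ℕ.+ k} (λ _ → + 2))) (trans (∏-2 (k ℕ.+ k)) (sym pow)) }

  open Scaling scaling

  private
    H : Mat n
    H i j = _∣_.quotient (divisor i j)

    G≡rH : ∀ i j → G i j ≡ r i * H i j
    G≡rH i j = trans (_∣_.equality (divisor i j)) (ℤP.*-comm (H i j) (r i))

    det-H : det H ≡ m * m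
    det-H = *-cancelˡ-≢0 (*-≢0 2^k≢0 2^k≢0) _ _ (trans (cong (_* det H) (sym product-r))
      (trans (sym (det-scale-rows r H)) (trans (det-cong (λ i j → sym (G≡rH i j)))
      (trans (det-⊗ (W ᵀ) W) (trans (cong (_* det W) (det-ᵀ W)) (trans (cong₂ _*_ detW detW) (lem 2^k m)))))))
      where
      lem : ∀ p m → p * m * (p * m) ≡ p * p * (m * m)
      lem = solve-∀

    det-H≈1 : det H ≈ + 1
    det-H≈1 = ≈-trans (≈-reflexive det-H) (*-cong (odd⇒≈1 m-odd) (odd⇒≈1 m-odd))

    r≢0 : ∀ i → r i ≢ + 0
    r≢0 i h = [ (λ q → 1≢0 (trans (sym (proj₁ q)) h)) , (λ q → 2≢0 (trans (sym (proj₁ q)) h)) ]′ (cases i)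
      where
      1≢0 : + 1 ≢ + 0
      1≢0 ()
      2≢0 : + 2 ≢ + 0
      2≢0 ()

    r∣2 : ∀ i → r i ∣ + 2
    r∣2 i = [ (λ q → divides (+ 2) (cong (+ 2 *_) (sym (proj₁ q)))) ,
      (λ q → divides (+ 1) (cong (+ 1 *_) (sym (proj₁ q)))) ]′ (cases i)

    row : ∀ i a → G i · a ≡ r i * (H i · a)
    row i a = trans (·-congˡ a (G≡rH i)) (trans (·-comm (λ j → r i * H i j) a)
      (trans (·-scaleʳ (r i) a (H i)) (cong (r i *_) (·-comm a (H i)))))

  gram-kernel : ∀ a → (∀ i → r i * + 2 ∣ G i · a) → ∀ i → a i ≈ + 0
  gram-kernel a h i = ≈-trans (≈-reflexive (sym (ℤP.*-identityˡ (a i)))) (≈-trans (*-congʳ (a i) (≈-sym det-H≈1))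
    (≈-trans (≈-reflexive (trans (cong (_* a i) (sym (det-ᵀ H))) (sym (adj-left (H ᵀ) a i))))
      (∑-≈0 λ j → zero-* (adj (H ᵀ) j i) (Ha≈0 j))))
    where
    Ha≈0 : ∀ j → a · H j ≈ + 0
    Ha≈0 j = ≈-trans (≈-reflexive (·-comm a (H j)))
      (∣⇒≈0 (ℤS.*-cancelˡ-∣ (r j) {{ℤ.≢-nonZero (r≢0 j)}} (subst (r j * + 2 ∣_) (row j a) (h j))))

  -- The proof of `image` needs p² ∤ det W, which fails at 2 once k ≥ 2. Instead Wᵀy is divided row
  -- by row by r and solved with adj H. The solution a gives Wᵀ(Wa - det H · y) = 0, so Wa = det H ·
  -- y exactly, and det H is odd.
  orthogonal⇒image : ∀ y → (∀ (i : Fin n) → walk A (toℕ i) · y ≈ + 0) → ∃ λ a → ∀ i → y i ≈ poly {n} a 𝟏 i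
  orthogonal⇒image y h = a , λ i → ≈-trans (≈-reflexive (sym (ℤP.*-identityˡ (y i))))
    (≈-trans (*-congʳ (y i) (≈-sym det-H≈1))
      (≈-trans (≈-reflexive (sym (exact i))) (≈-reflexive (sym (poly-walk a 0 i)))))
    where
    r∣ : ∀ i → r i ∣ walk A (toℕ i) · y
    r∣ i = ℤS.∣-trans (r∣2 i) (≈0⇒∣ (h i))
    c : Vector n
    c i = _∣_.quotient (r∣ i)
    a : Vector n
    a = adj H ⊙ c
    Ha : ∀ i → H i · a ≡ det H * c i
    Ha i = trans (sym (⊙-assoc H (adj H) c i)) (trans (·-congˡ c (⊗-adj H i))
      (∙δ-⊙ (det H) c i))
    u : Vector n
    u i = (W ⊙ a) i + - det H * y i
    u⊥ : ∀ i → u · col W i ≡ + 0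
    u⊥ i = trans (·-linearˡ (col W i) (W ⊙ a) y (- det H)) (trans (cong₂ (λ s t → s + - det H * t)
        (trans (·-comm (W ⊙ a) (col W i)) (trans (sym (⊙-assoc (W ᵀ) W a i)) (trans (row i a) (cong (r i *_) (Ha i)))))
        (trans (·-comm y (col W i)) (_∣_.equality (r∣ i))))
      (lem (r i) (det H) (c i)))
      where
      lem : ∀ r d c → r * (d * c) + - d * (c * r) ≡ + 0
      lem = solve-∀
    u≡0 : ∀ i → u i ≡ + 0
    u≡0 i = *-cancelˡ-≢0 det-W≢0 _ _ (trans (sym (adj-left W u i))
      (trans (∑-zero λ k → trans (cong (_* adj W k i) (u⊥ k)) refl) (sym (ℤP.*-zeroʳ (det W)))))
    exact : ∀ i → (W ⊙ a) i ≡ det H * y i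
    exact i = trans (lem ((W ⊙ a) i) (det H) (y i))
      (trans (cong (_+ det H * y i) (u≡0 i)) (ℤP.+-identityˡ (det H * y i)))
      where
      lem : ∀ w d y → w ≡ w + - d * y + d * y
      lem = solve-∀

  InSpan : ℕ → Vector n → Set
  InSpan e v = ∃ λ (a : Vector e) → ∀ i → v i ≈ poly a 𝟏 i

  private
    Leading : ℕ → Set
    Leading l = ∃ λ e → e ℕ.< l × ∃ λ (g : Vector e) → ∀ t → walk A (ε ℕ.+ e) t ≈ poly g (walk A ε) t

    -- Even top coefficients are discarded until an odd one appears; being 1 modulo 2, it allows
    -- solving for the top vector without an inverse.
    leading : ∀ l (c : Vector l) → (∀ t → ∑ (λ i → c i * walk A (ε ℕ.+ toℕ i) t) ≈ + 0) → (∀ i → c i ≈ + 0) ⊎ Leading l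
    leading zero    c rel = inj₁ λ ()
    leading (suc l) c rel = [ vanishing , (λ h → inj₂ (l , ℕP.≤-refl , g , top h)) ]′ (parity (c (fromℕ l)))
      where
      split : ∀ t → ∑ (λ i → c i * walk A (ε ℕ.+ toℕ i) t) ≡ ∑ (λ i → c (inject₁ i) * walk A (ε ℕ.+ toℕ i) t) + c
        (fromℕ l) * walk A (ε ℕ.+ l) t
      split t = trans (∑-last (λ i → c i * walk A (ε ℕ.+ toℕ i) t)) (cong₂ _+_
        (∑-cong λ i → cong (λ x → c (inject₁ i) * walk A (ε ℕ.+ x) t) (FinP.toℕ-inject₁ i))
        (cong (λ x → c (fromℕ l) * walk A (ε ℕ.+ x) t) (FinP.toℕ-fromℕ l)))
      vanishing : c (fromℕ l) ≈ + 0 → (∀ i → c i ≈ + 0) ⊎ Leading (suc l)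
      vanishing q = [ (λ h → inj₁ (snoc-elim h q)) , (λ { (e , e<l , rest) → inj₂ (e , ℕP.m<n⇒m<1+n e<l , rest) }) ]′
        (leading l (c ∘ inject₁) λ t → ≈-trans (≈-reflexive (sym (ℤP.+-identityʳ _)))
          (≈-trans (≈-sym (+-cong (≈-refl {∑ (λ i → c (inject₁ i) * walk A (ε ℕ.+ toℕ i) t)})
            (zero-* (walk A (ε ℕ.+ l) t) q))) (≈-trans (≈-reflexive (sym (split t))) (rel t))))
      g : Vector l
      g i = - + 1 * c (inject₁ i)
      top : c (fromℕ l) ≈ + 1 → ∀ t → walk A (ε ℕ.+ l) t ≈ poly g (walk A ε) t
      top q t = begin
        walk A (ε ℕ.+ l) t ≡⟨ ℤP.*-identityˡ _ ⟨
        + 1 * walk A (ε ℕ.+ l) t ≈⟨ *-congʳ (walk A (ε ℕ.+ l) t) q ⟨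
        c (fromℕ l) * walk A (ε ℕ.+ l) t ≡⟨ lem (c (fromℕ l) * walk A (ε ℕ.+ l) t) R ⟩
        R + c (fromℕ l) * walk A (ε ℕ.+ l) t + - + 1 * R ≡⟨ cong (_+ - + 1 * R) (split t) ⟨
        ∑ (λ i → c i * walk A (ε ℕ.+ toℕ i) t) + - + 1 * R ≈⟨ +-cong (rel t) (≈-refl { - + 1 * R}) ⟩
        + 0 + - + 1 * R ≡⟨ ℤP.+-identityˡ _ ⟩
        - + 1 * R ≡⟨ *-distribˡ-∑ (- + 1) _ ⟩
        ∑ (λ i → - + 1 * (c (inject₁ i) * walk A (ε ℕ.+ toℕ i) t))
          ≡⟨ ∑-cong (λ i → lem₂ (c (inject₁ i)) (walk A (ε ℕ.+ toℕ i) t)) ⟩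
        ∑ (λ i → walk A (ε ℕ.+ toℕ i) t * g i) ≡⟨ poly-walk g ε t ⟨
        poly g (walk A ε) t ∎
        where
        open ≈-Reasoning
        R = ∑ (λ i → c (inject₁ i) * walk A (ε ℕ.+ toℕ i) t)
        lem : ∀ x r → x ≡ r + x + - + 1 * r
        lem = solve-∀
        lem₂ : ∀ c w → - + 1 * (c * w) ≡ w * (- + 1 * c)
        lem₂ = solve-∀

  -- The k + 1 vectors from S^ε𝟏 to S^(ε+k)𝟏 are orthogonal modulo 2 to each other and to
  -- themselves, and 2(k + 1) > n, so they are dependent. Starting at ε leaves out 𝟏 when 𝟏 · 𝟏 = n
  -- is odd. The bound 2l < n later allows exponents to be doubled within the columns of W.
  minimal-relation : ∃ λ e → InSpan e (walk A e) × (∀ l → l ℕ.< e → l ℕ.+ l ℕ.< n)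
  minimal-relation = shift (found (IsotropicFamily.isotropic⇒relation 2 prime[2] V VV n<))
    where
    V : Fin (suc k) → Vector n
    V i = walk A (ε ℕ.+ toℕ i)
    VV : ∀ i j → V i · V j ≈ + 0
    VV i j = gram-even (ε ℕ.+ toℕ i) (ε ℕ.+ toℕ j) λ h → even-order
      (trans n≡ (cong (ℕ._+ (k ℕ.+ k)) (ℕP.m+n≡0⇒m≡0 ε (ℕP.m+n≡0⇒m≡0 (ε ℕ.+ toℕ i) h))))
    n< : n ℕ.< suc k ℕ.+ suc k
    n< = subst (ℕ._< suc k ℕ.+ suc k) (sym n≡) (subst (ε ℕ.+ (k ℕ.+ k) ℕ.<_) (cong suc (sym (ℕP.+-suc k k)))
           ([ (λ { refl → ℕP.m<n⇒m<1+n ℕP.≤-refl }) , (λ { refl → ℕP.≤-refl }) ]′ ε≤1))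
    found : IsotropicFamily.Relation 2 prime[2] V → Leading (suc k)
    found (c , rel , l , c≉0) = [ (λ h → ⊥-elim (c≉0 (h l))) , id ]′ (leading (suc k) c rel)
    shift : Leading (suc k) → ∃ λ e → InSpan e (walk A e) × (∀ l → l ℕ.< e → l ℕ.+ l ℕ.< n)
    shift (e , e<1+k , g , rel) = by-parity ε≤1 n≡ rel
      where
      by-parity : ∀ {ε} → ε ≡ 0 ⊎ ε ≡ 1 → n ≡ ε ℕ.+ (k ℕ.+ k) → (∀ t → walk A (ε ℕ.+ e) t ≈ poly g (walk A ε) t) →
                  ∃ λ e → InSpan e (walk A e) × (∀ l → l ℕ.< e → l ℕ.+ l ℕ.< n)
      by-parity (inj₁ refl) q rel = e , (g , rel) , λ l l<e → subst (l ℕ.+ l ℕ.<_) (sym q)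
        (ℕP.+-mono-< (ℕP.<-≤-trans l<e (ℕP.≤-pred e<1+k)) (ℕP.<-≤-trans l<e (ℕP.≤-pred e<1+k)))
      by-parity (inj₂ refl) q rel = suc e , ((+ 0 ◂ g) , λ t → ≈-trans (rel t)
        (≈-reflexive (trans (poly-⊙ g 𝟏 t) (sym (ℤP.+-identityˡ _))))) ,
        λ l l<1+e → subst (l ℕ.+ l ℕ.<_) (sym q) (ℕ.s≤s (ℕP.+-mono-≤ (l≤k l<1+e) (l≤k l<1+e)))
        where
        l≤k : ∀ {l} → l ℕ.< suc e → l ℕ.≤ k
        l≤k l<1+e = ℕP.≤-trans (ℕP.≤-pred l<1+e) (ℕP.≤-pred e<1+k)

  -- Division with remainder along Horner's scheme: after each multiplication by A only the term Sᵉ𝟏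
  -- is out of range, and the relation rewrites it.
  reduce : ∀ {e} → InSpan e (walk A e) → ∀ {l} (a : Vector l) → InSpan e (poly a 𝟏)
  reduce {e} (g , h) {zero}  a = (λ _ → + 0) , λ i → ≈-reflexive (sym (zero-poly e i))
    where
    zero-poly : ∀ e i → poly {e} (λ _ → + 0) 𝟏 i ≡ + 0
    zero-poly e i = trans (poly-walk {e} (λ _ → + 0) 0 i) (∑-zero λ l → ℤP.*-zeroʳ (walk A (toℕ l) i))
  reduce {e} (g , h) {suc l} a = lower (reduce (g , h) (a ∘ suc))
    where
    lower : InSpan e (poly (a ∘ suc) 𝟏) → InSpan e (poly a 𝟏)
    lower (b , q) = (λ i → c (inject₁ i) + c (fromℕ e) * g i) , λ i → begin
      a zero * + 1 + (A ⊙ poly (a ∘ suc) 𝟏) i ≈⟨ +-cong (≈-refl {a zero * + 1}) (⊙-≈ q i) ⟩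
      poly c 𝟏 i ≡⟨ poly-last i ⟩
      poly (c ∘ inject₁) 𝟏 i + c (fromℕ e) * walk A e i ≈⟨ +-cong (≈-refl {poly (c ∘ inject₁) 𝟏 i})
        (*-congˡ (c (fromℕ e)) (h i)) ⟩
      poly (c ∘ inject₁) 𝟏 i + c (fromℕ e) * poly g 𝟏 i ≡⟨ poly-add A (c ∘ inject₁) g (c (fromℕ e)) 𝟏 i ⟨
      poly (λ i → c (inject₁ i) + c (fromℕ e) * g i) 𝟏 i ∎
      where
      open ≈-Reasoning
      c : Vector (suc e)
      c = a zero ◂ b
      poly-last : ∀ i → poly c 𝟏 i ≡ poly (c ∘ inject₁) 𝟏 i + c (fromℕ e) * walk A e i
      poly-last i = trans (poly-walk c 0 i) (trans (∑-last (λ l → walk A (toℕ l) i * c l)) (cong₂ _+_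
        (trans (∑-cong λ l → cong (λ x → walk A x i * c (inject₁ l)) (FinP.toℕ-inject₁ l))
          (sym (poly-walk (c ∘ inject₁) 0 i)))
        (trans (cong (λ x → walk A x i * c (fromℕ e)) (FinP.toℕ-fromℕ e)) (ℤP.*-comm (walk A e i) (c (fromℕ e))))))

-- Frobenius modulo 2 and the vanishing of cross terms modulo 4.
norm-combination : ∀ {l n} (a : Vector l) (v : Fin l → Vector n) → (∀ i j → v i · v j 𝟐.≈ + 0) →
  (λ t → ∑ (λ i → a i * v i t)) · (λ t → ∑ (λ i → a i * v i t)) ≈ ∑ (λ i → a i * (v i · v i)) [mod + 4 ]
norm-combination {zero} a v h = ≈-reflexive
  (trans (∑-zero λ t → cong (_* ∑ (λ i → a i * v i t)) (∑-[] _)) (sym (∑-[] _)))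
  where open Mod (+ 4)
norm-combination {suc l} a v h = begin
  u · u ≡⟨ trans (·-congˡ u split) (trans (·-linearˡ u w (v zero) (a zero))
                                                    (trans (cong₂ (λ s t → s + a zero * t) (expand w)
                                                      (expand (v zero))) (regroup (w · w) (a zero) (v zero · v zero)
                                                      (w · v zero) (v zero · w) (·-comm w (v zero))))) ⟩
  a zero * a zero * (v zero · v zero) + + 2 * (a zero * (v zero · w)) + w · w
    ≈⟨ +-cong (+-cong (square-coefficient (a zero) (h zero zero)) (double-≈ (𝟐.*-zero (a zero) cross)))
      (norm-combination (a ∘ suc) (v ∘ suc) (λ i j → h (suc i) (suc j))) ⟩
  a zero * (v zero · v zero) + + 0 + ∑ (λ i → a (suc i) * (v (suc i) · v (suc i)))
    ≡⟨ trans (cong (_+ ∑ (λ i → a (suc i) * (v (suc i) · v (suc i)))) (ℤP.+-identityʳ (a zero * (v zero · v zero))))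
      (sym (∑-∷ (λ i → a i * (v i · v i)))) ⟩
  ∑ (λ i → a i * (v i · v i)) ∎
  where
  open Mod (+ 4)
  open ≈-Reasoning
  u w : Vector _
  u t = ∑ (λ i → a i * v i t)
  w t = ∑ (λ i → a (suc i) * v (suc i) t)
  split : ∀ t → u t ≡ w t + a zero * v zero t
  split t = trans (∑-∷ (λ i → a i * v i t)) (ℤP.+-comm (a zero * v zero t) (w t))
  expand : ∀ x → x · u ≡ x · w + a zero * (x · v zero)
  expand x = trans (·-congʳ x split) (·-linearʳ x w (v zero) (a zero))
  regroup : ∀ ww a vv wv vw → wv ≡ vw → ww + a * wv + a * (vw + a * vv) ≡ a * a * vv + + 2 * (a * vw) + ww
  regroup ww a vv wv _ refl = lem ww a vv wv
    where
    lem : ∀ x a y z → x + a * z + a * (z + a * y) ≡ a * a * y + + 2 * (a * z) + x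
    lem = solve-∀
  cross : v zero · w 𝟐.≈ + 0
  cross = 𝟐.≈-trans (𝟐.≈-reflexive (·-∑ (v zero) (a ∘ suc) (v ∘ suc)))
    (𝟐.∑-≈0 λ i → 𝟐.*-zero (a (suc i)) (h zero (suc i)))
  square-coefficient : ∀ a {x} → x 𝟐.≈ + 0 → a * a * x ≈ a * x
  square-coefficient a {x} hx = congruent (subst (+ 4 ∣_) (lem a x)
    (product-∣ (𝟐.≈0⇒∣ hx) (difference (square≈self a))))
    where
    lem : ∀ a x → x * (a * a - a) ≡ a * a * x - a * x
    lem = solve-∀
    product-∣ : ∀ {x y} → + 2 ∣ x → + 2 ∣ y → + 4 ∣ x * y
    product-∣ {x} {y} p q = ℤS.∣-trans (ℤS.*-monoʳ-∣ (+ 2) q) (ℤS.*-monoˡ-∣ y p)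

-- With u = v + 2b, the cross term 2(v · 2b) and the square of 2b are both multiples of 4.
norm-≈ : ∀ {n} {u v : Vector n} → (∀ i → u i 𝟐.≈ v i) → u · u ≈ v · v [mod + 4 ]
norm-≈ {n} {u} {v} h = ≈-trans (≈-reflexive (trans (·-congˡ u u≡) (trans (·-linearˡ u v b (+ 2))
    (trans (cong₂ (λ s t → s + + 2 * t) (expand v) (expand b))
      (regroup (v · v) (v · b) (b · v) (b · b) (·-comm b v))))))
  (congruent (divides (v · b + b · b) (lem (v · v) (v · b + b · b))))
  where
  open Mod (+ 4)
  b : Vector n
  b i = _∣_.quotient (difference (h i))
  u≡ : ∀ i → u i ≡ v i + + 2 * b i
  u≡ i = trans (step (u i) (v i)) (cong (_+_ (v i)) (trans (_∣_.equality (difference (h i))) (ℤP.*-comm (b i) (+ 2))))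
    where
    step : ∀ u v → u ≡ v + (u - v)
    step = solve-∀
  expand : ∀ x → x · u ≡ x · v + + 2 * (x · b)
  expand x = trans (·-congʳ x u≡) (·-linearʳ x v b (+ 2))
  regroup : ∀ vv vb bv bb → bv ≡ vb → vv + + 2 * vb + + 2 * (bv + + 2 * bb) ≡ vv + + 4 * (vb + bb)
  regroup vv vb _ bb refl = step vv vb bb
    where
    step : ∀ a b c → a + + 2 * b + + 2 * (b + + 2 * c) ≡ a + + 4 * (b + c)
    step = solve-∀
  lem : ∀ a c → a + + 4 * c - a ≡ c * + 4
  lem = solve-∀

-- Oddness of the level

module TwoConjugation {n} {A : Mat n} (skA : Skew A) (k ε : ℕ) (n≡ : n ≡ ε ℕ.+ (k ℕ.+ k)) (ε≤1 : ε ≡ 0 ⊎ ε ≡ 1)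
  (m : ℤ) (detW : det (walks A) ≡ + (2 ℕ.^ k) * m) (m-odd : ¬ (+ 2 ∣ m)) where
  open TwoPart skA k ε n≡ ε≤1 m detW m-odd
  open Scaling scaling
  open 𝟐
  open Moments skA
  open Polynomial A
  open PolynomialMod (+ 2)
  private module 𝟒 = Mod (+ 4)

  iterate-≈ : ∀ j {u v : Vector n} → (∀ i → u i ≈ v i) → ∀ i → iterate A j u i ≈ iterate A j v i
  iterate-≈ zero    h = h
  iterate-≈ (suc j) h = ⊙-≈ (iterate-≈ j h)

  iterate-poly : ∀ j {l} (a : Vector l) i → iterate A j (poly a 𝟏) i ≡ poly a (walk A j) i
  iterate-poly zero    a i = refl
  iterate-poly (suc j) a i = trans (⊙-cong A (iterate-poly j a) i) (sym (poly-⊙ a (walk A j) i))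

  -- With y ≡ Σ aₗ Sˡ𝟏 modulo 2, the vector z = Σ aₗ S²ˡ𝟏 satisfies 𝟏ᵀS²ʲz ≡ ± |Sʲy|² modulo 4.
  isotropic⇒zero : ∀ y → (∀ i → walk A i · y ≈ + 0) → (∀ j → iterate A j y · iterate A j y 𝟒.≈ + 0) → ∀ i → y i ≈ + 0
  isotropic⇒zero y y⊥ yy = go minimal-relation
    where
    go : (∃ λ e → InSpan e (walk A e) × (∀ l → l ℕ.< e → l ℕ.+ l ℕ.< n)) → ∀ i → y i ≈ + 0
    go (e , span , bound) = conclude (extend (orthogonal⇒image y (λ i → y⊥ (toℕ i))))
      where
      extend : (∃ λ (a : Vector n) → ∀ i → y i ≈ poly a 𝟏 i) → InSpan e y
      extend (a , q) = proj₁ (reduce span a) , λ i → ≈-trans (q i) (proj₂ (reduce span a) i)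
      -- The doubling l ↦ 2l, in range by the bound of `minimal-relation`.
      ι : Fin e → Fin n
      ι l = fromℕ< (bound (toℕ l) (FinP.toℕ<n l))
      toℕ-ι : ∀ l → toℕ (ι l) ≡ toℕ l ℕ.+ toℕ l
      toℕ-ι l = FinP.toℕ-fromℕ< (bound (toℕ l) (FinP.toℕ<n l))
      ι-injective : ∀ {l l′} → ι l ≡ ι l′ → l ≡ l′
      ι-injective {l} {l′} q = FinP.toℕ-injective
        (double-injective (toℕ l) (toℕ l′) (trans (sym (toℕ-ι l)) (trans (cong toℕ q) (toℕ-ι l′))))
        where
        double-injective : ∀ a b → a ℕ.+ a ≡ b ℕ.+ b → a ≡ b
        double-injective zero    zero    q = refl
        double-injective (suc a) (suc b) q = cong suc (double-injective a b
          (ℕP.suc-injective (trans (sym (ℕP.+-suc a a)) (trans (ℕP.suc-injective q) (ℕP.+-suc b b)))))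
      conclude : InSpan e y → ∀ i → y i ≈ + 0
      conclude (a , q) i = ≈-trans (q i) (≈-trans (≈-reflexive (poly-walk a 0 i))
        (∑-≈0 λ l → *-zero (walk A (toℕ l) i) (a≈0 l)))
        where
        -- The coordinates of z in the walk vectors: a l at position 2l and 0 elsewhere.
        ã : Vector n
        ã j = ∑ (λ l → a l * δ (ι l) j)
        ã-ι : ∀ l → ã (ι l) ≡ a l
        ã-ι l = trans (∑-single l (λ l′ → a l′ * δ (ι l′) (ι l))
          (λ l′ l′≢l → trans (cong (a l′ *_) (δ-≢ (l′≢l ∘ ι-injective))) (ℤP.*-zeroʳ (a l′))))
                      (trans (cong (a l *_) (δ-refl (ι l))) (ℤP.*-identityʳ (a l)))
        Gã : ∀ i → (λ j → walk A (toℕ i) · walk A (toℕ j)) · ã ≡ ∑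
          (λ l → a l * (walk A (toℕ i) · walk A (toℕ l ℕ.+ toℕ l)))
        Gã i = trans (·-∑ (λ j → walk A (toℕ i) · walk A (toℕ j)) a (λ l → δ (ι l))) (∑-cong λ l → cong (a l *_)
          (trans (·-comm (λ j → walk A (toℕ i) · walk A (toℕ j)) (δ (ι l)))
            (trans (∑-δˡ (ι l) _) (cong (λ x → walk A (toℕ i) · walk A x) (toℕ-ι l)))))
        -- The row with r = 1 is needed modulo 2 only, where the moments 2l and l agree, so the sum
        -- becomes 𝟏 · y.
        first-row : ∑ (λ l → a l * (walk A 0 · walk A (toℕ l ℕ.+ toℕ l))) ≈ + 0
        first-row = begin
          ∑ (λ l → a l * (𝟏 · walk A (toℕ l ℕ.+ toℕ l)))
            ≈⟨ ∑-≈ (λ l → *-congˡ (a l) (≈-trans (≈-reflexive (·-comm 𝟏 (walk A (toℕ l ℕ.+ toℕ l))))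
            (≈-trans (moment-double (toℕ l)) (≈-reflexive (·-comm (walk A (toℕ l)) 𝟏))))) ⟩
          ∑ (λ l → a l * (𝟏 · walk A (toℕ l))) ≡⟨ ·-∑ 𝟏 a (λ l → walk A (toℕ l)) ⟨
          𝟏 · (λ t → ∑ (λ l → a l * walk A (toℕ l) t)) ≡⟨ ·-congʳ 𝟏
            (λ t → trans (∑-cong λ l → ℤP.*-comm (a l) (walk A (toℕ l) t)) (sym (poly-walk a 0 t))) ⟩
          𝟏 · poly a 𝟏 ≈⟨ ·-≈ʳ 𝟏 q ⟨
          𝟏 · y ≈⟨ y⊥ 0 ⟩
          + 0 ∎
          where open ≈-Reasoning
        -- Each product is ±|Sʲ⁺ˡ𝟏|², whose sign is invisible modulo 4 because the norm is even;
        -- `norm-combination` assembles these norms into |Sʲy|².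
        even-row : ∀ j → (j ℕ.+ j ≡ 0 → moment A 0 ≈ + 0) → ∑
          (λ l → a l * (walk A (j ℕ.+ j) · walk A (toℕ l ℕ.+ toℕ l))) 𝟒.≈ + 0
        even-row j even = begin
          ∑ (λ l → a l * (walk A (j ℕ.+ j) · walk A (toℕ l ℕ.+ toℕ l))) ≈⟨ 𝟒.∑-≈ (λ l → 𝟒.*-congˡ (a l) (square l)) ⟩
          ∑ (λ l → a l * (walk A (j ℕ.+ toℕ l) · walk A (j ℕ.+ toℕ l))) ≈⟨ norm-combination a
            (λ l → walk A (j ℕ.+ toℕ l)) (λ l l′ → gram-even (j ℕ.+ toℕ l) (j ℕ.+ toℕ l′) (even′ l l′)) ⟨
          ŷ · ŷ ≈⟨ norm-≈ (λ t → ≈-trans (≈-reflexive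
            (trans (∑-cong λ l → ℤP.*-comm (a l) (walk A (j ℕ.+ toℕ l) t))
            (trans (sym (poly-walk a j t)) (sym (iterate-poly j a t))))) (≈-sym (iterate-≈ j q t))) ⟩
          iterate A j y · iterate A j y ≈⟨ yy j ⟩
          + 0 ∎
          where
          open 𝟒.≈-Reasoning
          ŷ : Vector n
          ŷ t = ∑ (λ l → a l * walk A (j ℕ.+ toℕ l) t)
          even′ : ∀ l l′ → j ℕ.+ toℕ l ℕ.+ (j ℕ.+ toℕ l′) ≡ 0 → moment A 0 ≈ + 0
          even′ l l′ h = even (cong (λ x → x ℕ.+ x) (ℕP.m+n≡0⇒m≡0 j (ℕP.m+n≡0⇒m≡0 (j ℕ.+ toℕ l) h)))
          square : ∀ l → walk A (j ℕ.+ j) · walk A (toℕ l ℕ.+ toℕ l) 𝟒.≈ walk A (j ℕ.+ toℕ l) · walk A (j ℕ.+ toℕ l)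
          square l = 𝟒.≈-trans (𝟒.≈-reflexive (trans (gram skA (j ℕ.+ j) (toℕ l ℕ.+ toℕ l))
            (trans (cong (_* moment A (j ℕ.+ j ℕ.+ (toℕ l ℕ.+ toℕ l))) (sgn-double j))
              (trans (ℤP.*-identityˡ _) (cong (moment A) (ℕ-interchange j j (toℕ l) (toℕ l)))))))
            (𝟒.≈-trans (𝟒.≈-sym (unsign (j ℕ.+ toℕ l) (moment-even _ λ h → even′ l l h)))
              (𝟒.≈-reflexive (sym (gram skA (j ℕ.+ toℕ l) (j ℕ.+ toℕ l)))))
            where
            unsign : ∀ s {x} → x ≈ + 0 → sgn s * x 𝟒.≈ x
            unsign s {x} h = [ (λ e → 𝟒.≈-reflexive (trans (cong (_* x) e) (ℤP.*-identityˡ x)))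
                             , (λ e → 𝟒.≈-trans (𝟒.≈-reflexive (trans (cong (_* x) e) (lem x)))
                               (𝟒.≈-trans (𝟒.+-cong (𝟒.≈-refl {x}) (𝟒.neg-cong (double-≈ h)))
                               (𝟒.≈-reflexive (ℤP.+-identityʳ x)))) ]′ (sgn-cases s)
              where
              lem : ∀ x → - + 1 * x ≡ x + - (+ 2 * x)
              lem = solve-∀
        odd-row : ∀ j → ∑ (λ l → a l * (walk A (suc (j ℕ.+ j)) · walk A (toℕ l ℕ.+ toℕ l))) ≡ + 0
        odd-row j = ∑-zero λ l → trans (cong (a l *_) (trans (gram skA (suc (j ℕ.+ j)) (toℕ l ℕ.+ toℕ l))
          (trans (cong (sgn (suc (j ℕ.+ j)) *_) (trans (cong (moment A ∘ suc) (ℕ-interchange j j (toℕ l) (toℕ l)))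
            (moment-odd (j ℕ.+ toℕ l)))) (ℤP.*-zeroʳ (sgn (suc (j ℕ.+ j))))))) (ℤP.*-zeroʳ (a l))
        row-∣ : ∀ i → r i * + 2 ∣ ∑ (λ l → a l * (walk A (toℕ i) · walk A (toℕ l ℕ.+ toℕ l)))
        row-∣ i = [ (λ { (r≡1 , i≡0) → subst₂ (λ s t → s * + 2 ∣ ∑
          (λ l → a l * (walk A t · walk A (toℕ l ℕ.+ toℕ l)))) (sym r≡1) (sym i≡0) (≈0⇒∣ first-row) })
                  , (λ { (r≡2 , even) → subst (λ s → s * + 2 ∣ ∑
                    (λ l → a l * (walk A (toℕ i) · walk A (toℕ l ℕ.+ toℕ l)))) (sym r≡2)
                    (quarter (toℕ i) even (halve (toℕ i))) }) ]′ (cases i)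
          where
          quarter : ∀ t → (t ≡ 0 → moment A 0 ≈ + 0) → (∃ λ s → t ≡ s ℕ.+ s ⊎ t ≡ suc (s ℕ.+ s)) → + 4 ∣ ∑
            (λ l → a l * (walk A t · walk A (toℕ l ℕ.+ toℕ l)))
          quarter t even (j , inj₁ refl) = 𝟒.≈0⇒∣ (even-row j even)
          quarter t even (j , inj₂ refl) = 𝟒.≈0⇒∣ (𝟒.≈-reflexive (odd-row j))
        a≈0 : ∀ l → a l ≈ + 0
        a≈0 l = ≈-trans (≈-reflexive (sym (ã-ι l)))
          (gram-kernel ã (λ i → subst (r i * + 2 ∣_) (sym (Gã i)) (row-∣ i)) (ι l))

  -- For a column y = N e_c, Sʲy = N Bʲe_c has squared norm d²|Bʲe_c|², a multiple of 4 when d is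
  -- even.
  even-level⇒even : ∀ {B : Mat n} → Skew B → ∀ {d N} → Conjugation A B d N → + 2 ∣ d → ∀ i c → N i c ≈ + 0
  even-level⇒even {B} skB {d} {N} C 2∣d i c = isotropic⇒zero (col N c) orth norms i
    where
    open Conjugated C
    orth : ∀ t → walk A t · col N c ≈ + 0
    orth t = ∣⇒≈0 (subst (+ 2 ∣_) (sym (trans (·-comm (walk A t) (col N c)) (col-walk skA skB t c)))
      (ℤS.∣m⇒∣m*n (walk B t c) 2∣d))
    iterate-cong : ∀ j {u v : Vector n} → (∀ i → u i ≡ v i) → ∀ i → iterate A j u i ≡ iterate A j v i
    iterate-cong zero    h = h
    iterate-cong (suc j) h = ⊙-cong A (iterate-cong j h)
    norms : ∀ j → iterate A j (col N c) · iterate A j (col N c) 𝟒.≈ + 0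
    norms j = 𝟒.∣⇒≈0 (subst (+ 4 ∣_) (sym (trans (∑-cong λ t → cong₂ _*_ (rewritten t) (rewritten t))
      (isometry (iterate B j (λ t → δ t c)) (iterate B j (λ t → δ t c)))))
      (ℤS.∣m⇒∣m*n _ (ℤS.∣-trans (ℤS.*-monoʳ-∣ (+ 2) 2∣d) (ℤS.*-monoˡ-∣ d 2∣d))))
      where
      rewritten : ∀ t → iterate A j (col N c) t ≡ (N ⊙ iterate B j (λ t → δ t c)) t
      rewritten t = trans (iterate-cong j (λ i → sym (col-⊙ c i)) t) (iterate-commutes j (λ t → δ t c) t)

-- The conjugation to the converse

integral : ∀ q → IntegralQ q → toℚ (ℚ.numerator q) ≡ q
integral q h = trans (ℚP./-cong {ℚ.numerator q} {1} {ℚ.numerator q} {ℚ.denominatorℕ q} refl (sym (ℤP.+-injective h)))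
  (ℚP.↥p/↧p≡p q)

module _ {n} (Γ : OGraph n) {Q₀ : QMat n} (reg : RegularQ n Q₀) (orth : OrthogonalQ n Q₀) (conj : ConjToConverse n Γ Q₀)
         {ℓ₀ : ℕ} (ℓ₀>0 : 0 ℕ.< ℓ₀) (scales : ScalesToIntegral n Q₀ ℓ₀) where
  private
    ℓ = + ℓ₀
    L = toℚ ℓ

    N₀ : Mat n
    N₀ i j = ℚ.numerator (L ℚ.* Q₀ i j)

    N₀≡ : ∀ i j → toℚ (N₀ i j) ≡ L ℚ.* Q₀ i j
    N₀≡ i j = integral (L ℚ.* Q₀ i j) (scales i j)

    ℓ≢0 : ℓ ≢ + 0
    ℓ≢0 h = ℕP.<⇒≢ ℓ₀>0 (sym (ℤP.+-injective h))

    toℚ-δ : ∀ i j → idQ n i j ≡ toℚ (δ i j)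
    toℚ-δ i j with i ≟ j
    ... | yes _ = refl
    ... | no _  = refl

    factor : ∀ a x y → a ℚ.* x ℚ.* (a ℚ.* y) ≡ a ℚ.* a ℚ.* (x ℚ.* y)
    factor = solve 3 (λ a x y → a :* x :* (a :* y) := a :* a :* (x :* y)) refl
      where open +-*-Solver

    N₀-orthogonal : ∀ i j → col N₀ i · col N₀ j ≡ ℓ * ℓ * δ i j
    N₀-orthogonal i j = toℚ-injective (begin
      toℚ (col N₀ i · col N₀ j) ≡⟨ toℚ-∑ n (λ k → N₀ k i * N₀ k j) ⟩
      sumR ℚops n (λ k → toℚ (N₀ k i * N₀ k j)) ≡⟨ sumℚ-cong n
        (λ k → trans (toℚ-* (N₀ k i) (N₀ k j)) (trans (cong₂ ℚ._*_ (N₀≡ k i) (N₀≡ k j)) (factor L (Q₀ k i) (Q₀ k j)))) ⟩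
      sumR ℚops n (λ k → L ℚ.* L ℚ.* (Q₀ k i ℚ.* Q₀ k j)) ≡⟨ *-distribˡ-sumℚ n (L ℚ.* L) (λ k → Q₀ k i ℚ.* Q₀ k j) ⟨
      L ℚ.* L ℚ.* sumR ℚops n (λ k → Q₀ k i ℚ.* Q₀ k j) ≡⟨ cong₂ ℚ._*_ (sym (toℚ-* ℓ ℓ))
        (trans (orth i j) (toℚ-δ i j)) ⟩
      toℚ (ℓ * ℓ) ℚ.* toℚ (δ i j) ≡⟨ toℚ-* (ℓ * ℓ) (δ i j) ⟨
      toℚ (ℓ * ℓ * δ i j) ∎)
      where open ≡-Reasoning

    N₀-rows : ∀ i → (N₀ ⊙ 𝟏) i ≡ ℓ
    N₀-rows i = toℚ-injective (begin
      toℚ (N₀ i · 𝟏) ≡⟨ cong toℚ (∑-cong λ j → ℤP.*-identityʳ (N₀ i j)) ⟩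
      toℚ (∑ (N₀ i)) ≡⟨ toℚ-∑ n (N₀ i) ⟩
      sumR ℚops n (λ j → toℚ (N₀ i j)) ≡⟨ sumℚ-cong n (N₀≡ i) ⟩
      sumR ℚops n (λ j → L ℚ.* Q₀ i j) ≡⟨ *-distribˡ-sumℚ n L (Q₀ i) ⟨
      L ℚ.* sumR ℚops n (Q₀ i) ≡⟨ cong (L ℚ.*_) (reg i) ⟩
      L ℚ.* ℚ.1ℚ ≡⟨ ℚP.*-identityʳ L ⟩
      toℚ ℓ ∎)
      where open ≡-Reasoning

    -- `RegularQ` speaks of row sums; the column sums come from ℓN₀ᵀ𝟏 = N₀ᵀ(N₀𝟏) = ℓ²𝟏.
    N₀-columns : ∀ i → col N₀ i · 𝟏 ≡ ℓ
    N₀-columns i = *-cancelˡ-≢0 ℓ≢0 _ _ (begin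
      ℓ * (col N₀ i · 𝟏) ≡⟨ ·-scaleʳ ℓ (col N₀ i) 𝟏 ⟨
      col N₀ i · (λ k → ℓ * + 1) ≡⟨ ·-congʳ (col N₀ i) (λ k → trans (ℤP.*-identityʳ ℓ) (sym (N₀-rows k))) ⟩
      ((N₀ ᵀ) ⊙ (N₀ ⊙ 𝟏)) i ≡⟨ ⊙-assoc (N₀ ᵀ) N₀ 𝟏 i ⟨
      (((N₀ ᵀ) ⊗ N₀) ⊙ 𝟏) i ≡⟨ ·-congˡ 𝟏 (N₀-orthogonal i) ⟩
      (((ℓ * ℓ) ∙ δ) ⊙ 𝟏) i ≡⟨ ∙δ-⊙ (ℓ * ℓ) 𝟏 i ⟩
      ℓ * ℓ * + 1 ≡⟨ ℤP.*-identityʳ (ℓ * ℓ) ⟩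
      ℓ * ℓ ∎)
      where open ≡-Reasoning

    N₀-conjugates : ∀ i j → col N₀ i · (S Γ ⊙ col N₀ j) ≡ ℓ * ℓ * neg (S Γ) i j
    N₀-conjugates i j = toℚ-injective (begin
      toℚ (col N₀ i · (S Γ ⊙ col N₀ j)) ≡⟨ cong toℚ (∑-assoc (col N₀ i) (S Γ) (col N₀ j)) ⟨
      toℚ (∑ (λ b → ∑ (λ a → N₀ a i * S Γ a b) * N₀ b j)) ≡⟨ toℚ-∑ n _ ⟩
      sumR ℚops n (λ b → toℚ (∑ (λ a → N₀ a i * S Γ a b) * N₀ b j)) ≡⟨ sumℚ-cong n
        (λ b → trans (toℚ-* (∑ (λ a → N₀ a i * S Γ a b)) (N₀ b j))
        (trans (cong₂ ℚ._*_ (inner-sum b) (N₀≡ b j)) (factor L (M b) (Q₀ b j)))) ⟩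
      sumR ℚops n (λ b → L ℚ.* L ℚ.* (M b ℚ.* Q₀ b j)) ≡⟨ *-distribˡ-sumℚ n (L ℚ.* L) (λ b → M b ℚ.* Q₀ b j) ⟨
      L ℚ.* L ℚ.* sumR ℚops n (λ b → M b ℚ.* Q₀ b j) ≡⟨ cong₂ ℚ._*_ (sym (toℚ-* ℓ ℓ))
        (trans (conj i j) (cong toℚ (skew Γ j i))) ⟩
      toℚ (ℓ * ℓ) ℚ.* toℚ (- S Γ i j) ≡⟨ toℚ-* (ℓ * ℓ) (- S Γ i j) ⟨
      toℚ (ℓ * ℓ * neg (S Γ) i j) ∎)
      where
      open ≡-Reasoning
      M : Fin n → ℚ
      M b = sumR ℚops n (λ a → Q₀ a i ℚ.* toℚ (S Γ a b))
      inner-sum : ∀ b → toℚ (∑ (λ a → N₀ a i * S Γ a b)) ≡ L ℚ.* M b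
      inner-sum b = trans (toℚ-∑ n (λ a → N₀ a i * S Γ a b)) (trans (sumℚ-cong n λ a →
        trans (toℚ-* (N₀ a i) (S Γ a b)) (trans (cong (ℚ._* toℚ (S Γ a b)) (N₀≡ a i))
          (ℚP.*-assoc L (Q₀ a i) (toℚ (S Γ a b)))))
        (sym (*-distribˡ-sumℚ n L (λ a → Q₀ a i ℚ.* toℚ (S Γ a b)))))

  converse-conjugation : ∃ λ N → Conjugation (S Γ) (neg (S Γ)) (+ ℓ₀) N
  converse-conjugation = N₀ , record
    { nonzero = ℓ≢0 ; orthogonal = N₀-orthogonal ; regular = N₀-columns ; conjugates = N₀-conjugates }

-- Levels of generalized cospectral graphs

prime-∣-power : ∀ {p} → Prime p → ∀ k → + p ∣ + (2 ℕ.^ k) → p ≡ 2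
prime-∣-power {p} pr zero    h = ⊥-elim (ModPrime.1≉0 p pr (Mod.∣⇒≈0 (+ p) h))
prime-∣-power {p} pr (suc k) h = [ divides-2 , prime-∣-power pr k ]′
  (prime-∣-* pr (+ 2) (+ (2 ℕ.^ k)) (subst (+ p ∣_) (ℤP.pos-* 2 (2 ℕ.^ k)) h))
  where
  divides-2 : + p ∣ + 2 → p ≡ 2
  divides-2 q = [ (λ e → ⊥-elim (¬prime[1] (subst Prime e pr))) , id ]′ (prime⇒irreducible prime[2] (ℤS.∣⇒∣ᵤ q))

module Bound (n : ℕ) (Γ : OGraph n) (inG : InG n Γ) where
  private
    A = S Γ
    skA = skew Γ
    m = proj₁ inG
    k = n ℕDM./ 2

    m-odd : ¬ (+ 2 ∣ m)
    m-odd h = proj₁ (proj₂ (proj₂ inG)) (ℤS.∣⇒∣ᵤ h)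

    detW : det (walks A) ≡ + (2 ℕ.^ k) * m
    detW = trans (det-cong λ i j → sym (powVec-walk n A (toℕ j) i))
      (trans (det-detℤ (walkMatrix n Γ)) (proj₁ (proj₂ inG)))

    det≢0 : det (walks A) ≢ + 0
    det≢0 h = [ (λ q → ℕ.≢-nonZero⁻¹ (2 ℕ.^ k) {{ℕP.m^n≢0 2 k}} (ℤP.+-injective q)) ,
      (λ q → m-odd (subst (+ 2 ∣_) (sym q) (divides (+ 0) refl))) ]′
      (ℤP.i*j≡0⇒i≡0∨j≡0 (+ (2 ℕ.^ k)) (trans (sym detW) h))

    p²∤det : ∀ {p} → Prime p → p ≢ 2 → ¬ (+ p * + p ∣ det (walks A))
    p²∤det {p} pr p≢2 h = ¬prime[1] (subst Prime
      (proj₂ (proj₂ (proj₂ inG)) p (subst (ℕD._∣ ℤ.∣ m ∣) (ℤP.abs-* (+ p) (+ p))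
      (ℤS.∣⇒∣ᵤ (prime²-cancel pr (λ q → p≢2 (prime-∣-power pr k q)) (subst (+ p * + p ∣_) detW h))))) pr)

    n≡ : n ≡ n ℕDM.% 2 ℕ.+ (k ℕ.+ k)
    n≡ = trans (ℕDM.m≡m%n+[m/n]*n n 2) (cong (n ℕDM.% 2 ℕ.+_)
      (trans (ℕP.*-comm k 2) (cong (k ℕ.+_) (ℕP.+-identityʳ k))))

    ε≤1 : n ℕDM.% 2 ≡ 0 ⊎ n ℕDM.% 2 ≡ 1
    ε≤1 = below-2 (n ℕDM.% 2) (ℕDM.m%n<n n 2)
      where
      below-2 : ∀ r → r ℕ.< 2 → r ≡ 0 ⊎ r ≡ 1
      below-2 0 _ = inj₁ refl
      below-2 1 _ = inj₂ refl
      below-2 (suc (suc r)) (ℕ.s≤s (ℕ.s≤s ()))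

  record Reduced (Δ : OGraph n) : Set where
    field
      d           : ℤ
      N           : Mat n
      conjugation : Conjugation A (S Δ) d N
      isPrimitive : Primitive d N

  reduced : ∀ Δ → GenCospectral n Γ Δ → Reduced Δ
  reduced Δ cosp = package (primitive-conjugation (conjugation-from-moments skA (skew Δ) moments det′≢0))
    where
    moments = cospectral-moments n Γ Δ cosp
    -- Equal moments give equal Gram matrices WᵀW, hence equal squares of the walk determinants.
    det′≢0 : det (walks (S Δ)) ≢ + 0
    det′≢0 h = *-≢0 det≢0 det≢0 (begin
      det (walks A) * det (walks A) ≡⟨ cong (_* det (walks A)) (det-ᵀ (walks A)) ⟨
      det ((walks A) ᵀ) * det (walks A) ≡⟨ det-⊗ ((walks A) ᵀ) (walks A) ⟨
      det ((walks A) ᵀ ⊗ walks A) ≡⟨ det-cong (λ i j → trans (gram skA (toℕ i) (toℕ j))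
        (trans (cong (sgn (toℕ i) *_) (moments (toℕ i ℕ.+ toℕ j))) (sym (gram (skew Δ) (toℕ i) (toℕ j))))) ⟩
      det ((walks (S Δ)) ᵀ ⊗ walks (S Δ)) ≡⟨ det-⊗ ((walks (S Δ)) ᵀ) (walks (S Δ)) ⟩
      det ((walks (S Δ)) ᵀ) * det (walks (S Δ)) ≡⟨ cong (det ((walks (S Δ)) ᵀ) *_) h ⟩
      det ((walks (S Δ)) ᵀ) * + 0 ≡⟨ ℤP.*-zeroʳ (det ((walks (S Δ)) ᵀ)) ⟩
      + 0 ∎)
      where open ≡-Reasoning
    package : (∃ λ d → ∃ λ N → Conjugation A (S Δ) d N × Primitive d N × _) → Reduced Δ
    package (d , N , C , P , _) = record { d = d ; N = N ; conjugation = C ; isPrimitive = P }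

  odd-level : ∀ {Δ} (R : Reduced Δ) → ¬ (+ 2 ∣ Reduced.d R)
  odd-level {Δ} R 2∣d = contradict (isPrimitive 2 prime[2] 2∣d)
    where
    open Reduced R
    contradict : ¬ (∃ λ j → ∃ λ i → ¬ (+ 2 ∣ N i j))
    contradict (j , i , h) = h (𝟐.≈0⇒∣ (TwoConjugation.even-level⇒even skA k (n ℕDM.% 2) n≡ ε≤1 m detW m-odd
      (skew Δ) conjugation 2∣d i j))

  odd-divisor : ∀ {Δ} (R : Reduced Δ) {p} → + p ∣ Reduced.d R → p ≢ 2
  odd-divisor R h refl = odd-level R h

  2≉0 : ∀ {p} (pr : Prime p) → p ≢ 2 → ¬ (+ 2 ≈ + 0 [mod + p ])
  2≉0 {p} pr p≢2 h = p≢2 (prime-∣-power pr 1 (Mod.≈0⇒∣ (+ p) h))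

  squarefree-level : ∀ {Δ} (R : Reduced Δ) {p} → Prime p → p ≢ 2 → ¬ (+ p * + p ∣ Reduced.d R)
  squarefree-level {Δ} R {p} pr p≢2 h = contradict (isPrimitive p pr (ℤS.∣-trans (divides (+ p) refl) h))
    where
    open Reduced R
    contradict : ¬ (∃ λ j → ∃ λ i → ¬ (+ p ∣ N i j))
    contradict (j , i , ¬q) = ¬q (Mod.≈0⇒∣ (+ p)
      (OddConjugation.square-divisor⇒zero skA p pr (p²∤det pr p≢2) (skew Δ) conjugation h i j))

  -- If p ∤ ℓ, `converse-level` makes N vanish modulo p, against primitivity.
  level-divides : ∀ {ℓ N₀} → Conjugation A (neg A) ℓ N₀ → ∀ {Δ} (R : Reduced Δ) {p} → Prime p → + p ∣ Reduced.d R → +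
    p ∣ ℓ
  level-divides {ℓ} C₀ {Δ} R {p} pr p∣d = decide (+ p ℤS.∣? ℓ)
    where
    open Reduced R
    p≢2 = odd-divisor R p∣d
    contradict : ¬ (+ p ∣ ℓ) → ¬ (∃ λ j → ∃ λ i → ¬ (+ p ∣ N i j))
    contradict p∤ℓ (j , i , ¬q) = ¬q (Mod.≈0⇒∣ (+ p)
      (OddConjugation.converse-level skA p pr (p²∤det pr p≢2) (skew Δ) conjugation C₀ (2≉0 pr p≢2) p∤ℓ p∣d i j))
    decide : Dec (+ p ∣ ℓ) → + p ∣ ℓ
    decide (yes q) = q
    decide (no ¬q) = ⊥-elim (contradict ¬q (isPrimitive p pr p∣d))

  -- A prime dividing dd′ divides both factors, so `cross-divisible` applies to all pairs of
  -- columns, while square-freeness of d and d′ keeps p³ from dividing dd′.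
  same-primes⇒isomorphic : ∀ {Δ Δ′} (R : Reduced Δ) (R′ : Reduced Δ′) →
    (∀ p → Prime p → + p ∣ Reduced.d R → + p ∣ Reduced.d R′) →
      (∀ p → Prime p → + p ∣ Reduced.d R′ → + p ∣ Reduced.d R) →
    Isomorphic n Δ Δ′
  same-primes⇒isomorphic {Δ} {Δ′} R R′ to from = isomorphism-criterion R.conjugation R′.conjugation λ p pr p∣ →
      both p pr ([ (λ q → q , to p pr q) , (λ q → from p pr q , q) ]′ (prime-∣-* pr R.d R′.d p∣))
    where
    module R = Reduced R
    module R′ = Reduced R′
    both : ∀ p → Prime p → (+ p ∣ R.d × + p ∣ R′.d) → (∀ i j → + p * + p ∣ col R.N i · col R′.N j) × ¬
      (+ p * + p * + p ∣ R.d * R′.d)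
    both p pr (p∣d , p∣d′) = cross (R.isPrimitive p pr p∣d) (R′.isPrimitive p pr p∣d′) , cube
      where
      p≢2 = odd-divisor R p∣d
      instance
        p≢0 : ℤ.NonZero (+ p)
        p≢0 = prime⇒nonZero pr
      module 𝕆 = OddConjugation skA p pr (p²∤det pr p≢2)
      module 𝕄 = Mod (+ p)
      cross : (∃ λ j → ∃ λ i → ¬ (+ p ∣ R.N i j)) → (∃ λ j → ∃ λ i → ¬ (+ p ∣ R′.N i j)) → ∀ c c′ → + p * + p ∣ col
        R.N c · col R′.N c′
      cross (j , i , h) (j′ , i′ , h′) c c′ = Neighbours.cross-divisible skA p pr (p²∤det pr p≢2) (2≉0 pr p≢2)
        {x = col R.N j} {y = col R′.N j′} {u = col R.N c} {u′ = col R′.N c′} {i = i} {i′ = i′}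
        (λ t → 𝕆.column-killed (skew Δ) R.conjugation p∣d j (toℕ t))
          (λ t → 𝕆.column-killed (skew Δ′) R′.conjugation p∣d′ j′ (toℕ t))
        (λ t → 𝕆.column-killed (skew Δ) R.conjugation p∣d c (toℕ t))
          (λ t → 𝕆.column-killed (skew Δ′) R′.conjugation p∣d′ c′ (toℕ t))
        (λ q → h (𝕄.≈0⇒∣ q)) (λ q → h′ (𝕄.≈0⇒∣ q))
        (𝕆.p²∣columns (skew Δ) R.conjugation p∣d j j) (𝕆.p²∣columns (skew Δ′) R′.conjugation p∣d′ j′ j′)
        (𝕆.p²∣columns (skew Δ) R.conjugation p∣d c j) (𝕆.p²∣columns (skew Δ′) R′.conjugation p∣d′ c′ j′)
      cube : ¬ (+ p * + p * + p ∣ R.d * R′.d)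
      cube h = quotients p∣d p∣d′
        where
        quotients : + p ∣ R.d → + p ∣ R′.d → ⊥
        quotients (divides q q≡) (divides q′ q′≡) =
          [ (λ r → squarefree-level R pr p≢2 (subst (+ p * + p ∣_) (sym q≡) (ℤS.*-monoˡ-∣ (+ p) r)))
                                                    , (λ r → squarefree-level R′ pr p≢2 (subst (+ p * + p ∣_)
                                                      (sym q′≡) (ℤS.*-monoˡ-∣ (+ p) r))) ]′
          (prime-∣-* pr q q′ (ℤS.*-cancelˡ-∣ (+ p) (ℤS.*-cancelˡ-∣ (+ p) (subst₂ _∣_ (ℤP.*-assoc (+ p) (+ p) (+ p))
            (trans (cong₂ _*_ q≡ q′≡) (arith q q′ (+ p))) h))))
          where
          arith : ∀ q r p → q * p * (r * p) ≡ p * (p * (q * r))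
          arith = solve-∀

-- Counting the mates

allPairs-lookup : ∀ {X : Set} {R : X → X → Set} {xs} → AllPairs R xs → ∀ {i j} → toℕ i ℕ.< toℕ j → R (lookup xs i)
  (lookup xs j)
allPairs-lookup (x ∷ xs) {zero}  {suc j} i<j = All.lookup x (∈-lookup j)
allPairs-lookup (x ∷ xs) {suc i} {suc j} i<j = allPairs-lookup xs (ℕP.≤-pred i<j)

-- Codes are compared pointwise, and `funToFin` numbers them for the pigeonhole principle.
injective-code-bound : ∀ t l (code : Fin l → Fin t → Fin 2) →
                       (∀ {i j} → toℕ i ℕ.< toℕ j → ¬ (∀ s → code i s ≡ code j s)) → l ℕ.≤ 2 ℕ.^ t
injective-code-bound t l code distinct = ℕP.≮⇒≥ λ 2^t<l → collision (FinP.pigeonhole 2^t<l (funToFin ∘ code))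
  where
  collision : ¬ (∃ λ i → ∃ λ j → toℕ i ℕ.< toℕ j × funToFin (code i) ≡ funToFin (code j))
  collision (i , j , i<j , q) = distinct i<j λ s → trans (sym (FinP.finToFun-funToFin (code i) s))
    (trans (cong (λ x → finToFun x s) q) (FinP.finToFun-funToFin (code j) s))

theorem1p3 : (n : ℕ) (Γ : OGraph n) → InG n Γ →
    (Q₀ : QMat n) → RegularQ n Q₀ → OrthogonalQ n Q₀ → ConjToConverse n Γ Q₀ →
    (ℓ₀ t : ℕ) → IsLevel n Q₀ ℓ₀ → ProductOfDistinctOddPrimes ℓ₀ t →
    (mates : List (OGraph n)) → All (GenCospectralMate n Γ) mates →
    AllPairs (λ Δ Δ′ → ¬ Isomorphic n Δ Δ′) mates →
    length mates ≤ 2 ^ t ∸ 1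
theorem1p3 n Γ inG Q₀ reg orth conj ℓ₀ t (ℓ₀>0 , scales , _) (ps , primes , _ , _ , refl , refl) mates areMates
  distinct =
  -- The list `graphs` is one longer than `mates`, whence the subtracted 1.
  ℕP.∸-monoˡ-≤ 1 (injective-code-bound (length ps) (length graphs) code separated)
  where
  open Bound n Γ inG
  graphs = Γ ∷ mates
  cospectral : All (GenCospectral n Γ) graphs
  cospectral = (refl , refl) ∷ All.map proj₁ areMates
  nonisomorphic : AllPairs (λ Δ Δ′ → ¬ Isomorphic n Δ Δ′) graphs
  nonisomorphic = All.map proj₂ areMates ∷ distinct
  R : ∀ i → Reduced (lookup graphs i)
  R i = reduced (lookup graphs i) (All.lookup cospectral (∈-lookup i))
  bit : ∀ {X : Set} → Dec X → Fin 2
  bit (yes _) = suc zero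
  bit (no _)  = zero
  bit-transfer : ∀ {X Y : Set} (x : Dec X) (y : Dec Y) → bit x ≡ bit y → X → Y
  bit-transfer _       (yes y) _ _ = y
  bit-transfer (yes _) (no _)  () _
  bit-transfer (no ¬x) (no _)  _ x = ⊥-elim (¬x x)
  -- A graph is encoded by the set of primes in `ps` that divide its denominator.
  code : Fin (length graphs) → Fin (length ps) → Fin 2
  code i s = bit (+ lookup ps s ℤS.∣? Reduced.d (R i))
  -- A prime dividing the denominator divides ℓ₀, so it occurs in `ps` and is seen by the code.
  transfer-prime : ∀ i j → (∀ s → code i s ≡ code j s) → ∀ p → Prime p → + p ∣ Reduced.d (R i) → + p ∣ Reduced.d (R j)
  transfer-prime i j same p pr p∣d = at-index (factorisationHasAllPrimeFactors pr
      (ℤS.∣⇒∣ᵤ (level-divides (proj₂ (converse-conjugation Γ reg orth conj ℓ₀>0 scales)) (R i) pr p∣d)) primes)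
    where
    at-index : p ∈ ps → + p ∣ Reduced.d (R j)
    at-index p∈ps = subst (λ q → + q ∣ Reduced.d (R j)) (sym (lookup-index p∈ps))
      (bit-transfer (+ lookup ps s ℤS.∣? Reduced.d (R i)) (+ lookup ps s ℤS.∣? Reduced.d (R j)) (same s)
        (subst (λ q → + q ∣ Reduced.d (R i)) (lookup-index p∈ps) p∣d))
      where s = index p∈ps
  separated : ∀ {i j} → toℕ i ℕ.< toℕ j → ¬ (∀ s → code i s ≡ code j s)
  separated {i} {j} i<j same = allPairs-lookup nonisomorphic {i} {j} i<j
    (same-primes⇒isomorphic (R i) (R j) (transfer-prime i j same) (transfer-prime j i (sym ∘ same)))
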